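{- Let $\mathsf{N}_n$ be a uniformly random simplex tree-child network with $n$ taxa, and let $w_n$ be chosen uniformly at random among its leaves. There exists a deterministic infinite rooted network $(\hat{\mathsf{N}}^{\mathrm{lf}},\ell_0)$, namely the one constructed in the context, such that $(\mathsf{N}_n,w_n)\xrightarrow{d}(\hat{\mathsf{N}}^{\mathrm{lf}},\ell_0)$ in the local weak sense as $n\to\infty$.
   Context: A simplex tree-child network on a finite set $X$ is a finite directed acyclic graph $N=(V,E)$ with a root $o$ and with leaves bijectively labelled by $X$, such that: the root has (indegree, outdegree) $=(0,1)$; every vertex is reachable from $o$ by a directed path; every leaf has degree $(1,0)$; every vertex that is neither the root nor a leaf is either a tree vertex, of degree $(1,2)$, or a reticulation vertex, of degree $(2,1)$; (tree-child) every non-leaf vertex has at least one child that is a tree vertex or a leaf; (one-component) the unique child of every reticulation vertex is a leaf. Networks are considered up to isomorphism preserving leaf labels. $\mathsf{N}_n$ is uniform on the finite set of simplex tree-child networks with leaf label set $[n]$. Local neighbourhoods: for a directed graph $N$ and $v\in V(N)$, $U_R(N,v)$ is the subgraph induced by the vertices at undirected graph distance at most $R$ from $v$, rooted at $v$. Each vertex carries a mark giving its type in $N$ (root, tree vertex, reticulation, or leaf); leaf labels are ignored. $\cong$ denotes isomorphism of rooted directed marked graphs, i.e. a bijection of vertex sets preserving root, marks, edges and edge orientations. Local weak convergence $(N_n,v_n)\xrightarrow{d}(N,v)$ means $\mathbb{P}(U_R(N_n,v_n)\cong G)\to\mathbb{P}(U_R(N,v)\cong G)$ for every fixed $R\ge0$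 and every finite rooted directed marked graph $G$; for deterministic $(N,v)$ this is $\mathbb{P}(U_R(N_n,v_n)\cong U_R(N,v))\to1$ for every $R\ge0$. Construction. A bi-infinite spine is a bi-infinite directed path $\cdots\to x_{ -1}\to x_0\to x_1\to\cdots$ of tree vertices. To decorate a tree vertex $x$ means: give $x$ a new reticulation child $\rho(x)$; give $\rho(x)$ a new leaf child $\ell(x)$; and give $\rho(x)$ a second parent $w(x)$, which is a tree vertex on a new bi-infinite spine, all of whose vertices other than $w(x)$ are in turn decorated, recursively (the reticulation child of $w(x)$ is $\rho(x)$). All spines and vertices introduced at every level are pairwise distinct. The network $\hat{\mathcal{R}}$ has two disjoint bi-infinite spines $\cdots\to p_{ -1}\to p_0\to p_1\to\cdots$ and $\cdots\to q_{ -1}\to q_0\to q_1\to\cdots$, and a reticulation $\rho_0$ whose two parents are $p_0$ and $q_0$ and whose only child is a leaf $\ell_0$; every spine vertex $p_i,q_i$ with $i\ne0$ is decorated, while $p_0,q_0$ have $\rho_0$ as their only reticulation child. The leaf limit $\hat{\mathsf{N}}^{\mathrm{lf}}$ is the same directed graph $\hat{\mathcal{R}}$, but rooted at $\ell_0$. -}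

module Defs where

open import Data.Bool.Base using (Bool; true; false; T; if_then_else_)
open import Data.Bool.Properties using (T?) renaming (_≟_ to _≟ᵇ_)
open import Data.Empty using (⊥-elim)
open import Data.Fin.Base using (Fin; zero; suc; toℕ)
open import Data.Fin.Properties using (all?; any?; toℕ<n; toℕ-injective; *↔×) renaming (_≟_ to _≟ᶠ_)
open import Data.Fin.Subset using (Subset; ∣_∣)
open import Data.Integer.Base as ℤ using (ℤ; 0ℤ)
open import Data.List.Base as List using (List; []; _∷_; length; concatMap; cartesianProductWith; allFin; upTo; deduplicate)
open import Data.List.Membership.Propositional using (_∈_; lose; find)
open import Data.List.Membership.Propositional.Properties using (∈-cartesianProductWith⁺; ∈-allFin; ∈-upTo⁺; ∈-lookup)
import Data.List.Membership.Setoid.Properties as SetoidMembership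
open import Data.List.Relation.Unary.All as All using (All; []; _∷_)
open import Data.List.Relation.Unary.AllPairs using ([]; _∷_)
open import Data.List.Relation.Unary.Any as Any using (Any; here; there)
open import Data.List.Relation.Unary.Any.Properties as Anyₚ using (lookup-index)
open import Data.List.Relation.Unary.Unique.Propositional using (Unique)
import Data.List.Relation.Unary.Unique.Setoid as SetoidUnique
open import Data.List.Relation.Unary.Unique.DecSetoid.Properties using (deduplicate-!)
open import Data.Nat.Base using (ℕ; zero; suc; _+_; _*_; _≤_; _<_; z≤n; s≤s)
open import Data.Nat.Properties as ℕₚ using (+-*-semiring)
open import Data.Product.Base using (∃; _×_; _,_; proj₁; proj₂; uncurry)
open import Data.Product.Properties using (≡-dec)
open import Data.Sum.Base as Sum using (_⊎_; inj₁; inj₂)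
open import Data.Unit.Base using (tt)
open import Data.Vec.Base as Vec using (Vec; []; _∷_; tabulate)
open import Data.Vec.Properties using (lookup∘tabulate; tabulate-cong)
open import Function.Base using (_∘_; _on_)
open import Function.Bundles using (Inverse; Bijection; _↔_; _⇔_; mk⇔; mk↔ₛ′; module Equivalence)
open import Function.Definitions using (Congruent)
open import Function.Properties.Inverse using (↔-refl; ↔-sym; ↔-trans)
open import Level using (0ℓ)
open import Relation.Binary.Bundles using (Setoid; DecSetoid)
open import Relation.Binary.Core using (Rel)
open import Relation.Binary.Definitions using (Decidable; _Respects₂_)
open import Relation.Binary.Structures using (IsEquivalence)
import Relation.Binary.Construct.On as On
open import Relation.Binary.Construct.Closure.ReflexiveTransitive as Star using (Star; ε; _◅_)
open import Relation.Binary.Construct.Closure.Symmetric using (SymClosure)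
open import Relation.Binary.Construct.Closure.Transitive as Plus using (TransClosure; [_]; _∷_)
open import Relation.Binary.PropositionalEquality as ≡ using (_≡_; _≢_; _≗_; refl; sym; trans; cong; cong₂; subst)
open import Relation.Nullary using (¬_; Dec; yes; no; does; ¬?; contradiction; _×-dec_; _⊎-dec_; _→-dec_; map′)
open import Relation.Unary using (Pred)

data Mark : Set where
  root tree reticulation leaf : Mark

-- (indegree , outdegree)
degree : Mark → ℕ × ℕ
degree root         = 0 , 1
degree tree         = 1 , 2
degree reticulation = 2 , 1
degree leaf         = 1 , 0

-- Vertices form a setoid so that an induced subgraph can be carried by
-- Σ-types whose (possibly non-unique) membership proofs are ignored.
record MarkedGraph : Set₁ where
  infix 4 _⟶_
  field
    vertices : Setoid 0ℓ 0ℓ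
  open Setoid vertices public using (_≈_) renaming (Carrier to Vertex)
  field
    _⟶_       : Rel Vertex 0ℓ
    ⟶-resp-≈  : _⟶_ Respects₂ _≈_
    mark      : Vertex → Mark
    mark-cong : Congruent _≈_ _≡_ mark

record RootedGraph : Set₁ where
  constructor _rootedAt_
  field
    graph  : MarkedGraph
    origin : MarkedGraph.Vertex graph
  open MarkedGraph graph public

-- Within G v r u : an undirected walk of length at most r joins v to u.
data Within (G : MarkedGraph) (v : MarkedGraph.Vertex G) : ℕ → Pred (MarkedGraph.Vertex G) 0ℓ where
  here : ∀ {r u} → MarkedGraph._≈_ G v u → Within G v r u
  step : ∀ {r u w} → Within G v r u → SymClosure (MarkedGraph._⟶_ G) u w → Within G v (suc r) w

induced : (G : MarkedGraph) → Pred (MarkedGraph.Vertex G) 0ℓ → MarkedGraph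
induced G P = record
  { vertices  = On.setoid {B = ∃ P} vertices proj₁
  ; _⟶_       = _⟶_ on proj₁
  ; ⟶-resp-≈  = proj₁ ⟶-resp-≈ , proj₂ ⟶-resp-≈
  ; mark      = mark ∘ proj₁
  ; mark-cong = mark-cong
  }
  where open MarkedGraph G

U : ℕ → RootedGraph → RootedGraph
U r (G rootedAt v) = induced G (Within G v r) rootedAt (v , here (Setoid.refl (MarkedGraph.vertices G)))

infix 4 _≅_
record _≅_ (G H : RootedGraph) : Set where
  private
    module G = RootedGraph G
    module H = RootedGraph H
  field
    bijection : Inverse G.vertices H.vertices
  open Inverse bijection public using (to; from)
  field
    origin-preserved : to G.origin H.≈ H.origin
    mark-preserved   : ∀ v → H.mark (to v) ≡ G.mark v
    edge-preserved   : ∀ v w → (v G.⟶ w) ⇔ (to v H.⟶ to w)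

-- The random rooted graph outcome ω, for ω uniform in Ω.
record UniformRootedGraph : Set₁ where
  field
    Ω       : Set
    size    : ℕ
    finite  : Fin size ↔ Ω
    outcome : Ω → RootedGraph

-- ℙ≥ X A a b : the uniform probability of A on Ω is at least a / b, i.e.
-- some duplicate-free list of outcomes in A has length at least
-- size * a / b.
record ℙ≥ (X : UniformRootedGraph) (A : Pred (UniformRootedGraph.Ω X) 0ℓ) (a b : ℕ) : Set where
  field
    outcomes : List (UniformRootedGraph.Ω X)
    unique   : Unique outcomes
    all      : All A outcomes
    enough   : UniformRootedGraph.size X * a ≤ length outcomes * b

-- Local weak convergence to a deterministic limit: for each radius r,
-- ℙ(U r Xₙ ≅ U r G) → 1, the tolerances being 1 / (1 + k).
infix 4 _⟶ᵈ_
_⟶ᵈ_ : (ℕ → UniformRootedGraph) → RootedGraph → Set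
X ⟶ᵈ G = ∀ (r k : ℕ) → ∃ λ n₀ → ∀ n → n₀ ≤ n →
  ℙ≥ (X n) (λ ω → U r (UniformRootedGraph.outcome (X n) ω) ≅ U r G) k (suc k)

module Digraph {m : ℕ} (edge : Fin m → Fin m → Bool) where
  infix 4 _⟶_
  _⟶_ : Rel (Fin m) 0ℓ
  v ⟶ w = T (edge v w)

  parents children : Fin m → Subset m
  parents  v = tabulate (λ u → edge u v)
  children v = tabulate (λ w → edge v w)

  indegree outdegree : Fin m → ℕ
  indegree  v = ∣ parents v ∣
  outdegree v = ∣ children v ∣

-- The marks are determined by the degrees; they are carried as data.
record IsSimplexTreeChild {n m : ℕ} (edge : Fin m → Fin m → Bool) (o : Fin m)
                          (mark : Fin m → Mark) (label : Fin n → Fin m) : Set where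
  open Digraph edge
  field
    acyclic         : ∀ v → ¬ TransClosure _⟶_ v v
    reachable       : ∀ v → Star _⟶_ o v
    root-mark       : ∀ v → mark v ≡ root ⇔ v ≡ o
    degrees         : ∀ v → (indegree v , outdegree v) ≡ degree (mark v)
    label-injective : ∀ i j → label i ≡ label j → i ≡ j
    label-image     : ∀ v → mark v ≡ leaf ⇔ ∃ λ i → label i ≡ v
    tree-child      : ∀ v → mark v ≢ leaf → ∃ λ w → v ⟶ w × (mark w ≡ tree ⊎ mark w ≡ leaf)
    one-component   : ∀ v w → mark v ≡ reticulation → v ⟶ w → mark w ≡ leaf

record Network (n : ℕ) : Set where
  field
    order  : ℕ
    edge   : Fin order → Fin order → Bool
    o      : Fin order
    mark   : Fin order → Mark
    label  : Fin n → Fin order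
    isSimplexTreeChild : IsSimplexTreeChild edge o mark label
  open Digraph edge public
  open IsSimplexTreeChild isSimplexTreeChild public

  markedGraph : MarkedGraph
  markedGraph = record
    { vertices  = ≡.setoid (Fin order)
    ; _⟶_       = _⟶_
    ; ⟶-resp-≈  = ≡.resp₂ _⟶_
    ; mark      = mark
    ; mark-cong = cong mark
    }

infix 4 _≃_
record _≃_ {n} (M N : Network n) : Set where
  private
    module M = Network M
    module N = Network N
  field
    bijection : Fin M.order ↔ Fin N.order
  open Inverse bijection public using (to; from; strictlyInverseˡ; strictlyInverseʳ)
  field
    edge-preserved  : ∀ v w → N.edge (to v) (to w) ≡ M.edge v w
    label-preserved : ∀ i → to (M.label i) ≡ N.label i

≃-refl : ∀ {n} {N : Network n} → N ≃ N
≃-refl = record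
  { bijection       = ↔-refl
  ; edge-preserved  = λ _ _ → refl
  ; label-preserved = λ _ → refl
  }

≃-sym : ∀ {n} {M N : Network n} → M ≃ N → N ≃ M
≃-sym {N = N} e = record
  { bijection       = ↔-sym bijection
  ; edge-preserved  = λ v w → trans (sym (edge-preserved (from v) (from w)))
      (cong₂ (Network.edge N) (strictlyInverseˡ v) (strictlyInverseˡ w))
  ; label-preserved = λ i → trans (cong from (sym (label-preserved i))) (strictlyInverseʳ _)
  }
  where open _≃_ e

≃-trans : ∀ {n} {L M N : Network n} → L ≃ M → M ≃ N → L ≃ N
≃-trans e f = record
  { bijection       = ↔-trans e.bijection f.bijection
  ; edge-preserved  = λ v w → trans (f.edge-preserved _ _) (e.edge-preserved v w)
  ; label-preserved = λ i → trans (cong f.to (e.label-preserved i)) (f.label-preserved i)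
  }
  where
  module e = _≃_ e
  module f = _≃_ f

≃-isEquivalence : ∀ {n} → IsEquivalence (_≃_ {n})
≃-isEquivalence = record { refl = ≃-refl ; sym = ≃-sym ; trans = ≃-trans }

networkSetoid : ℕ → Setoid 0ℓ 0ℓ
networkSetoid n = record { Carrier = Network n ; _≈_ = _≃_ ; isEquivalence = ≃-isEquivalence }

-- Exactly one representative for each class of ≈.
record Enumeration (S : Setoid 0ℓ 0ℓ) : Set where
  field
    size      : ℕ
    bijection : Bijection (≡.setoid (Fin size)) S
  open Bijection bijection public using () renaming (to to representative)

-- Isomorphism classes of networks on Fin n form a finite set: counting
-- edges by heads and by tails bounds the number of vertices by 4n, and
-- the finitely many candidates are searched exhaustively.

private

  record Listable (A : Set) : Set where
    field
      elements : List A
      complete : ∀ a → a ∈ elements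
  open Listable

  search : ∀ {A : Set} {P : Pred A 0ℓ} → Listable A → (∀ a → Dec (P a)) → Dec (∃ P)
  search L P? = map′ (λ p → let a , _ , pa = find p in a , pa)
                     (λ (a , pa) → lose (complete L a) pa)
                     (Any.any? P? (elements L))

  Fin-listable : ∀ n → Listable (Fin n)
  Fin-listable n = record { elements = allFin n ; complete = ∈-allFin }

  Bool-listable : Listable Bool
  Bool-listable = record
    { elements = true ∷ false ∷ []
    ; complete = λ { true → here refl ; false → there (here refl) } }

  Mark-listable : Listable Mark
  Mark-listable = record
    { elements = root ∷ tree ∷ reticulation ∷ leaf ∷ []
    ; complete = λ { root         → here refl
                   ; tree         → there (here refl)
                   ; reticulation → there (there (here refl))
                   ; leaf         → there (there (there (here refl))) } }

  Vec-listable : ∀ {A : Set} → Listable A → ∀ k → Listable (Vec A k)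
  Vec-listable L zero    = record { elements = [] ∷ [] ; complete = λ { [] → here refl } }
  Vec-listable L (suc k) = record
    { elements = cartesianProductWith _∷_ (elements L) (elements (Vec-listable L k))
    ; complete = λ { (x ∷ xs) → ∈-cartesianProductWith⁺ _∷_ (complete L x) (complete (Vec-listable L k) xs) }
    }

  ×-listable : ∀ {A B : Set} → Listable A → Listable B → Listable (A × B)
  ×-listable L M = record
    { elements = cartesianProductWith _,_ (elements L) (elements M)
    ; complete = λ (a , b) → ∈-cartesianProductWith⁺ _,_ (complete L a) (complete M b)
    }

  _≟ᵐ_ : Decidable {A = Mark} _≡_
  root         ≟ᵐ root         = yes refl
  root         ≟ᵐ tree         = no λ ()
  root         ≟ᵐ reticulation = no λ ()
  root         ≟ᵐ leaf         = no λ ()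
  tree         ≟ᵐ root         = no λ ()
  tree         ≟ᵐ tree         = yes refl
  tree         ≟ᵐ reticulation = no λ ()
  tree         ≟ᵐ leaf         = no λ ()
  reticulation ≟ᵐ root         = no λ ()
  reticulation ≟ᵐ tree         = no λ ()
  reticulation ≟ᵐ reticulation = yes refl
  reticulation ≟ᵐ leaf         = no λ ()
  leaf         ≟ᵐ root         = no λ ()
  leaf         ≟ᵐ tree         = no λ ()
  leaf         ≟ᵐ reticulation = no λ ()
  leaf         ≟ᵐ leaf         = yes refl

  _⇔-dec_ : ∀ {A B : Set} → Dec A → Dec B → Dec (A ⇔ B)
  A? ⇔-dec B? = map′ (uncurry mk⇔) (λ e → Equivalence.to e , Equivalence.from e)
                     ((A? →-dec B?) ×-dec (B? →-dec A?))

  module Warshall {m : ℕ} {E : Rel (Fin m) 0ℓ} (E? : Decidable E) where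

    -- a nonempty walk all of whose inner vertices are below k
    Via : ℕ → Rel (Fin m) 0ℓ
    Via zero    u v = E u v
    Via (suc k) u v = Via k u v ⊎ (∃ λ w → toℕ w ≡ k × Via k u w × Via k w v)

    via? : ∀ k → Decidable (Via k)
    via? zero    u v = E? u v
    via? (suc k) u v = via? k u v ⊎-dec
      any? (λ w → (toℕ w ℕₚ.≟ k) ×-dec (via? k u w ×-dec via? k w v))

    private
      pre : ∀ {k u w} → toℕ w ≡ k → Via (suc k) u w → Via k u w
      pre eq (inj₁ p) = p
      pre eq (inj₂ (x , eq′ , p , _)) with refl ← toℕ-injective (trans eq′ (sym eq)) = p

      post : ∀ {k w v} → toℕ w ≡ k → Via (suc k) w v → Via k w v
      post eq (inj₁ p) = p
      post eq (inj₂ (x , eq′ , _ , p)) with refl ← toℕ-injective (trans eq′ (sym eq)) = p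

    glue : ∀ k {u w v} → toℕ w < k → Via k u w → Via k w v → Via k u v
    glue (suc k) {w = w} (s≤s w≤k) p q with toℕ w ℕₚ.≟ k
    ... | yes eq = inj₂ (w , eq , pre eq p , post eq q)
    ... | no neq = go p q
      where
      w<k = ℕₚ.≤∧≢⇒< w≤k neq
      go : ∀ {u v} → Via (suc k) u w → Via (suc k) w v → Via (suc k) u v
      go (inj₁ p)                (inj₁ q)                = inj₁ (glue k w<k p q)
      go (inj₁ p)                (inj₂ (x , e , q , q′)) = inj₂ (x , e , glue k w<k p q , q′)
      go (inj₂ (x , e , p , p′)) (inj₁ q)                = inj₂ (x , e , p , glue k w<k p′ q)
      go (inj₂ (x , e , p , _))  (inj₂ (y , e′ , _ , q)) with refl ← toℕ-injective (trans e (sym e′)) =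
        inj₂ (x , e , p , q)

    lift : ∀ k {u v} → E u v → Via k u v
    lift zero    e = e
    lift (suc k) e = inj₁ (lift k e)

    fromPlus : ∀ {u v} → TransClosure E u v → Via m u v
    fromPlus [ e ]           = lift m e
    fromPlus (_∷_ {y = y} e p) = glue m (toℕ<n y) (lift m e) (fromPlus p)

    toPlus : ∀ k {u v} → Via k u v → TransClosure E u v
    toPlus zero    e                      = [ e ]
    toPlus (suc k) (inj₁ p)               = toPlus k p
    toPlus (suc k) (inj₂ (_ , _ , p , q)) = toPlus k p Plus.++ toPlus k q

    plus? : Decidable (TransClosure E)
    plus? u v = map′ (toPlus m) fromPlus (via? m u v)

    star? : Decidable (Star E)
    star? u v = map′ to from ((u ≟ᶠ v) ⊎-dec plus? u v)
      where
      plus⇒star : ∀ {u v} → TransClosure E u v → Star E u v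
      plus⇒star [ e ]   = e ◅ ε
      plus⇒star (e ∷ p) = e ◅ plus⇒star p
      to : ∀ {u v} → u ≡ v ⊎ TransClosure E u v → Star E u v
      to (inj₁ refl) = ε
      to (inj₂ p)    = plus⇒star p
      from : ∀ {u v} → Star E u v → u ≡ v ⊎ TransClosure E u v
      from ε       = inj₁ refl
      from (e ◅ s) with from s
      ... | inj₁ refl = inj₂ [ e ]
      ... | inj₂ p    = inj₂ (e ∷ p)

  isSimplexTreeChild? : ∀ {n m} edge o mark label → Dec (IsSimplexTreeChild {n} {m} edge o mark label)
  isSimplexTreeChild? edge o mark label = map′
    (λ (a , b , c , d , e , f , g , h) → record
      { acyclic = a ; reachable = b ; root-mark = c ; degrees = d ; label-injective = e
      ; label-image = f ; tree-child = g ; one-component = h })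
    (λ s → let open IsSimplexTreeChild s in
      acyclic , reachable , root-mark , degrees , label-injective , label-image , tree-child , one-component)
    (    all? (λ v → ¬? (plus? v v))
    ×-dec all? (λ v → star? o v)
    ×-dec all? (λ v → (mark v ≟ᵐ root) ⇔-dec (v ≟ᶠ o))
    ×-dec all? (λ v → ≡-dec ℕₚ._≟_ ℕₚ._≟_ (indegree v , outdegree v) (degree (mark v)))
    ×-dec all? (λ i → all? (λ j → (label i ≟ᶠ label j) →-dec (i ≟ᶠ j)))
    ×-dec all? (λ v → (mark v ≟ᵐ leaf) ⇔-dec any? (λ i → label i ≟ᶠ v))
    ×-dec all? (λ v → ¬? (mark v ≟ᵐ leaf) →-dec
            any? (λ w → T? (edge v w) ×-dec ((mark w ≟ᵐ tree) ⊎-dec (mark w ≟ᵐ leaf))))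
    ×-dec all? (λ v → all? (λ w → (mark v ≟ᵐ reticulation) →-dec (T? (edge v w) →-dec (mark w ≟ᵐ leaf)))))
    where
    open Digraph edge
    open Warshall (λ v w → T? (edge v w))

  isSimplexTreeChild-cong : ∀ {n m} {edge edge′ : Fin m → Fin m → Bool} {o} {mark mark′ : Fin m → Mark}
    {label label′ : Fin n → Fin m} →
    (∀ v w → edge v w ≡ edge′ v w) → mark ≗ mark′ → label ≗ label′ →
    IsSimplexTreeChild edge o mark label → IsSimplexTreeChild edge′ o mark′ label′
  isSimplexTreeChild-cong {edge = edge} {edge′} {o} {mark} {mark′} {label} {label′} e k l s = record
    { acyclic         = λ v p → acyclic v (Plus-map p)
    ; reachable       = λ v → Star.map fwdE (reachable v)
    ; root-mark       = λ v → mk⇔ (λ p → Equivalence.to (root-mark v) (trans (k v) p))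
                                  (λ p → trans (sym (k v)) (Equivalence.from (root-mark v) p))
    ; degrees         = λ v → trans (cong₂ _,_
        (cong ∣_∣ (tabulate-cong (λ u → sym (e u v)))) (cong ∣_∣ (tabulate-cong (λ w → sym (e v w)))))
        (trans (degrees v) (cong degree (k v)))
    ; label-injective = λ i j p → label-injective i j (trans (l i) (trans p (sym (l j))))
    ; label-image     = λ v → mk⇔
        (λ p → let i , q = Equivalence.to (label-image v) (trans (k v) p) in i , trans (sym (l i)) q)
        (λ (i , q) → trans (sym (k v)) (Equivalence.from (label-image v) (i , trans (l i) q)))
    ; tree-child      = λ v p → let w , vw , q = tree-child v (λ r → p (trans (sym (k v)) r)) in
        w , fwdE vw , Sum.map (trans (sym (k w))) (trans (sym (k w))) q
    ; one-component   = λ v w p vw → trans (sym (k w)) (one-component v w (trans (k v) p) (bwdE vw))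
    }
    where
    open IsSimplexTreeChild s
    fwdE : ∀ {v w} → T (edge v w) → T (edge′ v w)
    fwdE {v} {w} = subst T (e v w)
    bwdE : ∀ {v w} → T (edge′ v w) → T (edge v w)
    bwdE {v} {w} = subst T (sym (e v w))
    Plus-map : ∀ {v w} → TransClosure (λ v w → T (edge′ v w)) v w → TransClosure (λ v w → T (edge v w)) v w
    Plus-map [ p ]    = [ bwdE p ]
    Plus-map (p ∷ ps) = bwdE p ∷ Plus-map ps

  _≃?_ : ∀ {n} → Decidable (_≃_ {n})
  _≃?_ {n} M N = map′ to from
      (search (×-listable (Vec-listable (Fin-listable N.order) M.order) (Vec-listable (Fin-listable M.order) N.order))
        (λ (f , g) → good? (Vec.lookup f) (Vec.lookup g)))
    where
    module M = Network M
    module N = Network N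
    Good : (Fin M.order → Fin N.order) → (Fin N.order → Fin M.order) → Set
    Good f g = (∀ y → f (g y) ≡ y) × (∀ x → g (f x) ≡ x)
             × (∀ v w → N.edge (f v) (f w) ≡ M.edge v w) × (∀ i → f (M.label i) ≡ N.label i)
    good? : ∀ f g → Dec (Good f g)
    good? f g = all? (λ y → f (g y) ≟ᶠ y) ×-dec all? (λ x → g (f x) ≟ᶠ x)
      ×-dec all? (λ v → all? (λ w → N.edge (f v) (f w) ≟ᵇ M.edge v w))
      ×-dec all? (λ i → f (M.label i) ≟ᶠ N.label i)
    to : (∃ λ ((f , g) : Vec (Fin N.order) M.order × Vec (Fin M.order) N.order) →
            Good (Vec.lookup f) (Vec.lookup g)) → M ≃ N
    to ((f , g) , fg , gf , e , l) = record
      { bijection = mk↔ₛ′ (Vec.lookup f) (Vec.lookup g) fg gf ; edge-preserved = e ; label-preserved = l }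
    from : M ≃ N → ∃ λ ((f , g) : Vec (Fin N.order) M.order × Vec (Fin M.order) N.order) →
             Good (Vec.lookup f) (Vec.lookup g)
    from e = (tabulate E.to , tabulate E.from)
      , (λ y → trans (lt E.to _) (trans (cong E.to (lt E.from y)) (E.strictlyInverseˡ y)))
      , (λ x → trans (lt E.from _) (trans (cong E.from (lt E.to x)) (E.strictlyInverseʳ x)))
      , (λ v w → trans (cong₂ N.edge (lt E.to v) (lt E.to w)) (E.edge-preserved v w))
      , (λ i → trans (lt E.to _) (E.label-preserved i))
      where
      module E = _≃_ e
      lt : ∀ {A : Set} {k} (f : Fin k → A) i → Vec.lookup (tabulate f) i ≡ f i
      lt = lookup∘tabulate

  module Bound where
    open import Algebra.Properties.Semiring.Sum +-*-semiring
      using (sum; sum-cong-≗; ∑-comm; ∑-distrib-+; *-distribˡ-sum; *-distribʳ-sum)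

    ⟦_⟧ : Bool → ℕ
    ⟦ b ⟧ = if b then 1 else 0

    ∣tabulate∣ : ∀ {m} (f : Fin m → Bool) → ∣ tabulate f ∣ ≡ sum (λ i → ⟦ f i ⟧)
    ∣tabulate∣ {zero}  f = refl
    ∣tabulate∣ {suc m} f with f zero
    ... | true  = cong suc (∣tabulate∣ (f ∘ suc))
    ... | false = ∣tabulate∣ (f ∘ suc)

    sum-mono : ∀ {m} {f g : Fin m → ℕ} → (∀ i → f i ≤ g i) → sum f ≤ sum g
    sum-mono {zero}  p = z≤n
    sum-mono {suc m} p = ℕₚ.+-mono-≤ (p zero) (sum-mono (p ∘ suc))

    sum-one : ∀ m → sum {m} (λ _ → 1) ≡ m
    sum-one zero    = refl
    sum-one (suc m) = cong suc (sum-one m)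

    sum-zero : ∀ m → sum {m} (λ _ → 0) ≡ 0
    sum-zero zero    = refl
    sum-zero (suc m) = sum-zero m

    term≤sum : ∀ {m} (f : Fin m → ℕ) i → f i ≤ sum f
    term≤sum f zero    = ℕₚ.m≤m+n _ _
    term≤sum f (suc i) = ℕₚ.≤-trans (term≤sum (f ∘ suc) i) (ℕₚ.m≤n+m _ _)

    δ : ∀ {m} → Fin m → Fin m → ℕ
    δ u v = ⟦ does (u ≟ᶠ v) ⟧

    δ-refl : ∀ {m} (u : Fin m) → δ u u ≡ 1
    δ-refl u with u ≟ᶠ u
    ... | yes _ = refl
    ... | no p  = contradiction refl p

    sum-δ : ∀ {m} (u : Fin m) → sum (δ u) ≡ 1
    sum-δ {suc m} zero    = cong suc (sum-zero m)
    sum-δ {suc m} (suc u) = sum-δ u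

    ret lf : Mark → ℕ
    ret k = ⟦ does (k ≟ᵐ reticulation) ⟧
    lf  k = ⟦ does (k ≟ᵐ leaf) ⟧

    weights : ∀ k → 1 + proj₁ (degree k) ≡ proj₂ (degree k) + 2 * (ret k + lf k)
    weights root         = refl
    weights tree         = refl
    weights reticulation = refl
    weights leaf         = refl

    module _ {n : ℕ} (N : Network n) where
      open Network N
      in′ out : Fin order → ℕ
      in′ v = proj₁ (degree (mark v))
      out v = proj₂ (degree (mark v))

      in-sum : ∀ w → sum (λ v → ⟦ edge v w ⟧) ≡ in′ w
      in-sum w = trans (sym (∣tabulate∣ (λ v → edge v w))) (cong proj₁ (degrees w))

      out-sum : ∀ v → sum (λ w → ⟦ edge v w ⟧) ≡ out v
      out-sum v = trans (sym (∣tabulate∣ (edge v))) (cong proj₂ (degrees v))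

      handshake : sum in′ ≡ sum out
      handshake = trans (sum-cong-≗ (λ w → sym (in-sum w)))
        (trans (∑-comm (λ w v → ⟦ edge v w ⟧)) (sum-cong-≗ out-sum))

      R L : ℕ
      R = sum (ret ∘ mark)
      L = sum (lf ∘ mark)

      order≡ : order ≡ 2 * (R + L)
      order≡ = ℕₚ.+-cancelʳ-≡ (sum out) _ _ (begin
        order + sum out                                 ≡⟨ cong₂ _+_ (sym (sum-one order)) (sym handshake) ⟩
        sum {order} (λ _ → 1) + sum in′                 ≡⟨ ∑-distrib-+ (λ _ → 1) in′ ⟨
        sum (λ v → 1 + in′ v)                           ≡⟨ sum-cong-≗ (λ v → weights (mark v)) ⟩
        sum (λ v → out v + 2 * (ret (mark v) + lf (mark v)))
          ≡⟨ ∑-distrib-+ out _ ⟩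
        sum out + sum (λ v → 2 * (ret (mark v) + lf (mark v)))
          ≡⟨ cong (sum out +_) (*-distribˡ-sum 2 (λ v → ret (mark v) + lf (mark v))) ⟨
        sum out + 2 * sum (λ v → ret (mark v) + lf (mark v))
          ≡⟨ cong (λ x → sum out + 2 * x) (∑-distrib-+ (ret ∘ mark) (lf ∘ mark)) ⟩
        sum out + 2 * (R + L)                           ≡⟨ ℕₚ.+-comm (sum out) _ ⟩
        2 * (R + L) + sum out                           ∎)
        where open ≡.≡-Reasoning

      R≤L : R ≤ L
      R≤L = begin
        R                                                       ≤⟨ sum-mono pointwise ⟩
        sum (λ v → sum (λ w → ⟦ edge v w ⟧ * lf (mark w)))      ≡⟨ ∑-comm (λ v w → ⟦ edge v w ⟧ * lf (mark w)) ⟩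
        sum (λ w → sum (λ v → ⟦ edge v w ⟧ * lf (mark w)))
          ≡⟨ sum-cong-≗ (λ w → trans (sym (*-distribʳ-sum (lf (mark w)) (λ v → ⟦ edge v w ⟧)))
               (trans (cong (_* lf (mark w)) (in-sum w)) (collapse (mark w)))) ⟩
        L                                                       ∎
        where
        open ℕₚ.≤-Reasoning
        collapse : ∀ k → proj₁ (degree k) * lf k ≡ lf k
        collapse root         = refl
        collapse tree         = refl
        collapse reticulation = refl
        collapse leaf         = refl
        pointwise : ∀ v → ret (mark v) ≤ sum (λ w → ⟦ edge v w ⟧ * lf (mark w))
        pointwise v with mark v ≟ᵐ reticulation
        ... | no  _ = z≤n
        ... | yes p = ℕₚ.≤-reflexive (sym (trans (sum-cong-≗ leafy)
                        (trans (out-sum v) (cong (proj₂ ∘ degree) p))))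
          where
          leafy : ∀ w → ⟦ edge v w ⟧ * lf (mark w) ≡ ⟦ edge v w ⟧
          leafy w with edge v w in eq
          ... | false = refl
          ... | true  = cong (λ k → 1 * lf k) (one-component v w p (subst T (sym eq) tt))

      L≤n : L ≤ n
      L≤n = begin
        L                                       ≤⟨ sum-mono pointwise ⟩
        sum (λ v → sum (λ i → δ (label i) v))   ≡⟨ ∑-comm (λ v i → δ (label i) v) ⟩
        sum (λ i → sum (δ (label i)))           ≡⟨ sum-cong-≗ (λ i → sum-δ (label i)) ⟩
        sum {n} (λ _ → 1)                       ≡⟨ sum-one n ⟩
        n                                       ∎
        where
        open ℕₚ.≤-Reasoning
        pointwise : ∀ v → lf (mark v) ≤ sum (λ i → δ (label i) v)
        pointwise v with mark v ≟ᵐ leaf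
        ... | no  _ = z≤n
        ... | yes p with Equivalence.to (label-image v) p
        ...   | i , refl = ℕₚ.≤-trans (ℕₚ.≤-reflexive (sym (δ-refl (label i))))
                             (term≤sum (λ j → δ (label j) (label i)) i)

      order≤ : order ≤ 2 * (n + n)
      order≤ = ℕₚ.≤-trans (ℕₚ.≤-reflexive order≡)
        (ℕₚ.*-monoʳ-≤ 2 (ℕₚ.+-mono-≤ (ℕₚ.≤-trans R≤L L≤n) L≤n))

  Code : ℕ → ℕ → Set
  Code n m = Vec (Vec Bool m) m × Fin m × Vec Mark m × Vec (Fin m) n

  codes : ∀ n m → Listable (Code n m)
  codes n m = ×-listable (Vec-listable (Vec-listable Bool-listable m) m)
    (×-listable (Fin-listable m) (×-listable (Vec-listable Mark-listable m) (Vec-listable (Fin-listable m) n)))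

  decode : ∀ {n m} → Code n m → List (Network n)
  decode (e , o , k , l)
    with isSimplexTreeChild? (λ v w → Vec.lookup (Vec.lookup e v) w) o (Vec.lookup k) (Vec.lookup l)
  ... | yes p = record { isSimplexTreeChild = p } ∷ []
  ... | no _  = []

  networksOfOrder : ∀ n → ℕ → List (Network n)
  networksOfOrder n m = concatMap decode (elements (codes n m))

  allNetworks : ∀ n → List (Network n)
  allNetworks n = concatMap (networksOfOrder n) (upTo (suc (2 * (n + n))))

  allNetworks-complete : ∀ {n} (N : Network n) → Any (N ≃_) (allNetworks n)
  allNetworks-complete {n} N =
    Anyₚ.concatMap⁺ (networksOfOrder n) (lose {P = λ m → Any (N ≃_) (networksOfOrder n m)}
      (∈-upTo⁺ (s≤s (Bound.order≤ N)))
      (Anyₚ.concatMap⁺ (decode {n}) (lose {P = λ c → Any (N ≃_) (decode c)}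
        (complete (codes n order) code) decoded)))
    where
    open Network N
    rows = tabulate (λ v → tabulate (edge v))
    code : Code n order
    code = rows , o , tabulate mark , tabulate label
    lookup-rows : ∀ v w → Vec.lookup (Vec.lookup rows v) w ≡ edge v w
    lookup-rows v w = trans (cong (λ r → Vec.lookup r w) (lookup∘tabulate _ v)) (lookup∘tabulate _ w)
    decoded : Any (N ≃_) (decode code)
    decoded with isSimplexTreeChild? (λ v w → Vec.lookup (Vec.lookup rows v) w) o
                   (Vec.lookup (tabulate mark)) (Vec.lookup (tabulate label))
    ... | yes p = here (record
      { bijection = ↔-refl ; edge-preserved = lookup-rows
      ; label-preserved = λ i → sym (lookup∘tabulate label i) })
    ... | no ¬p = contradiction (isSimplexTreeChild-cong (λ v w → sym (lookup-rows v w))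
      (λ v → sym (lookup∘tabulate mark v)) (λ i → sym (lookup∘tabulate label i)) isSimplexTreeChild) ¬p

  enumerate : (D : DecSetoid 0ℓ 0ℓ) → let open DecSetoid D in
    (xs : List Carrier) → (∀ x → Any (x ≈_) xs) → Enumeration setoid
  enumerate D xs xs-complete = record
    { size      = length ys
    ; bijection = record
      { to        = List.lookup ys
      ; cong      = λ { refl → ≈-refl }
      ; bijective = injective ys (deduplicate-! D xs) _ _
                  , λ y → let p = ys-complete y in
                      Any.index p , λ { refl → ≈-sym (lookup-index p) }
      }
    }
    where
    open DecSetoid D renaming (refl to ≈-refl; sym to ≈-sym; trans to ≈-trans)
    ys = deduplicate _≟_ xs
    ys-complete : ∀ y → Any (y ≈_) ys
    ys-complete y = SetoidMembership.∈-deduplicate⁺ setoid _≟_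
      (λ p q → ≈-trans q (≈-sym p)) (xs-complete y)
    injective : ∀ zs → SetoidUnique.Unique setoid zs → ∀ i j → List.lookup zs i ≈ List.lookup zs j → i ≡ j
    injective (z ∷ zs) (_ ∷ _)   zero    zero    _ = refl
    injective (z ∷ zs) (z# ∷ _)  zero    (suc j) p = ⊥-elim (All.lookup z# (∈-lookup j) p)
    injective (z ∷ zs) (z# ∷ _)  (suc i) zero    p = ⊥-elim (All.lookup z# (∈-lookup i) (≈-sym p))
    injective (z ∷ zs) (_ ∷ uzs) (suc i) (suc j) p = cong suc (injective zs uzs i j p)

abstract
  networks : ∀ n → Enumeration (networkSetoid n)
  networks n = enumerate
    (record { isDecEquivalence = record { isEquivalence = ≃-isEquivalence ; _≟_ = _≃?_ } })
    (allNetworks n) allNetworks-complete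

-- (Nₙ , wₙ): a uniform isomorphism class of networks on Fin n together
-- with an independent uniform leaf.  The leaf is drawn as its label, which
-- is preserved by isomorphisms.
uniformNetworkAtLeaf : ℕ → UniformRootedGraph
uniformNetworkAtLeaf n = record
  { Ω       = Fin 𝒩.size × Fin n
  ; size    = 𝒩.size * n
  ; finite  = *↔×
  ; outcome = λ (c , i) →
      Network.markedGraph (𝒩.representative c) rootedAt Network.label (𝒩.representative c) i
  }
  where module 𝒩 = Enumeration (networks n)

-- decorating s i is the spine introduced by decorating vertex i of the
-- spine s.  Index 0 is the vertex not decorated: p₀ and q₀ on the two
-- initial spines, and w(x) on the spine introduced by decorating x.
data Spine : Set where
  p-spine q-spine : Spine
  decorating : (s : Spine) (i : ℤ) .{{_ : ℤ.NonZero i}} → Spine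

data R̂-Vertex : Set where
  on    : Spine → ℤ → R̂-Vertex
  ρ₀ ℓ₀ : R̂-Vertex
  ρ ℓ   : (s : Spine) (i : ℤ) .{{_ : ℤ.NonZero i}} → R̂-Vertex

data R̂-Edge : Rel R̂-Vertex 0ℓ where
  along     : ∀ {s i j} → j ≡ ℤ.suc i → R̂-Edge (on s i) (on s j)
  p₀→ρ₀     : R̂-Edge (on p-spine 0ℤ) ρ₀
  q₀→ρ₀     : R̂-Edge (on q-spine 0ℤ) ρ₀
  ρ₀→ℓ₀     : R̂-Edge ρ₀ ℓ₀
  x→ρ[x]    : ∀ {s i} .{{_ : ℤ.NonZero i}} → R̂-Edge (on s i) (ρ s i)
  w[x]→ρ[x] : ∀ {s i} .{{_ : ℤ.NonZero i}} → R̂-Edge (on (decorating s i) 0ℤ) (ρ s i)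
  ρ[x]→ℓ[x] : ∀ {s i} .{{_ : ℤ.NonZero i}} → R̂-Edge (ρ s i) (ℓ s i)

R̂-mark : R̂-Vertex → Mark
R̂-mark (on _ _) = tree
R̂-mark ρ₀       = reticulation
R̂-mark ℓ₀       = leaf
R̂-mark (ρ _ _)  = reticulation
R̂-mark (ℓ _ _)  = leaf

R̂ : MarkedGraph
R̂ = record
  { vertices  = ≡.setoid R̂-Vertex
  ; _⟶_       = R̂-Edge
  ; ⟶-resp-≈  = ≡.resp₂ R̂-Edge
  ; mark      = R̂-mark
  ; mark-cong = cong R̂-mark
  }

N̂ˡᶠ : RootedGraph
N̂ˡᶠ = R̂ rootedAt ℓ₀

-- Two switchings on networks bound the bad outcomes.
--
-- (1) Pick a tree vertex v without reticulation child and a leaf a that is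
-- not a child of v and is not below a reticulation.  Exchange a with the
-- subtree of a child of v, then put a below a new reticulation whose other
-- parent is the old root, under a new root.  The result together with one
-- marked vertex determines the network, v and a.  With j leaves that are
-- not below a reticulation there are j - 1 vertices like v, so
-- #{j ≥ J} · J (J - 2) ≤ #networks · 4n and j = o(n) with high probability.
-- The root, the vertices like v and the j leaves are then too few to be
-- close to a typical leaf.
--
-- (2) If a reticulation with parents x and y lies on a short cycle, exchange
-- y with a parent of some other, distant reticulation.  Since y is still near
-- x afterwards, the result determines everything up to boundedly many
-- choices, so on average a network has only boundedly many such
-- reticulations.
--
-- Both switchings act on isomorphism classes because a network has no
-- automorphism fixing the labels.  Near a leaf that sees neither kind of
-- obstruction, the network is covered by R̂, and a collision under the
-- covering map would close up a directed cycle or a short cycle through a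
-- reticulation.
module Submission where

open import Defs
open import Data.Bool.Base using (Bool; true; false; T; _∧_; not)
open import Data.Bool.Properties using (T?; T-∧)
open import Data.Empty using (⊥; ⊥-elim)
open import Data.Fin.Base using (Fin; zero; suc)
open import Data.Fin.Properties using (any?; suc-injective; 0≢1+n) renaming (_≟_ to _≟ᶠ_)
open import Data.Fin.Subset using (∣_∣)
open import Data.Fin.Induction using (spo-wellFounded; spo-noetherian)
open import Data.Integer.Base as ℤ using (ℤ; 0ℤ; -[1+_])
import Data.Integer.Properties as ℤₚ
open import Data.List.Base using (List; []; _∷_; _++_; length; map; concatMap; allFin; filter)
open import Data.List.Properties using (length-map; length-++; length-tabulate)
open import Data.List.Membership.Propositional using (_∈_; lose; find)
open import Data.List.Membership.Propositional.Properties
  using (∈-∃++; ∈-++⁺ˡ; ∈-++⁺ʳ; ∈-++⁻; ∈-map⁺; ∈-map⁻; ∈-allFin; ∈-filter⁺; ∈-filter⁻; ∈-concatMap⁺; ∈-concatMap⁻)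
open import Data.Fin.Permutation.Components using (transpose; transpose-inverse)
import Data.List.Membership.DecPropositional as DecMembership
open import Data.List.Relation.Unary.All as All using (All; []; _∷_)
import Data.List.Relation.Unary.All.Properties as Allₚ
open import Data.List.Relation.Unary.AllPairs using ([]; _∷_)
open import Data.List.Relation.Unary.Any using (here; there)
open import Data.List.Relation.Unary.Unique.Propositional using (Unique)
import Data.List.Relation.Unary.Unique.Propositional.Properties as Uniqueₚ
open import Data.Nat.Base using (ℕ; zero; suc; _+_; _*_; _∸_; _^_; _≤_; _<_; z≤n; s≤s; NonZero; >-nonZero; ≢-nonZero⁻¹)
open import Data.Nat.DivMod using (_/_; _%_; m≡m%n+[m/n]*n; m%n<n; m*n/n≡m; /-monoˡ-≤)
open import Data.Nat.Properties as ℕₚ using (+-*-semiring)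
open import Algebra.Properties.Semiring.Sum +-*-semiring
  using (sum; sum-cong-≗; ∑-comm; ∑-distrib-+; *-distribˡ-sum)
open import Data.Nat.Tactic.RingSolver using (solve-∀)
open import Data.Product.Base using (∃; ∃₂; Σ; _×_; _,_; proj₁; proj₂; uncurry)
open import Data.Sum.Base as Sum using (_⊎_; inj₁; inj₂; [_,_]′)
open import Data.Unit.Base using (⊤; tt)
open import Data.Vec.Base using (tabulate)
open import Data.Vec.Properties using (tabulate-cong)
open import Function.Base using (_∘_; id; flip; case_of_)
open import Function.Bundles using (Inverse; Bijection; _↔_; _⇔_; mk⇔; mk↔ₛ′; module Equivalence)
open import Induction.WellFounded using (Acc; acc; WellFounded)
open import Level using (0ℓ)
open import Relation.Binary.Core using (Rel)
open import Relation.Binary.Definitions using (tri<; tri≈; tri>)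
open import Relation.Binary.Structures using (IsStrictPartialOrder)
open import Relation.Binary.Construct.Closure.ReflexiveTransitive as Star using (Star; ε; _◅_; _◅◅_)
open import Relation.Binary.Construct.Closure.Symmetric using (fwd; bwd)
open import Relation.Binary.Construct.Closure.Transitive as Plus using (TransClosure; [_]; _∷_; _∷ʳ_)
open import Relation.Binary.PropositionalEquality as ≡
  using (_≡_; _≢_; refl; sym; trans; cong; cong₂; subst; subst₂)
open import Relation.Nullary using (¬_; Dec; yes; no; ¬?; contradiction; _×-dec_; _⊎-dec_; map′)
open import Relation.Nullary.Decidable using (⌊_⌋; toWitness; fromWitness)
open import Relation.Unary using (Pred; Decidable)

-- Probabilities are replaced by comparisons of list lengths, so no asymptotic enumeration of
-- networks is needed. The order of the two switchings matters: the exchange of (2) needs a distant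
-- reticulation, and these are about as many as the taxa only once the tree leaves are known to be
-- few, so the exceptional networks of (1) are set aside first. In (1) the exchange has to precede
-- the insertion, since moving `a` alone would leave its former parent with one child, whereas
-- trading `a` for a subtree preserves all degrees. The radii come from the comparison of balls of
-- radius `r`. An edge that starts at height `r` is lifted to a vertex of height up to `1 + r`
-- before its endpoint is identified, so `φ` must be injective there; as `φ-injective` asks for
-- heights strictly below `M`, this gives `M = 2 + r`, and `K = 3 + r` keeps one further layer free
-- of obstructions. A collision joins the two parents of a reticulation by three stretches of length
-- at most `M` each, hence `L = 3 M`.

module _ {A B : Set} {R : A → B → Set} where

  -- `R` need not be functional, so that a switching may be related to every target that comes with
  -- a witness isomorphism. The head takes its partner `y` out of `ys`; injectivity keeps the
  -- partners of the tail away from that occurrence.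
  length-≤ : ∀ {xs : List A} {ys : List B} → Unique xs →
    (∀ {x} → x ∈ xs → ∃ λ y → y ∈ ys × R x y) →
    (∀ {x x′ y} → x ∈ xs → x′ ∈ xs → R x y → R x′ y → x ≡ x′) →
    length xs ≤ length ys
  length-≤ {[]}     _           _     _      = z≤n
  length-≤ {x ∷ xs} (x# ∷ uniq) total inject with total (here refl)
  ... | y , y∈ys , Rxy with ∈-∃++ y∈ys
  ...   | as , bs , refl = begin
    suc (length xs)                ≤⟨ s≤s (length-≤ uniq total′ (λ p q → inject (there p) (there q))) ⟩
    suc (length (as ++ bs))        ≡⟨ cong suc (length-++ as) ⟩
    suc (length as + length bs)    ≡⟨ ℕₚ.+-suc (length as) (length bs) ⟨
    length as + length (y ∷ bs)    ≡⟨ length-++ as ⟨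
    length (as ++ y ∷ bs)          ∎
    where
    open ℕₚ.≤-Reasoning
    total′ : ∀ {x′} → x′ ∈ xs → ∃ λ y′ → y′ ∈ as ++ bs × R x′ y′
    total′ x′∈xs with total (there x′∈xs)
    ... | y′ , y′∈ , Rx′y′ with ∈-++⁻ as y′∈
    ...   | inj₁ p           = y′ , ∈-++⁺ˡ p , Rx′y′
    ...   | inj₂ (there p)   = y′ , ∈-++⁺ʳ as p , Rx′y′
    ...   | inj₂ (here refl) =
      contradiction (inject (here refl) (there x′∈xs) Rxy Rx′y′) (All.lookup x# x′∈xs)

⊆⇒length-≤ : ∀ {A : Set} {xs ys : List A} → Unique xs → (∀ {x} → x ∈ xs → x ∈ ys) → length xs ≤ length ys
⊆⇒length-≤ uniq sub = length-≤ {R = _≡_} uniq (λ p → _ , sub p , refl) (λ { _ _ refl refl → refl })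

-- Lists of dependent pairs and their lengths

module _ {A : Set} {B : A → Set} where

  private
    tag : ∀ a → B a → Σ A B
    tag a b = a , b

  Σ-list : List A → (∀ a → List (B a)) → List (Σ A B)
  Σ-list []       f = []
  Σ-list (x ∷ xs) f = map (tag x) (f x) ++ Σ-list xs f

  ∈-Σ-list⁺ : ∀ {xs f a b} → a ∈ xs → b ∈ f a → (a , b) ∈ Σ-list xs f
  ∈-Σ-list⁺         (here refl) q = ∈-++⁺ˡ (∈-map⁺ (tag _) q)
  ∈-Σ-list⁺ {x ∷ _} (there p)   q = ∈-++⁺ʳ (map (tag x) _) (∈-Σ-list⁺ p q)

  ∈-Σ-list⁻ : ∀ xs {f a b} → (a , b) ∈ Σ-list xs f → a ∈ xs × b ∈ f a
  ∈-Σ-list⁻ (x ∷ xs) {f} p with ∈-++⁻ (map (tag x) (f x)) p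
  ... | inj₁ q with ∈-map⁻ (tag x) q
  ...   | b , b∈ , refl = here refl , b∈
  ∈-Σ-list⁻ (x ∷ xs) {f} p | inj₂ q = let a∈ , b∈ = ∈-Σ-list⁻ xs q in there a∈ , b∈

  Σ-list-unique : ∀ {xs f} → Unique xs → (∀ a → Unique (f a)) → Unique (Σ-list xs f)
  Σ-list-unique []                       _ = []
  Σ-list-unique {x ∷ xs} {f} (x# ∷ uniq) g =
    Uniqueₚ.++⁺ (Uniqueₚ.map⁺ (λ { refl → refl }) (g x)) (Σ-list-unique uniq g)
      (λ { (p , q) → disjoint (∈-map⁻ (tag x) p) q })
    where
    disjoint : ∀ {ab} → (∃ λ b → b ∈ f x × ab ≡ (x , b)) → ab ∈ Σ-list xs f → ⊥
    disjoint (b , _ , refl) q = All.lookup x# (proj₁ (∈-Σ-list⁻ xs q)) refl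

  length-Σ-list-≤ : ∀ xs {f} k → (∀ {a} → a ∈ xs → length (f a) ≤ k) → length (Σ-list xs f) ≤ length xs * k
  length-Σ-list-≤ []           k h = z≤n
  length-Σ-list-≤ (x ∷ xs) {f} k h = begin
    length (map (tag x) (f x) ++ Σ-list xs f)         ≡⟨ length-++ (map (tag x) (f x)) ⟩
    length (map (tag x) (f x)) + length (Σ-list xs f) ≡⟨ cong (_+ _) (length-map (tag x) (f x)) ⟩
    length (f x) + length (Σ-list xs f)
      ≤⟨ ℕₚ.+-mono-≤ (h (here refl)) (length-Σ-list-≤ xs k (h ∘ there)) ⟩
    k + length xs * k                                ∎
    where open ℕₚ.≤-Reasoning

  length-Σ-list-≥ : ∀ xs {f} k → (∀ {a} → a ∈ xs → k ≤ length (f a)) → length xs * k ≤ length (Σ-list xs f)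
  length-Σ-list-≥ []           k h = z≤n
  length-Σ-list-≥ (x ∷ xs) {f} k h = begin
    k + length xs * k
      ≤⟨ ℕₚ.+-mono-≤ (h (here refl)) (length-Σ-list-≥ xs k (h ∘ there)) ⟩
    length (f x) + length (Σ-list xs f)              ≡⟨ cong (_+ _) (length-map (tag x) (f x)) ⟨
    length (map (tag x) (f x)) + length (Σ-list xs f) ≡⟨ length-++ (map (tag x) (f x)) ⟨
    length (map (tag x) (f x) ++ Σ-list xs f)         ∎
    where open ℕₚ.≤-Reasoning

module _ {A : Set} {P : Pred A 0ℓ} (P? : Decidable P) where

  length-filter-¬ : ∀ xs → length (filter P? xs) + length (filter (¬? ∘ P?) xs) ≡ length xs
  length-filter-¬ []       = refl
  length-filter-¬ (x ∷ xs) with P? x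
  ... | yes _ = cong suc (length-filter-¬ xs)
  ... | no  _ = trans (ℕₚ.+-suc _ _) (cong suc (length-filter-¬ xs))

-- Searching and counting in finite types

choose : ∀ {m} {P : Pred (Fin m) 0ℓ} → Decidable P → Fin m → Fin m
choose P? d with any? P?
... | yes (x , _) = x
... | no  _       = d

choose-satisfies : ∀ {m} {P : Pred (Fin m) 0ℓ} (P? : Decidable P) {d} → ∃ P → P (choose P? d)
choose-satisfies P? p with any? P?
... | yes (_ , px) = px
... | no ¬p        = contradiction p ¬p

trues : ∀ {m} → (Fin m → Bool) → List (Fin m)
trues {zero}  f = []
trues {suc m} f with f zero
... | true  = zero ∷ map suc (trues (f ∘ suc))
... | false = map suc (trues (f ∘ suc))

length-trues : ∀ {m} (f : Fin m → Bool) → length (trues f) ≡ ∣ tabulate f ∣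
length-trues {zero}  f = refl
length-trues {suc m} f with f zero
... | true  = cong suc (trans (length-map suc (trues (f ∘ suc))) (length-trues (f ∘ suc)))
... | false = trans (length-map suc (trues (f ∘ suc))) (length-trues (f ∘ suc))

∈-trues⁺ : ∀ {m} (f : Fin m → Bool) {x} → T (f x) → x ∈ trues f
∈-trues⁺ f {zero} p with f zero
... | true = here refl
∈-trues⁺ f {suc x} p with f zero
... | true  = there (∈-map⁺ suc (∈-trues⁺ (f ∘ suc) p))
... | false = ∈-map⁺ suc (∈-trues⁺ (f ∘ suc) p)

∈-trues⁻ : ∀ {m} (f : Fin m → Bool) {x} → x ∈ trues f → T (f x)
∈-trues⁻ {suc m} f p with f zero in eq | p
... | true  | here refl = subst T (sym eq) tt
... | true  | there q with ∈-map⁻ suc q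
...   | x , x∈ , refl = ∈-trues⁻ (f ∘ suc) x∈
∈-trues⁻ {suc m} f p | false | q with ∈-map⁻ suc q
...   | x , x∈ , refl = ∈-trues⁻ (f ∘ suc) x∈

trues-unique : ∀ {m} (f : Fin m → Bool) → Unique (trues f)
trues-unique {zero}  f = []
trues-unique {suc m} f with f zero
... | true  = Allₚ.map⁺ (All.tabulate λ _ → 0≢1+n) ∷ Uniqueₚ.map⁺ suc-injective (trues-unique (f ∘ suc))
... | false = Uniqueₚ.map⁺ suc-injective (trues-unique (f ∘ suc))

∣tabulate∣-≤ : ∀ {m k} {f : Fin m → Bool} {g : Fin k → Bool} (h : Fin m → Fin k) →
  (∀ {x y} → h x ≡ h y → x ≡ y) → (∀ x → T (f x) → T (g (h x))) → ∣ tabulate f ∣ ≤ ∣ tabulate g ∣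
∣tabulate∣-≤ {f = f} {g} h h-inj imp = subst₂ _≤_ (length-trues f) (length-trues g)
  (length-≤ {R = λ x y → h x ≡ y} (trues-unique f)
    (λ {x} p → h x , ∈-trues⁺ g (imp x (∈-trues⁻ f p)) , refl)
    (λ _ _ p q → h-inj (trans p (sym q))))

∣tabulate∣≡length : ∀ {m} (f : Fin m → Bool) {xs} → Unique xs → (∀ x → T (f x) → x ∈ xs) →
  (∀ {x} → x ∈ xs → T (f x)) → ∣ tabulate f ∣ ≡ length xs
∣tabulate∣≡length f uniq sub sup = trans (sym (length-trues f)) (ℕₚ.≤-antisym
  (⊆⇒length-≤ (trues-unique f) (λ p → sub _ (∈-trues⁻ f p)))
  (⊆⇒length-≤ uniq (λ p → ∈-trues⁺ f (sup p))))

∣tabulate∣≡0 : ∀ {m} (f : Fin m → Bool) → ∣ tabulate f ∣ ≡ 0 → ∀ x → ¬ T (f x)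
∣tabulate∣≡0 f eq x p with trues f | length-trues f | ∈-trues⁺ f p
... | []    | _   | ()
... | _ ∷ _ | len | _ = case trans len eq of λ ()

∣tabulate∣≡1 : ∀ {m} (f : Fin m → Bool) → ∣ tabulate f ∣ ≡ 1 →
  ∃ λ x → T (f x) × (∀ y → T (f y) → y ≡ x)
∣tabulate∣≡1 f eq with trues f | length-trues f | (λ {x} → ∈-trues⁺ f {x}) | (λ {x} → ∈-trues⁻ f {x})
... | []        | len | _ | _ = case trans len eq of λ ()
... | x ∷ []    | _   | g | h = x , h (here refl) , λ y p → case g p of λ { (here q) → q }
... | _ ∷ _ ∷ _ | len | _ | _ = case trans len eq of λ ()

∣tabulate∣≡2 : ∀ {m} (f : Fin m → Bool) → ∣ tabulate f ∣ ≡ 2 →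
  ∃₂ λ x y → x ≢ y × T (f x) × T (f y) × (∀ z → T (f z) → z ≡ x ⊎ z ≡ y)
∣tabulate∣≡2 f eq with trues f | length-trues f | trues-unique f | (λ {x} → ∈-trues⁺ f {x}) | (λ {x} → ∈-trues⁻ f {x})
... | []            | len | _ | _ | _ = case trans len eq of λ ()
... | _ ∷ []        | len | _ | _ | _ = case trans len eq of λ ()
... | x ∷ y ∷ []    | _   | (x# ∷ _) ∷ _ | g | h = x , y , x# , h (here refl) , h (there (here refl)) ,
  λ z p → case g p of λ { (here q) → inj₁ q ; (there (here q)) → inj₂ q }
... | _ ∷ _ ∷ _ ∷ _ | len | _ | _ | _ = case trans len eq of λ ()

-- Structure and rigidity of networks

module _ {m} {E : Rel (Fin m) 0ℓ} (acyclic : ∀ v → ¬ TransClosure E v v) where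

  private
    plus-isStrictPartialOrder : IsStrictPartialOrder _≡_ (TransClosure E)
    plus-isStrictPartialOrder = record
      { isEquivalence = ≡.isEquivalence
      ; irrefl        = λ { refl → acyclic _ }
      ; trans         = Plus._++_
      ; <-resp-≈      = ≡.resp₂ _
      }

  descendants-wellFounded : WellFounded (flip (TransClosure E))
  descendants-wellFounded = spo-noetherian plus-isStrictPartialOrder

  -- Climbing from parent to parent is well founded in a finite acyclic graph, and it can only stop
  -- at `o`.
  acyclic⇒reachable : ∀ {o} → (∀ v → v ≡ o ⊎ ∃ λ u → E u v) → ∀ v → Star E o v
  acyclic⇒reachable {o} parent v = go v (spo-wellFounded plus-isStrictPartialOrder v)
    where
    go : ∀ v → Acc (TransClosure E) v → Star E o v
    go v (acc rs) with parent v
    ... | inj₁ refl    = ε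
    ... | inj₂ (u , e) = go u (rs [ e ]) ◅◅ (e ◅ ε)

-- Z is a trap for E′: once entered it is never left, and the arcs of E′
-- that are missing from E only lead into it.
trap⇒acyclic : ∀ {A : Set} {E E′ : Rel A 0ℓ} (Z : Pred A 0ℓ) →
  (∀ {u w} → Z u → E′ u w → E u w × Z w) →
  (∀ {u w} → E′ u w → E u w ⊎ Z w) →
  (∀ v → ¬ TransClosure E v v) → ∀ v → ¬ TransClosure E′ v v
trap⇒acyclic {E = E} {E′} Z inside into acyclic v cycle =
  [ acyclic v , (λ z → acyclic v (proj₁ (inside⁺ z cycle))) ]′ (outside cycle)
  where
  inside⁺ : ∀ {u w} → Z u → TransClosure E′ u w → TransClosure E u w × Z w
  inside⁺ z [ e ]   = let e′ , z′ = inside z e in [ e′ ] , z′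
  inside⁺ z (e ∷ p) = let e′ , z′ = inside z e ; p′ , z″ = inside⁺ z′ p in e′ ∷ p′ , z″
  outside : ∀ {u w} → TransClosure E′ u w → TransClosure E u w ⊎ Z w
  outside [ e ]   = Sum.map₁ [_] (into e)
  outside (e ∷ p) with into e | outside p
  ... | _      | inj₂ z  = inj₂ z
  ... | inj₁ f | inj₁ p′ = inj₁ (f ∷ p′)
  ... | inj₂ z | _       = inj₂ (proj₂ (inside⁺ z p))

ret? : ∀ k → Dec (k ≡ reticulation)
ret? root         = no λ ()
ret? tree         = no λ ()
ret? reticulation = yes refl
ret? leaf         = no λ ()

NonRet : Pred Mark 0ℓ
NonRet k = k ≡ tree ⊎ k ≡ leaf

ret⇒¬NonRet : ∀ {k} → k ≡ reticulation → ¬ NonRet k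
ret⇒¬NonRet refl (inj₁ ())
ret⇒¬NonRet refl (inj₂ ())

degree-injective : ∀ k l → degree k ≡ degree l → k ≡ l
degree-injective root         root         _ = refl
degree-injective tree         tree         _ = refl
degree-injective reticulation reticulation _ = refl
degree-injective leaf         leaf         _ = refl

module _ {n m} {edge : Fin m → Fin m → Bool} {o : Fin m} {mark : Fin m → Mark} {label : Fin n → Fin m} where
  open Digraph edge

  abstract
    -- Reachability is derived here once for both switchings: every mark except `root` has positive
    -- indegree, so `acyclic⇒reachable` applies.
    simplexTreeChild :
      (∀ v → ¬ TransClosure _⟶_ v v) →
      (∀ v → mark v ≡ root ⇔ v ≡ o) →
      (∀ v → (indegree v , outdegree v) ≡ degree (mark v)) →
      (∀ i j → label i ≡ label j → i ≡ j) →
      (∀ v → mark v ≡ leaf ⇔ ∃ λ i → label i ≡ v) →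
      (∀ v → mark v ≢ leaf → ∃ λ w → v ⟶ w × NonRet (mark w)) →
      (∀ v w → mark v ≡ reticulation → v ⟶ w → mark w ≡ leaf) →
      IsSimplexTreeChild edge o mark label
    simplexTreeChild acyclic root-mark degrees label-injective label-image tree-child one-component = record
      { acyclic         = acyclic
      ; reachable       = acyclic⇒reachable acyclic parent
      ; root-mark       = root-mark
      ; degrees         = degrees
      ; label-injective = label-injective
      ; label-image     = label-image
      ; tree-child      = tree-child
      ; one-component   = one-component
      }
      where
      parent : ∀ v → v ≡ o ⊎ ∃ λ u → u ⟶ v
      parent v with mark v | cong proj₁ (degrees v) | Equivalence.to (root-mark v)
      ... | root         | _ | h = inj₁ (h refl)
      ... | tree         | d | _ = let u , e , _ = ∣tabulate∣≡1 (λ u → edge u v) d in inj₂ (u , e)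
      ... | reticulation | d | _ = let u , _ , _ , e , _ = ∣tabulate∣≡2 (λ u → edge u v) d in inj₂ (u , e)
      ... | leaf         | d | _ = let u , e , _ = ∣tabulate∣≡1 (λ u → edge u v) d in inj₂ (u , e)

module Net {n} (N : Network n) where
  open Network N public

  indegree≡ : ∀ {v k} → mark v ≡ k → indegree v ≡ proj₁ (degree k)
  indegree≡ {v} refl = cong proj₁ (degrees v)

  outdegree≡ : ∀ {v k} → mark v ≡ k → outdegree v ≡ proj₂ (degree k)
  outdegree≡ {v} refl = cong proj₂ (degrees v)

  leaf-childless : ∀ {v w} → mark v ≡ leaf → ¬ v ⟶ w
  leaf-childless {v} {w} k = ∣tabulate∣≡0 (edge v) (outdegree≡ k) w

  root-parentless : ∀ {u w} → mark w ≡ root → ¬ u ⟶ w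
  root-parentless {u} {w} k = ∣tabulate∣≡0 (λ u → edge u w) (indegree≡ k) u

  parent : ∀ {w} → NonRet (mark w) → ∃ λ u → u ⟶ w × (∀ u′ → u′ ⟶ w → u′ ≡ u)
  parent {w} (inj₁ k) = ∣tabulate∣≡1 (λ u → edge u w) (indegree≡ k)
  parent {w} (inj₂ k) = ∣tabulate∣≡1 (λ u → edge u w) (indegree≡ k)

  parent-unique : ∀ {u u′ w} → NonRet (mark w) → u ⟶ w → u′ ⟶ w → u ≡ u′
  parent-unique k e e′ = let _ , _ , h = parent k in trans (h _ e) (sym (h _ e′))

  parents-of-ret : ∀ {w} → mark w ≡ reticulation →
    ∃₂ λ x y → x ≢ y × x ⟶ w × y ⟶ w × (∀ u → u ⟶ w → u ≡ x ⊎ u ≡ y)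
  parents-of-ret {w} k = ∣tabulate∣≡2 (λ u → edge u w) (indegree≡ k)

  three-parents : ∀ {x y z w} → mark w ≡ reticulation → x ≢ y → x ⟶ w → y ⟶ w → z ⟶ w → z ≡ x ⊎ z ≡ y
  three-parents k x≢y ex ey ez with parents-of-ret k
  ... | _ , _ , _ , _ , _ , h with h _ ex | h _ ey | h _ ez
  ... | inj₁ refl | inj₁ refl | _         = contradiction refl x≢y
  ... | inj₁ refl | inj₂ refl | inj₁ refl = inj₁ refl
  ... | inj₁ refl | inj₂ refl | inj₂ refl = inj₂ refl
  ... | inj₂ refl | inj₁ refl | inj₁ refl = inj₂ refl
  ... | inj₂ refl | inj₁ refl | inj₂ refl = inj₁ refl
  ... | inj₂ refl | inj₂ refl | _         = contradiction refl x≢y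

  other-parent : ∀ {x w} → mark w ≡ reticulation → x ⟶ w → ∃ λ y → x ≢ y × y ⟶ w
  other-parent k e with parents-of-ret k
  ... | x , y , x≢y , ex , ey , h with h _ e
  ...   | inj₁ refl = y , x≢y , ey
  ...   | inj₂ refl = x , (x≢y ∘ sym) , ex

  child : ∀ {v} → mark v ≡ root ⊎ mark v ≡ reticulation → ∃ λ w → v ⟶ w × (∀ w′ → v ⟶ w′ → w′ ≡ w)
  child {v} (inj₁ k) = ∣tabulate∣≡1 (edge v) (outdegree≡ k)
  child {v} (inj₂ k) = ∣tabulate∣≡1 (edge v) (outdegree≡ k)

  child-unique : ∀ {v w w′} → mark v ≡ root ⊎ mark v ≡ reticulation → v ⟶ w → v ⟶ w′ → w ≡ w′
  child-unique k e e′ = let _ , _ , h = child k in trans (h _ e) (sym (h _ e′))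

  children-of-tree : ∀ {v} → mark v ≡ tree →
    ∃₂ λ x y → x ≢ y × v ⟶ x × v ⟶ y × (∀ w → v ⟶ w → w ≡ x ⊎ w ≡ y)
  children-of-tree {v} k = ∣tabulate∣≡2 (edge v) (outdegree≡ k)

  three-children : ∀ {x y z v} → mark v ≡ tree → x ≢ y → v ⟶ x → v ⟶ y → v ⟶ z → z ≡ x ⊎ z ≡ y
  three-children k x≢y ex ey ez with children-of-tree k
  ... | _ , _ , _ , _ , _ , h with h _ ex | h _ ey | h _ ez
  ... | inj₁ refl | inj₁ refl | _         = contradiction refl x≢y
  ... | inj₁ refl | inj₂ refl | inj₁ refl = inj₁ refl
  ... | inj₁ refl | inj₂ refl | inj₂ refl = inj₂ refl
  ... | inj₂ refl | inj₁ refl | inj₁ refl = inj₂ refl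
  ... | inj₂ refl | inj₁ refl | inj₂ refl = inj₁ refl
  ... | inj₂ refl | inj₂ refl | _         = contradiction refl x≢y

  target-mark : ∀ {u w} → u ⟶ w → NonRet (mark w) ⊎ mark w ≡ reticulation
  target-mark {w = w} e with mark w in eq
  ... | root         = contradiction e (root-parentless eq)
  ... | tree         = inj₁ (inj₁ refl)
  ... | reticulation = inj₂ refl
  ... | leaf         = inj₁ (inj₂ refl)

  -- A leaf has no child, a reticulation has only a leaf below it, and the single child of the root
  -- is not a reticulation by `tree-child`.
  parent-of-ret : ∀ {u w} → mark w ≡ reticulation → u ⟶ w → mark u ≡ tree
  parent-of-ret {u} {w} k e with mark u in eq
  ... | tree         = refl
  ... | leaf         = contradiction e (leaf-childless eq)
  ... | reticulation = case trans (sym k) (one-component u w eq e) of λ ()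
  ... | root         with tree-child u (λ k′ → case trans (sym eq) k′ of λ ())
  ...   | w′ , e′ , nr with child-unique (inj₁ eq) e e′
  ...     | refl = contradiction nr (ret⇒¬NonRet k)

  -- One of the two children of a tree vertex is reserved by `tree-child`. Hence a parent determines
  -- its reticulation, which lets `exchange-reflects` recover both reticulations from `x` and `y`.
  ret-child-unique : ∀ {u w w′} → mark w ≡ reticulation → mark w′ ≡ reticulation → u ⟶ w → u ⟶ w′ → w ≡ w′
  ret-child-unique {u} k k′ e e′ with parent-of-ret k e
  ... | t with tree-child u (λ l → case trans (sym t) l of λ ())
  ... | c , ec , nr with three-children t (λ { refl → ret⇒¬NonRet k nr }) ec e e′
  ...   | inj₁ refl = contradiction nr (ret⇒¬NonRet k′)
  ...   | inj₂ eq   = sym eq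

  nonret-child-unique : ∀ {u r w w′} → mark r ≡ reticulation → u ⟶ r →
    NonRet (mark w) → NonRet (mark w′) → u ⟶ w → u ⟶ w′ → w ≡ w′
  nonret-child-unique k er nr nr′ e e′ with three-children (parent-of-ret k er) (λ { refl → ret⇒¬NonRet k nr }) er e e′
  ... | inj₁ refl = contradiction nr′ (ret⇒¬NonRet k)
  ... | inj₂ eq   = sym eq

  label-mark : ∀ i → mark (label i) ≡ leaf
  label-mark i = Equivalence.from (label-image _) (i , refl)

  o-mark : mark o ≡ root
  o-mark = Equivalence.from (root-mark o) refl

  root⇒o : ∀ {v} → mark v ≡ root → v ≡ o
  root⇒o = Equivalence.to (root-mark _)

  leaf-of-ret : ∀ {w} → mark w ≡ reticulation → ∃ λ i → w ⟶ label i
  leaf-of-ret k with child (inj₂ k)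
  ... | c , e , _ with Equivalence.to (label-image c) (one-component _ c k e)
  ...   | i , refl = i , e

module Iso {n} {M N : Network n} (e : M ≃ N) where
  private
    module M = Net M
    module N = Net N
  open _≃_ e public

  to-injective : ∀ {x y} → to x ≡ to y → x ≡ y
  to-injective eq = trans (sym (strictlyInverseʳ _)) (trans (cong from eq) (strictlyInverseʳ _))

  edge⁺ : ∀ {v w} → v M.⟶ w → to v N.⟶ to w
  edge⁺ = subst T (sym (edge-preserved _ _))

  edge⁻ : ∀ {v w} → to v N.⟶ to w → v M.⟶ w
  edge⁻ = subst T (edge-preserved _ _)

module _ {n} {M N : Network n} (e : M ≃ N) where
  private
    module M = Net M
    module N = Net N
    module e = Iso e
    module e⁻¹ = Iso (≃-sym e)

    from-edge : ∀ {v w} → v N.⟶ e.to w → e.from v M.⟶ w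
    from-edge h = e.edge⁻ (subst (N._⟶ _) (sym (e.strictlyInverseˡ _)) h)

    from-edge′ : ∀ {v w} → e.to v N.⟶ w → v M.⟶ e.from w
    from-edge′ h = e.edge⁻ (subst (_ N.⟶_) (sym (e.strictlyInverseˡ _)) h)

  abstract
    -- `_≃_` speaks of edges and labels only, but marks can be read off from degrees, and degrees
    -- are compared by injections along `to` and `from`.
    mark-preserved : ∀ v → N.mark (e.to v) ≡ M.mark v
    mark-preserved v = degree-injective _ _ (trans (sym (N.degrees (e.to v))) (trans (cong₂ _,_
        (ℕₚ.≤-antisym
          (∣tabulate∣-≤ e.from e⁻¹.to-injective (λ _ → from-edge))
          (∣tabulate∣-≤ e.to e.to-injective (λ _ → e.edge⁺)))
        (ℕₚ.≤-antisym
          (∣tabulate∣-≤ e.from e⁻¹.to-injective (λ _ → from-edge′))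
          (∣tabulate∣-≤ e.to e.to-injective (λ _ → e.edge⁺))))
      (M.degrees v)))

  ret-preserved : ∀ {v} → M.mark v ≡ reticulation → N.mark (e.to v) ≡ reticulation
  ret-preserved {v} = trans (mark-preserved v)

-- Every internal vertex is the only parent of one of its children, so a
-- label-preserving automorphism fixes the vertices from the leaves upwards.
rigid : ∀ {n} {N : Network n} (e : N ≃ N) → ∀ v → _≃_.to e v ≡ v
rigid {N = N} e v = go v (descendants-wellFounded acyclic v)
  where
  open Net N
  open Iso e using (to; edge⁺; label-preserved)
  internal : ∀ v → Acc (flip (TransClosure _⟶_)) v → mark v ≢ leaf → to v ≡ v
  go : ∀ v → Acc (flip (TransClosure _⟶_)) v → to v ≡ v
  go v a with mark v in eq
  ... | leaf with Equivalence.to (label-image v) eq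
  ...   | i , refl = label-preserved i
  go v a | root         = internal v a (λ k → case trans (sym eq) k of λ ())
  go v a | tree         = internal v a (λ k → case trans (sym eq) k of λ ())
  go v a | reticulation = internal v a (λ k → case trans (sym eq) k of λ ())
  internal v (acc rs) k with tree-child v k
  ... | w , v⟶w , nr = parent-unique nr (subst (to v ⟶_) (go w (rs [ v⟶w ])) (edge⁺ v⟶w)) v⟶w

module Classes (n : ℕ) where
  open Enumeration (networks n) public using (size; representative)
  open Enumeration (networks n) using (bijection)

  class : Network n → Fin size
  class N = proj₁ (Bijection.surjective bijection N)

  class-≃ : ∀ N → N ≃ representative (class N)
  class-≃ N = ≃-sym (proj₂ (Bijection.surjective bijection N) refl)

  representative-injective : ∀ {c d} → representative c ≃ representative d → c ≡ d
  representative-injective = Bijection.injective bijection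

-- Vertex counts

⟦_⟧ : Bool → ℕ
⟦ true  ⟧ = 1
⟦ false ⟧ = 0

∣tabulate∣≡sum : ∀ {m} (f : Fin m → Bool) → ∣ tabulate f ∣ ≡ sum (λ i → ⟦ f i ⟧)
∣tabulate∣≡sum {zero}  f = refl
∣tabulate∣≡sum {suc m} f with f zero
... | true  = cong suc (∣tabulate∣≡sum (f ∘ suc))
... | false = ∣tabulate∣≡sum (f ∘ suc)

sum-ones : ∀ m → sum {m} (λ _ → 1) ≡ m
sum-ones zero    = refl
sum-ones (suc m) = cong suc (sum-ones m)

indicator-yes : {P : Set} (P? : Dec P) → P → ⟦ ⌊ P? ⌋ ⟧ ≡ 1
indicator-yes (yes _) _ = refl
indicator-yes (no ¬p) p = contradiction p ¬p

indicator-no : {P : Set} (P? : Dec P) → ¬ P → ⟦ ⌊ P? ⌋ ⟧ ≡ 0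
indicator-no (yes p) ¬p = contradiction p ¬p
indicator-no (no _)  _  = refl

root? : ∀ k → Dec (k ≡ root)
root? root         = yes refl
root? tree         = no λ ()
root? reticulation = no λ ()
root? leaf         = no λ ()

tree? : ∀ k → Dec (k ≡ tree)
tree? root         = no λ ()
tree? tree         = yes refl
tree? reticulation = no λ ()
tree? leaf         = no λ ()

leaf? : ∀ k → Dec (k ≡ leaf)
leaf? root         = no λ ()
leaf? tree         = no λ ()
leaf? reticulation = no λ ()
leaf? leaf         = yes refl

satisfying : ∀ {m} {P : Pred (Fin m) 0ℓ} → Decidable P → List (Fin m)
satisfying P? = trues (λ v → ⌊ P? v ⌋)

module _ {m} {P : Pred (Fin m) 0ℓ} (P? : Decidable P) where

  ∈-satisfying⁺ : ∀ {x} → P x → x ∈ satisfying P?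
  ∈-satisfying⁺ p = ∈-trues⁺ _ (fromWitness p)

  ∈-satisfying⁻ : ∀ {x} → x ∈ satisfying P? → P x
  ∈-satisfying⁻ p = toWitness (∈-trues⁻ _ p)

  satisfying-unique : Unique (satisfying P?)
  satisfying-unique = trues-unique _

  length-satisfying : length (satisfying P?) ≡ sum (λ v → ⟦ ⌊ P? v ⌋ ⟧)
  length-satisfying = trans (length-trues f) (∣tabulate∣≡sum f)
    where
    f : Fin m → Bool
    f v = ⌊ P? v ⌋

module Kinds {n} (N : Network n) where
  open Net N

  -- `Special` collects the kinds of vertices that do not occur in `R̂`, where every spine vertex
  -- has a reticulation child and every leaf hangs below a reticulation. Together with the root the
  -- `Skeleton` vertices form a tree: the network without its reticulations and the leaves below
  -- them.
  HasRetParent HasRetChild TreeLeaf Branch Special Skeleton : Pred (Fin order) 0ℓ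
  HasRetParent v = ∃ λ u → u ⟶ v × mark u ≡ reticulation
  HasRetChild  v = ∃ λ w → v ⟶ w × mark w ≡ reticulation
  TreeLeaf     v = mark v ≡ leaf × ¬ HasRetParent v
  Branch       v = mark v ≡ tree × ¬ HasRetChild v
  Special      v = mark v ≡ root ⊎ Branch v ⊎ TreeLeaf v
  Skeleton     v = mark v ≡ tree ⊎ TreeLeaf v

  hasRetParent? : Decidable HasRetParent
  hasRetParent? v = any? (λ u → T? (edge u v) ×-dec ret? (mark u))

  hasRetChild? : Decidable HasRetChild
  hasRetChild? v = any? (λ w → T? (edge v w) ×-dec ret? (mark w))

  treeLeaf? : Decidable TreeLeaf
  treeLeaf? v = leaf? (mark v) ×-dec ¬? (hasRetParent? v)

  branch? : Decidable Branch
  branch? v = tree? (mark v) ×-dec ¬? (hasRetChild? v)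

  special? : Decidable Special
  special? v = root? (mark v) ⊎-dec branch? v ⊎-dec treeLeaf? v

  skeleton? : Decidable Skeleton
  skeleton? v = tree? (mark v) ⊎-dec treeLeaf? v

  treeLeaves branches specials : List (Fin order)
  treeLeaves = satisfying treeLeaf?
  branches   = satisfying branch?
  specials   = satisfying special?

  skeleton⇒nonRet : ∀ {v} → Skeleton v → NonRet (mark v)
  skeleton⇒nonRet (inj₁ k)       = inj₁ k
  skeleton⇒nonRet (inj₂ (k , _)) = inj₂ k

  nonRet⇒skeleton : ∀ {u w} → mark u ≢ reticulation → u ⟶ w → NonRet (mark w) → Skeleton w
  nonRet⇒skeleton ¬r e (inj₁ k) = inj₁ k
  nonRet⇒skeleton ¬r e (inj₂ k) = inj₂ (k , λ (u′ , e′ , r) → ¬r (trans (cong mark (parent-unique (inj₂ k) e e′)) r))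

  private
    skeletal : Fin order → Fin order → Bool
    skeletal u w = edge u w ∧ ⌊ skeleton? w ⌋

    skeletal⁺ : ∀ {u w} → u ⟶ w → Skeleton w → T (skeletal u w)
    skeletal⁺ e s = Equivalence.from T-∧ (e , fromWitness s)

    skeletal⁻ : ∀ {u w} → T (skeletal u w) → u ⟶ w × Skeleton w
    skeletal⁻ p = let e , s = Equivalence.to T-∧ p in e , toWitness s

    indegree-skeletal : ∀ w → sum (λ u → ⟦ skeletal u w ⟧) ≡ ⟦ ⌊ skeleton? w ⌋ ⟧
    indegree-skeletal w = trans (sym (∣tabulate∣≡sum (λ u → skeletal u w))) (lemma (skeleton? w))
      where
      lemma : (d : Dec (Skeleton w)) → ∣ tabulate (λ u → skeletal u w) ∣ ≡ ⟦ ⌊ d ⌋ ⟧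
      lemma (no ¬s) = ∣tabulate∣≡length (λ u → skeletal u w) {xs = []} [] (λ u p → contradiction (proj₂ (skeletal⁻ p)) ¬s) (λ ())
      lemma (yes s) with parent (skeleton⇒nonRet s)
      ... | u , e , unique = ∣tabulate∣≡length (λ u → skeletal u w) {xs = u ∷ []} ([] ∷ [])
        (λ u′ p → here (unique u′ (proj₁ (skeletal⁻ p)))) (λ { (here refl) → skeletal⁺ e s })

    -- In the skeleton tree the outdegree is one at the root and at tree vertices with a
    -- reticulation child, two at branches and zero elsewhere. The tree leaves stand on the left so
    -- that the identity has no subtraction and can be summed.
    outdegree-skeletal : ∀ v → ∣ tabulate (skeletal v) ∣ + ⟦ ⌊ treeLeaf? v ⌋ ⟧ ≡
      ⟦ ⌊ skeleton? v ⌋ ⟧ + (⟦ ⌊ branch? v ⌋ ⟧ + ⟦ ⌊ root? (mark v) ⌋ ⟧)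
    outdegree-skeletal v = lemma (mark v) refl
      where
      assemble : ∀ {a b c d e a′ b′ c′ d′ e′} → a ≡ a′ → b ≡ b′ → c ≡ c′ → d ≡ d′ → e ≡ e′ →
        a′ + b′ ≡ c′ + (d′ + e′) → a + b ≡ c + (d + e)
      assemble refl refl refl refl refl eq = eq
      at-tree : mark v ≡ tree → Dec (HasRetChild v) → ∣ tabulate (skeletal v) ∣ + ⟦ ⌊ treeLeaf? v ⌋ ⟧ ≡
        ⟦ ⌊ skeleton? v ⌋ ⟧ + (⟦ ⌊ branch? v ⌋ ⟧ + ⟦ ⌊ root? (mark v) ⌋ ⟧)
      at-leaf : mark v ≡ leaf → Dec (HasRetParent v) → ∣ tabulate (skeletal v) ∣ + ⟦ ⌊ treeLeaf? v ⌋ ⟧ ≡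
        ⟦ ⌊ skeleton? v ⌋ ⟧ + (⟦ ⌊ branch? v ⌋ ⟧ + ⟦ ⌊ root? (mark v) ⌋ ⟧)
      lemma : ∀ k → mark v ≡ k → ∣ tabulate (skeletal v) ∣ + ⟦ ⌊ treeLeaf? v ⌋ ⟧ ≡
        ⟦ ⌊ skeleton? v ⌋ ⟧ + (⟦ ⌊ branch? v ⌋ ⟧ + ⟦ ⌊ root? (mark v) ⌋ ⟧)
      lemma root eq with tree-child v (λ k → case trans (sym eq) k of λ ())
      ... | c , e , nr = assemble
        (∣tabulate∣≡length (skeletal v) {xs = c ∷ []} ([] ∷ [])
          (λ w p → here (child-unique (inj₁ eq) (proj₁ (skeletal⁻ p)) e))
          (λ { (here refl) → skeletal⁺ e (nonRet⇒skeleton (λ k → case trans (sym eq) k of λ ()) e nr) }))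
        (indicator-no (treeLeaf? v) (λ (k , _) → case trans (sym eq) k of λ ()))
        (indicator-no (skeleton? v) (λ { (inj₁ k) → case trans (sym eq) k of λ () ; (inj₂ (k , _)) → case trans (sym eq) k of λ () }))
        (indicator-no (branch? v) (λ (k , _) → case trans (sym eq) k of λ ()))
        (indicator-yes (root? (mark v)) eq)
        refl
      lemma reticulation eq with child (inj₂ eq)
      ... | c , e , unique = assemble
        (∣tabulate∣≡length (skeletal v) {xs = []} []
          (λ w p → let e′ , s = skeletal⁻ p in
            case s of λ { (inj₁ k) → case trans (sym k) (one-component v w eq e′) of λ ()
                        ; (inj₂ (_ , ¬r)) → contradiction (v , e′ , eq) ¬r })
          (λ ()))
        (indicator-no (treeLeaf? v) (λ (k , _) → case trans (sym eq) k of λ ()))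
        (indicator-no (skeleton? v) (λ { (inj₁ k) → case trans (sym eq) k of λ () ; (inj₂ (k , _)) → case trans (sym eq) k of λ () }))
        (indicator-no (branch? v) (λ (k , _) → case trans (sym eq) k of λ ()))
        (indicator-no (root? (mark v)) (λ k → case trans (sym eq) k of λ ()))
        refl
      lemma tree eq = at-tree eq (hasRetChild? v)
      lemma leaf eq = at-leaf eq (hasRetParent? v)
      at-tree eq (yes (r , er , kr)) with tree-child v (λ k → case trans (sym eq) k of λ ())
      ... | c , e , nr = assemble
        (∣tabulate∣≡length (skeletal v) {xs = c ∷ []} ([] ∷ [])
          (λ w p → let e′ , s = skeletal⁻ p in here (nonret-child-unique kr er (skeleton⇒nonRet s) nr e′ e))
          (λ { (here refl) → skeletal⁺ e (nonRet⇒skeleton (λ k → case trans (sym eq) k of λ ()) e nr) }))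
        (indicator-no (treeLeaf? v) (λ (k , _) → case trans (sym eq) k of λ ()))
        (indicator-yes (skeleton? v) (inj₁ eq))
        (indicator-no (branch? v) (λ (_ , ¬r) → ¬r (r , er , kr)))
        (indicator-no (root? (mark v)) (λ k → case trans (sym eq) k of λ ()))
        refl
      at-tree eq (no ¬r) with children-of-tree eq
      ... | x , y , x≢y , ex , ey , cases = assemble
        (∣tabulate∣≡length (skeletal v) {xs = x ∷ y ∷ []} ((x≢y ∷ []) ∷ [] ∷ [])
          (λ w p → [ here , there ∘ here ]′ (cases w (proj₁ (skeletal⁻ p))))
          (λ { (here refl) → skeletal⁺ ex (skel ex) ; (there (here refl)) → skeletal⁺ ey (skel ey) }))
        (indicator-no (treeLeaf? v) (λ (k , _) → case trans (sym eq) k of λ ()))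
        (indicator-yes (skeleton? v) (inj₁ eq))
        (indicator-yes (branch? v) (eq , ¬r))
        (indicator-no (root? (mark v)) (λ k → case trans (sym eq) k of λ ()))
        refl
        where
        skel : ∀ {w} → v ⟶ w → Skeleton w
        skel e with target-mark e
        ... | inj₁ nr = nonRet⇒skeleton (λ k → case trans (sym eq) k of λ ()) e nr
        ... | inj₂ r  = contradiction (_ , e , r) ¬r
      at-leaf eq (yes r) = assemble
        (∣tabulate∣≡length (skeletal v) {xs = []} [] (λ w p → contradiction (proj₁ (skeletal⁻ p)) (leaf-childless eq)) (λ ()))
        (indicator-no (treeLeaf? v) (λ (_ , ¬r) → ¬r r))
        (indicator-no (skeleton? v) (λ { (inj₁ k) → case trans (sym eq) k of λ () ; (inj₂ (_ , ¬r)) → ¬r r }))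
        (indicator-no (branch? v) (λ (k , _) → case trans (sym eq) k of λ ()))
        (indicator-no (root? (mark v)) (λ k → case trans (sym eq) k of λ ()))
        refl
      at-leaf eq (no ¬r) = assemble
        (∣tabulate∣≡length (skeletal v) {xs = []} [] (λ w p → contradiction (proj₁ (skeletal⁻ p)) (leaf-childless eq)) (λ ()))
        (indicator-yes (treeLeaf? v) (eq , ¬r))
        (indicator-yes (skeleton? v) (inj₂ (eq , ¬r)))
        (indicator-no (branch? v) (λ (k , _) → case trans (sym eq) k of λ ()))
        (indicator-no (root? (mark v)) (λ k → case trans (sym eq) k of λ ()))
        refl

    length-roots : length (satisfying (root? ∘ mark)) ≡ 1
    length-roots = trans (length-trues f) (∣tabulate∣≡length f {xs = o ∷ []} ([] ∷ [])
      (λ v p → here (root⇒o (toWitness p))) (λ { (here refl) → fromWitness o-mark }))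
      where
      f : Fin order → Bool
      f v = ⌊ root? (mark v) ⌋

  abstract
    -- The edges of the skeleton tree are counted by heads, which gives `S`, and by tails through
    -- `outdegree-skeletal`. This is the usual relation between the leaves and the binary vertices
    -- of a rooted tree.
    length-treeLeaves : length treeLeaves ≡ suc (length branches)
    length-treeLeaves = ℕₚ.+-cancelˡ-≡ S _ _ (begin
      S + length treeLeaves
        ≡⟨ cong₂ _+_ double-count (length-satisfying treeLeaf?) ⟩
      sum (λ v → ∣ tabulate (skeletal v) ∣) + sum (λ v → ⟦ ⌊ treeLeaf? v ⌋ ⟧)
        ≡⟨ ∑-distrib-+ (λ v → ∣ tabulate (skeletal v) ∣) _ ⟨
      sum (λ v → ∣ tabulate (skeletal v) ∣ + ⟦ ⌊ treeLeaf? v ⌋ ⟧)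
        ≡⟨ sum-cong-≗ outdegree-skeletal ⟩
      sum (λ v → ⟦ ⌊ skeleton? v ⌋ ⟧ + (⟦ ⌊ branch? v ⌋ ⟧ + ⟦ ⌊ root? (mark v) ⌋ ⟧))
        ≡⟨ ∑-distrib-+ (λ v → ⟦ ⌊ skeleton? v ⌋ ⟧) _ ⟩
      S + sum (λ v → ⟦ ⌊ branch? v ⌋ ⟧ + ⟦ ⌊ root? (mark v) ⌋ ⟧)
        ≡⟨ cong (S +_) (∑-distrib-+ (λ v → ⟦ ⌊ branch? v ⌋ ⟧) _) ⟩
      S + (sum (λ v → ⟦ ⌊ branch? v ⌋ ⟧) + sum (λ v → ⟦ ⌊ root? (mark v) ⌋ ⟧))
        ≡⟨ cong (S +_) (cong₂ _+_ (length-satisfying branch?) (length-satisfying (root? ∘ mark))) ⟨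
      S + (length branches + length (satisfying (root? ∘ mark)))
        ≡⟨ cong (λ x → S + (length branches + x)) length-roots ⟩
      S + (length branches + 1)
        ≡⟨ cong (S +_) (ℕₚ.+-comm _ 1) ⟩
      S + suc (length branches) ∎)
      where
      open ≡.≡-Reasoning
      S : ℕ
      S = sum (λ v → ⟦ ⌊ skeleton? v ⌋ ⟧)
      double-count : S ≡ sum (λ v → ∣ tabulate (skeletal v) ∣)
      double-count = trans (sum-cong-≗ (sym ∘ indegree-skeletal))
        (trans (∑-comm (λ w u → ⟦ skeletal u w ⟧)) (sum-cong-≗ (λ v → sym (∣tabulate∣≡sum (skeletal v)))))

  abstract
    length-specials-≤ : length specials ≤ 2 * length treeLeaves
    length-specials-≤ = begin
      length specials
        ≤⟨ ⊆⇒length-≤ {ys = (o ∷ branches) ++ treeLeaves} (satisfying-unique special?) (sub ∘ ∈-satisfying⁻ special?) ⟩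
      length ((o ∷ branches) ++ treeLeaves)
        ≡⟨ length-++ (o ∷ branches) ⟩
      suc (length branches) + length treeLeaves
        ≡⟨ cong₂ _+_ length-treeLeaves (ℕₚ.+-identityʳ _) ⟨
      2 * length treeLeaves ∎
      where
      open ℕₚ.≤-Reasoning
      sub : ∀ {v} → Special v → v ∈ (o ∷ branches) ++ treeLeaves
      sub (inj₁ k)        = here (root⇒o k)
      sub (inj₂ (inj₁ b)) = there (∈-++⁺ˡ (∈-satisfying⁺ branch? b))
      sub (inj₂ (inj₂ t)) = ∈-++⁺ʳ (o ∷ branches) (∈-satisfying⁺ treeLeaf? t)

  private
    -- A local form of the handshake identity: in the sum over all vertices the indegrees and
    -- outdegrees cancel, and twice the number of reticulations and leaves is left, which is
    -- `order≡`.
    weights : ∀ k → 1 + proj₁ (degree k) ≡ proj₂ (degree k) + 2 * (⟦ ⌊ ret? k ⌋ ⟧ + ⟦ ⌊ leaf? k ⌋ ⟧)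
    weights root         = refl
    weights tree         = refl
    weights reticulation = refl
    weights leaf         = refl

    rets leaves : List (Fin order)
    rets   = satisfying (ret? ∘ mark)
    leaves = satisfying (leaf? ∘ mark)

    order≡ : order ≡ 2 * (length rets + length leaves)
    order≡ = ℕₚ.+-cancelʳ-≡ (sum outdegree) _ _ (begin
      order + sum outdegree
        ≡⟨ cong₂ _+_ (sym (sum-ones order)) handshake ⟩
      sum {order} (λ _ → 1) + sum indegree
        ≡⟨ ∑-distrib-+ (λ _ → 1) indegree ⟨
      sum (λ v → 1 + indegree v)
        ≡⟨ sum-cong-≗ pointwise ⟩
      sum (λ v → outdegree v + 2 * (r v + l v))
        ≡⟨ ∑-distrib-+ outdegree _ ⟩
      sum outdegree + sum (λ v → 2 * (r v + l v))
        ≡⟨ cong (sum outdegree +_) (*-distribˡ-sum 2 (λ v → r v + l v)) ⟨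
      sum outdegree + 2 * sum (λ v → r v + l v)
        ≡⟨ cong (λ x → sum outdegree + 2 * x) (∑-distrib-+ r l) ⟩
      sum outdegree + 2 * (sum r + sum l)
        ≡⟨ cong (λ x → sum outdegree + 2 * x) (cong₂ _+_ (length-satisfying (ret? ∘ mark)) (length-satisfying (leaf? ∘ mark))) ⟨
      sum outdegree + 2 * (length rets + length leaves)
        ≡⟨ ℕₚ.+-comm (sum outdegree) _ ⟩
      2 * (length rets + length leaves) + sum outdegree ∎)
      where
      open ≡.≡-Reasoning
      r l : Fin order → ℕ
      r v = ⟦ ⌊ ret? (mark v) ⌋ ⟧
      l v = ⟦ ⌊ leaf? (mark v) ⌋ ⟧
      handshake : sum outdegree ≡ sum indegree
      handshake = trans (sum-cong-≗ (λ v → ∣tabulate∣≡sum (edge v)))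
        (trans (∑-comm (λ v w → ⟦ edge v w ⟧)) (sum-cong-≗ (λ w → sym (∣tabulate∣≡sum (λ v → edge v w)))))
      pointwise : ∀ v → 1 + indegree v ≡ outdegree v + 2 * (r v + l v)
      pointwise v = subst₂ (λ a b → 1 + a ≡ b + 2 * (r v + l v)) (sym (indegree≡ refl)) (sym (outdegree≡ refl)) (weights (mark v))

    length-leaves-≤ : length leaves ≤ n
    length-leaves-≤ = subst (length leaves ≤_) (length-tabulate {n = n} id)
      (length-≤ {R = λ v i → label i ≡ v} (satisfying-unique (leaf? ∘ mark))
        (λ p → let i , eq = Equivalence.to (label-image _) (∈-satisfying⁻ (leaf? ∘ mark) p) in i , ∈-allFin i , eq)
        (λ _ _ p q → trans (sym p) q))

    length-rets-≤ : length rets ≤ n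
    length-rets-≤ = subst (length rets ≤_) (length-tabulate {n = n} id)
      (length-≤ {R = λ v i → v ⟶ label i} (satisfying-unique (ret? ∘ mark))
        (λ p → let i , e = leaf-of-ret (∈-satisfying⁻ (ret? ∘ mark) p) in i , ∈-allFin i , e)
        (λ _ _ → parent-unique (inj₂ (label-mark _))))

  abstract
    order≤ : order ≤ 4 * n
    order≤ = begin
      order                              ≡⟨ order≡ ⟩
      2 * (length rets + length leaves)  ≤⟨ ℕₚ.*-monoʳ-≤ 2 (ℕₚ.+-mono-≤ length-rets-≤ length-leaves-≤) ⟩
      2 * (n + n)                        ≡⟨ arith n ⟩
      4 * n                              ∎
      where
      open ℕₚ.≤-Reasoning
      arith : ∀ n → 2 * (n + n) ≡ 4 * n
      arith = solve-∀

-- Exchanging two edges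

T-⇔⇒≡ : ∀ {a b} → (T a → T b) → (T b → T a) → a ≡ b
T-⇔⇒≡ {true}  {true}  f g = refl
T-⇔⇒≡ {true}  {false} f g = ⊥-elim (f tt)
T-⇔⇒≡ {false} {true}  f g = ⊥-elim (g tt)
T-⇔⇒≡ {false} {false} f g = refl

transpose-injective : ∀ {m} (i j : Fin m) {x y} → transpose i j x ≡ transpose i j y → x ≡ y
transpose-injective i j eq = trans (sym (transpose-inverse j i)) (trans (cong (transpose j i) eq) (transpose-inverse j i))

transpose-left : ∀ {m} (i j : Fin m) → transpose i j i ≡ j
transpose-left i j with i ≟ᶠ i
... | yes _ = refl
... | no ¬p = contradiction refl ¬p

transpose-right : ∀ {m} {i j : Fin m} → i ≢ j → transpose i j j ≡ i
transpose-right {i = i} {j} i≢j with j ≟ᶠ i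
... | yes p = contradiction (sym p) i≢j
... | no _ with j ≟ᶠ j
...   | yes _ = refl
...   | no ¬p = contradiction refl ¬p

transpose-other : ∀ {m} {i j x : Fin m} → x ≢ i → x ≢ j → transpose i j x ≡ x
transpose-other {i = i} {j} {x} x≢i x≢j with x ≟ᶠ i
... | yes p = contradiction p x≢i
... | no _ with x ≟ᶠ j
...   | yes p = contradiction p x≢j
...   | no _  = refl

module Swap {m} (edge : Fin m → Fin m → Bool) (y α z β : Fin m) where

  Removed Added Swapped : Rel (Fin m) 0ℓ
  Removed u w = (u ≡ y × w ≡ α) ⊎ (u ≡ z × w ≡ β)
  Added   u w = (u ≡ y × w ≡ β) ⊎ (u ≡ z × w ≡ α)
  Swapped u w = (T (edge u w) × ¬ Removed u w) ⊎ Added u w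

  private
    swapped? : ∀ u w → Dec (Swapped u w)
    swapped? u w = (T? (edge u w) ×-dec ¬? (((u ≟ᶠ y) ×-dec (w ≟ᶠ α)) ⊎-dec ((u ≟ᶠ z) ×-dec (w ≟ᶠ β))))
      ⊎-dec (((u ≟ᶠ y) ×-dec (w ≟ᶠ β)) ⊎-dec ((u ≟ᶠ z) ×-dec (w ≟ᶠ α)))

  abstract
    swap : Fin m → Fin m → Bool
    swap u w = ⌊ swapped? u w ⌋

    swap⁺ : ∀ {u w} → Swapped u w → T (swap u w)
    swap⁺ {u} {w} s = fromWitness {a? = swapped? u w} s

    swap⁻ : ∀ {u w} → T (swap u w) → Swapped u w
    swap⁻ {u} {w} t = toWitness {a? = swapped? u w} t

-- The two negative fields keep an added edge from coinciding with an existing one, which would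
-- change degrees. They also force the two tails, and the two heads, to be distinct.
record Swappable {m} (edge : Fin m → Fin m → Bool) (y α z β : Fin m) : Set where
  constructor swappable
  field
    y⟶α : T (edge y α)
    z⟶β : T (edge z β)
    y↛β : ¬ T (edge y β)
    z↛α : ¬ T (edge z α)

  y≢z : y ≢ z
  y≢z refl = z↛α y⟶α

  α≢β : α ≢ β
  α≢β refl = y↛β y⟶α

module _ {m} {edge : Fin m → Fin m → Bool} {y α z β : Fin m} (s : Swappable edge y α z β) where
  open Swappable s
  open Swap edge y α z β

  swap-swappable : Swappable swap y β z α
  swap-swappable = swappable
    (swap⁺ (inj₂ (inj₁ (refl , refl))))
    (swap⁺ (inj₂ (inj₂ (refl , refl))))
    (λ t → case swap⁻ t of λ
      { (inj₁ (_ , ¬r)) → ¬r (inj₁ (refl , refl))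
      ; (inj₂ (inj₁ (_ , eq))) → α≢β eq
      ; (inj₂ (inj₂ (eq , _))) → y≢z eq })
    (λ t → case swap⁻ t of λ
      { (inj₁ (_ , ¬r)) → ¬r (inj₂ (refl , refl))
      ; (inj₂ (inj₁ (eq , _))) → y≢z (sym eq)
      ; (inj₂ (inj₂ (_ , eq))) → α≢β (sym eq) })

  abstract
    swap-involutive : ∀ u w → Swap.swap swap y β z α u w ≡ edge u w
    swap-involutive u w = T-⇔⇒≡ there′ back
      where
      there′ : T (Swap.swap swap y β z α u w) → T (edge u w)
      there′ t with Swap.swap⁻ swap y β z α t
      ... | inj₂ (inj₁ (refl , refl)) = y⟶α
      ... | inj₂ (inj₂ (refl , refl)) = z⟶β
      ... | inj₁ (t′ , ¬r) with swap⁻ t′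
      ...   | inj₁ (e , _) = e
      ...   | inj₂ r       = contradiction r ¬r
      back : T (edge u w) → T (Swap.swap swap y β z α u w)
      back t = Swap.swap⁺ swap y β z α (lemma ((u ≟ᶠ y) ×-dec (w ≟ᶠ α)) ((u ≟ᶠ z) ×-dec (w ≟ᶠ β)))
        where
        lemma : Dec (u ≡ y × w ≡ α) → Dec (u ≡ z × w ≡ β) → Swap.Swapped swap y β z α u w
        lemma (yes p) _       = inj₂ (inj₁ p)
        lemma (no _)  (yes p) = inj₂ (inj₂ p)
        lemma (no ¬p) (no ¬q) = inj₁ (swap⁺ (inj₁ (t , [ ¬p , ¬q ]′)) ,
          λ { (inj₁ (refl , refl)) → y↛β t ; (inj₂ (refl , refl)) → z↛α t })

  private
    -- At a tail of the exchange the new children are the old ones with `α` and `β` transposed; at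
    -- every other vertex nothing happens to the children. Either way this is an injection.
    move-child : ∀ u → ∃ λ (h : Fin m → Fin m) → (∀ {x x′} → h x ≡ h x′ → x ≡ x′) ×
      (∀ w → T (edge u w) → T (swap u (h w)))
    move-child u with u ≟ᶠ y | u ≟ᶠ z
    ... | no u≢y | no u≢z = id , id , λ w e → swap⁺ (inj₁ (e , [ u≢y ∘ proj₁ , u≢z ∘ proj₁ ]′))
    ... | yes refl | _ = transpose α β , transpose-injective α β , moved
      where
      moved : ∀ w → T (edge u w) → T (swap u (transpose α β w))
      moved w e = go (w ≟ᶠ α) (w ≟ᶠ β)
        where
        go : Dec (w ≡ α) → Dec (w ≡ β) → T (swap u (transpose α β w))
        go _ (yes refl) = contradiction e y↛β
        go (yes refl) (no _) = subst (T ∘ swap u) (sym (transpose-left α β)) (swap⁺ (inj₂ (inj₁ (refl , refl))))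
        go (no w≢α) (no w≢β) = subst (T ∘ swap u) (sym (transpose-other w≢α w≢β))
          (swap⁺ (inj₁ (e , [ w≢α ∘ proj₂ , w≢β ∘ proj₂ ]′)))
    ... | no _ | yes refl = transpose α β , transpose-injective α β , moved
      where
      moved : ∀ w → T (edge u w) → T (swap u (transpose α β w))
      moved w e = go (w ≟ᶠ α) (w ≟ᶠ β)
        where
        go : Dec (w ≡ α) → Dec (w ≡ β) → T (swap u (transpose α β w))
        go (yes refl) _ = contradiction e z↛α
        go (no _) (yes refl) = subst (T ∘ swap u) (sym (transpose-right α≢β)) (swap⁺ (inj₂ (inj₂ (refl , refl))))
        go (no w≢α) (no w≢β) = subst (T ∘ swap u) (sym (transpose-other w≢α w≢β))
          (swap⁺ (inj₁ (e , [ w≢α ∘ proj₂ , w≢β ∘ proj₂ ]′)))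

    move-parent : ∀ w → ∃ λ (h : Fin m → Fin m) → (∀ {x x′} → h x ≡ h x′ → x ≡ x′) ×
      (∀ u → T (edge u w) → T (swap (h u) w))
    move-parent w with w ≟ᶠ α | w ≟ᶠ β
    ... | no w≢α | no w≢β = id , id , λ u e → swap⁺ (inj₁ (e , [ w≢α ∘ proj₂ , w≢β ∘ proj₂ ]′))
    ... | yes refl | _ = transpose y z , transpose-injective y z , moved
      where
      moved : ∀ u → T (edge u w) → T (swap (transpose y z u) w)
      moved u e = go (u ≟ᶠ y) (u ≟ᶠ z)
        where
        go : Dec (u ≡ y) → Dec (u ≡ z) → T (swap (transpose y z u) w)
        go _ (yes refl) = contradiction e z↛α
        go (yes refl) (no _) = subst (λ x → T (swap x w)) (sym (transpose-left y z)) (swap⁺ (inj₂ (inj₂ (refl , refl))))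
        go (no u≢y) (no u≢z) = subst (λ x → T (swap x w)) (sym (transpose-other u≢y u≢z))
          (swap⁺ (inj₁ (e , [ u≢y ∘ proj₁ , u≢z ∘ proj₁ ]′)))
    ... | no _ | yes refl = transpose y z , transpose-injective y z , moved
      where
      moved : ∀ u → T (edge u w) → T (swap (transpose y z u) w)
      moved u e = go (u ≟ᶠ y) (u ≟ᶠ z)
        where
        go : Dec (u ≡ y) → Dec (u ≡ z) → T (swap (transpose y z u) w)
        go (yes refl) _ = contradiction e y↛β
        go (no _) (yes refl) = subst (λ x → T (swap x w)) (sym (transpose-right y≢z)) (swap⁺ (inj₂ (inj₁ (refl , refl))))
        go (no u≢y) (no u≢z) = subst (λ x → T (swap x w)) (sym (transpose-other u≢y u≢z))
          (swap⁺ (inj₁ (e , [ u≢y ∘ proj₁ , u≢z ∘ proj₁ ]′)))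

  swap-children-≤ : ∀ u → ∣ tabulate (edge u) ∣ ≤ ∣ tabulate (swap u) ∣
  swap-children-≤ u = let h , inj , moved = move-child u in ∣tabulate∣-≤ h inj moved

  swap-parents-≤ : ∀ w → ∣ tabulate (λ u → edge u w) ∣ ≤ ∣ tabulate (λ u → swap u w) ∣
  swap-parents-≤ w = let h , inj , moved = move-parent w in ∣tabulate∣-≤ h inj moved

module _ {m} {edge : Fin m → Fin m → Bool} {y α z β : Fin m} (s : Swappable edge y α z β) where
  open Swap edge y α z β using (swap)

  abstract
    -- Both inequalities come from `swap-children-≤`, once for the swap and once for the swap back,
    -- which restores `edge` by `swap-involutive`.
    swap-outdegree : ∀ u → ∣ tabulate (swap u) ∣ ≡ ∣ tabulate (edge u) ∣
    swap-outdegree u = ℕₚ.≤-antisym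
      (subst (∣ tabulate (swap u) ∣ ≤_) (cong ∣_∣ (tabulate-cong (swap-involutive s u))) (swap-children-≤ (swap-swappable s) u))
      (swap-children-≤ s u)

    swap-indegree : ∀ w → ∣ tabulate (λ u → swap u w) ∣ ≡ ∣ tabulate (λ u → edge u w) ∣
    swap-indegree w = ℕₚ.≤-antisym
      (subst (∣ tabulate (λ u → swap u w) ∣ ≤_) (cong ∣_∣ (tabulate-cong (λ u → swap-involutive s u w)))
        (swap-parents-≤ (swap-swappable s) w))
      (swap-parents-≤ s w)

module _ {n} (N : Network n) {y α z β} (s : Swappable (Network.edge N) y α z β) where
  open Net N
  open Swappable s
  open Swap edge y α z β

  module _ (y-¬ret : mark y ≢ reticulation) (z-¬ret : mark z ≢ reticulation)
           (α⇒β : NonRet (mark α) → NonRet (mark β)) (β⇒α : NonRet (mark β) → NonRet (mark α))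
           (swap-acyclic : ∀ v → ¬ TransClosure (λ u w → T (swap u w)) v v) where

    private
      tree-child′ : ∀ v → mark v ≢ leaf → ∃ λ w → T (swap v w) × NonRet (mark w)
      tree-child′ v k with tree-child v k
      ... | w , e , nr with ((v ≟ᶠ y) ×-dec (w ≟ᶠ α)) | ((v ≟ᶠ z) ×-dec (w ≟ᶠ β))
      ...   | yes (refl , refl) | _                 = β , swap⁺ (inj₂ (inj₁ (refl , refl))) , α⇒β nr
      ...   | no _              | yes (refl , refl) = α , swap⁺ (inj₂ (inj₂ (refl , refl))) , β⇒α nr
      ...   | no ¬p             | no ¬q             = w , swap⁺ (inj₁ (e , [ ¬p , ¬q ]′)) , nr

      one-component′ : ∀ v w → mark v ≡ reticulation → T (swap v w) → mark w ≡ leaf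
      one-component′ v w k t with swap⁻ t
      ... | inj₁ (e , _)           = one-component v w k e
      ... | inj₂ (inj₁ (refl , _)) = contradiction k y-¬ret
      ... | inj₂ (inj₂ (refl , _)) = contradiction k z-¬ret

    abstract
      -- Since the exchanged heads are of the same kind by `α⇒β` and `β⇒α`, a tail that loses the
      -- child required by `tree-child` gets another one. Tails that are not reticulations leave
      -- `one-component` intact.
      swap-isSimplexTreeChild : IsSimplexTreeChild swap o mark label
      swap-isSimplexTreeChild = simplexTreeChild swap-acyclic root-mark
        (λ v → trans (cong₂ _,_ (swap-indegree s v) (swap-outdegree s v)) (degrees v))
        label-injective label-image tree-child′ one-component′

  module _ (kα : mark α ≡ reticulation) (kβ : mark β ≡ reticulation) where

    private
      tree⇒¬ret : ∀ {k} → k ≡ tree → k ≢ reticulation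
      tree⇒¬ret refl ()

      tree⇒¬trapped : ∀ {k} → k ≡ tree → ¬ (k ≡ reticulation ⊎ k ≡ leaf)
      tree⇒¬trapped refl (inj₁ ())
      tree⇒¬trapped refl (inj₂ ())

      y-tree : mark y ≡ tree
      y-tree = parent-of-ret kα y⟶α

      z-tree : mark z ≡ tree
      z-tree = parent-of-ret kβ z⟶β

      inside : ∀ {u w} → mark u ≡ reticulation ⊎ mark u ≡ leaf → T (swap u w) →
        u ⟶ w × (mark w ≡ reticulation ⊎ mark w ≡ leaf)
      inside k t with swap⁻ t
      inside (inj₁ k) t | inj₁ (e , _)           = e , inj₂ (one-component _ _ k e)
      inside (inj₂ k) t | inj₁ (e , _)           = contradiction e (leaf-childless k)
      inside k        t | inj₂ (inj₁ (refl , _)) = contradiction k (tree⇒¬trapped y-tree)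
      inside k        t | inj₂ (inj₂ (refl , _)) = contradiction k (tree⇒¬trapped z-tree)

      into : ∀ {u w} → T (swap u w) → u ⟶ w ⊎ (mark w ≡ reticulation ⊎ mark w ≡ leaf)
      into t with swap⁻ t
      ... | inj₁ (e , _)              = inj₁ e
      ... | inj₂ (inj₁ (refl , refl)) = inj₂ (inj₁ kβ)
      ... | inj₂ (inj₂ (refl , refl)) = inj₂ (inj₁ kα)

    abstract
      -- Reticulations and leaves form the trap: both added edges enter it, and the tails of the
      -- exchange, being tree vertices, lie outside it.
      swapAtRets-isSimplexTreeChild : IsSimplexTreeChild swap o mark label
      swapAtRets-isSimplexTreeChild = swap-isSimplexTreeChild (tree⇒¬ret y-tree) (tree⇒¬ret z-tree)
        (⊥-elim ∘ ret⇒¬NonRet kα) (⊥-elim ∘ ret⇒¬NonRet kβ)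
        (trap⇒acyclic (λ w → mark w ≡ reticulation ⊎ mark w ≡ leaf) inside into acyclic)

    swapAtRets : Network n
    swapAtRets = record { isSimplexTreeChild = swapAtRets-isSimplexTreeChild }

  module _ (y-¬ret : mark y ≢ reticulation) (z-¬ret : mark z ≢ reticulation)
           (nr : NonRet (mark α)) (kβ : mark β ≡ leaf) (α↛z : ¬ Star _⟶_ α z) where

    private
      star⇒plus : ∀ {u w x} → u ⟶ w → Star _⟶_ w x → TransClosure _⟶_ u x
      star⇒plus e ε       = [ e ]
      star⇒plus e (f ◅ p) = e ∷ star⇒plus f p

      inside : ∀ {u w} → Star _⟶_ α u ⊎ u ≡ β → T (swap u w) → u ⟶ w × (Star _⟶_ α w ⊎ w ≡ β)
      inside a t with swap⁻ t
      inside (inj₁ p)    t | inj₁ (e , _)           = e , inj₁ (p ◅◅ e ◅ ε)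
      inside (inj₂ refl) t | inj₁ (e , _)           = contradiction e (leaf-childless kβ)
      inside (inj₁ p)    t | inj₂ (inj₁ (refl , _)) = contradiction (star⇒plus y⟶α p) (acyclic y)
      inside (inj₁ p)    t | inj₂ (inj₂ (refl , _)) = contradiction p α↛z
      inside (inj₂ refl) t | inj₂ (inj₁ (refl , _)) = contradiction y⟶α (leaf-childless kβ)
      inside (inj₂ refl) t | inj₂ (inj₂ (refl , _)) = contradiction z⟶β (leaf-childless kβ)

      into : ∀ {u w} → T (swap u w) → u ⟶ w ⊎ (Star _⟶_ α w ⊎ w ≡ β)
      into t with swap⁻ t
      ... | inj₁ (e , _)              = inj₁ e
      ... | inj₂ (inj₁ (refl , refl)) = inj₂ (inj₂ refl)
      ... | inj₂ (inj₂ (refl , refl)) = inj₂ (inj₁ ε)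

    abstract
      -- The trap consists of the descendants of `α` and the leaf `β`. Neither `y`, by acyclicity,
      -- nor `z`, by `α↛z`, is a descendant of `α`, so the edges that start inside the trap are
      -- unchanged.
      swapAtLeaf-isSimplexTreeChild : IsSimplexTreeChild swap o mark label
      swapAtLeaf-isSimplexTreeChild = swap-isSimplexTreeChild y-¬ret z-¬ret (λ _ → inj₂ kβ) (λ _ → nr)
        (trap⇒acyclic (λ w → Star _⟶_ α w ⊎ w ≡ β) inside into acyclic)

module _ {m k} (b : Fin m ↔ Fin k) where
  open Inverse b using (to; from; strictlyInverseʳ)

  swap-equivariant : ∀ {E : Fin m → Fin m → Bool} {F : Fin k → Fin k → Bool} {y α z β y′ α′ z′ β′} →
    (∀ u w → F (to u) (to w) ≡ E u w) →
    to y ≡ y′ → to α ≡ α′ → to z ≡ z′ → to β ≡ β′ →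
    ∀ u w → Swap.swap F y′ α′ z′ β′ (to u) (to w) ≡ Swap.swap E y α z β u w
  swap-equivariant {E} {F} {y} {α} {z} {β} edges refl refl refl refl u w = T-⇔⇒≡
    (λ t → E.swap⁺ (case F.swap⁻ t of λ
      { (inj₁ (e , ¬r))         → inj₁ (subst T (edges u w) e ,
          λ { (inj₁ (refl , refl)) → ¬r (inj₁ (refl , refl)) ; (inj₂ (refl , refl)) → ¬r (inj₂ (refl , refl)) })
      ; (inj₂ (inj₁ (p , q))) → inj₂ (inj₁ (inj p , inj q))
      ; (inj₂ (inj₂ (p , q))) → inj₂ (inj₂ (inj p , inj q)) }))
    (λ t → F.swap⁺ (case E.swap⁻ t of λ
      { (inj₁ (e , ¬r))         → inj₁ (subst T (sym (edges u w)) e ,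
          λ { (inj₁ (p , q)) → ¬r (inj₁ (inj p , inj q)) ; (inj₂ (p , q)) → ¬r (inj₂ (inj p , inj q)) })
      ; (inj₂ (inj₁ (refl , refl))) → inj₂ (inj₁ (refl , refl))
      ; (inj₂ (inj₂ (refl , refl))) → inj₂ (inj₂ (refl , refl)) }))
    where
    module E = Swap E y α z β
    module F = Swap F (to y) (to α) (to z) (to β)
    inj : ∀ {x x′} → to x ≡ to x′ → x ≡ x′
    inj eq = trans (sym (strictlyInverseʳ _)) (trans (cong from eq) (strictlyInverseʳ _))

  -- The swap is undone on both sides at once, because the swap back is equivariant too. Both
  -- switchings are decoded with this.
  swap-reflects : ∀ {E : Fin m → Fin m → Bool} {F : Fin k → Fin k → Bool} {y α z β y′ α′ z′ β′} →
    Swappable E y α z β → Swappable F y′ α′ z′ β′ →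
    (∀ u w → Swap.swap F y′ α′ z′ β′ (to u) (to w) ≡ Swap.swap E y α z β u w) →
    to y ≡ y′ → to α ≡ α′ → to z ≡ z′ → to β ≡ β′ →
    ∀ u w → F (to u) (to w) ≡ E u w
  swap-reflects s t edges py pα pz pβ u w =
    trans (sym (swap-involutive t (to u) (to w)))
      (trans (swap-equivariant edges py pβ pz pα u w) (swap-involutive s u w))

-- Turning a tree leaf into the leaf of a reticulation

pattern top   = zero
pattern new   = suc zero
pattern old u = suc (suc u)

old-injective : ∀ {m} {u w : Fin m} → _≡_ {A = Fin (2 + m)} (old u) (old w) → u ≡ w
old-injective refl = refl

promote : Mark → Mark
promote root         = tree
promote tree         = tree
promote reticulation = reticulation
promote leaf         = leaf

module _ {n} (N : Network n) where
  open Net N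

  -- The child `c` is there to satisfy `tree-child` at `v` once a reticulation has taken the place
  -- of `a`.
  record Insertable (a : Fin order) : Set where
    field
      a-leaf    : mark a ≡ leaf
      v c       : Fin order
      v-tree    : mark v ≡ tree
      v⟶a       : v ⟶ a
      v⟶c       : v ⟶ c
      c-nonRet  : NonRet (mark c)
      a≢c       : a ≢ c

    v≢o : v ≢ o
    v≢o eq = case trans (sym v-tree) (trans (cong mark eq) o-mark) of λ ()

    only-parent : ∀ {u w} → u ⟶ w → u ≢ v → w ≢ a
    only-parent e u≢v refl = u≢v (parent-unique (inj₂ a-leaf) e v⟶a)

  module _ {a} (ins : Insertable a) where
    open Insertable ins

    -- a becomes the child of a new reticulation whose parents are v and the
    -- old root, which itself turns into a tree vertex below a new root.
    data Inserted : Rel (Fin (2 + order)) 0ℓ where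
      top-o : ∀ {w} → w ≡ o → Inserted top (old w)
      o-new : ∀ {u} → u ≡ o → Inserted (old u) new
      v-new : ∀ {u} → u ≡ v → Inserted (old u) new
      new-a : ∀ {w} → w ≡ a → Inserted new (old w)
      kept  : ∀ {u w} → u ⟶ w → w ≢ a → Inserted (old u) (old w)

    private
      inserted? : ∀ u w → Dec (Inserted u w)
      inserted? top     top     = no λ ()
      inserted? top     new     = no λ ()
      inserted? top     (old w) = map′ top-o (λ { (top-o eq) → eq }) (w ≟ᶠ o)
      inserted? new     top     = no λ ()
      inserted? new     new     = no λ ()
      inserted? new     (old w) = map′ new-a (λ { (new-a eq) → eq }) (w ≟ᶠ a)
      inserted? (old u) top     = no λ ()
      inserted? (old u) new     = map′ [ o-new , v-new ]′ (λ { (o-new eq) → inj₁ eq ; (v-new eq) → inj₂ eq }) ((u ≟ᶠ o) ⊎-dec (u ≟ᶠ v))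
      inserted? (old u) (old w) = map′ (uncurry kept) (λ { (kept e w≢a) → e , w≢a })
        (T? (edge u w) ×-dec ¬? (w ≟ᶠ a))

    abstract
      insert : Fin (2 + order) → Fin (2 + order) → Bool
      insert u w = ⌊ inserted? u w ⌋

      insert⁺ : ∀ {u w} → Inserted u w → T (insert u w)
      insert⁺ {u} {w} = fromWitness {a? = inserted? u w}

      insert⁻ : ∀ {u w} → T (insert u w) → Inserted u w
      insert⁻ {u} {w} = toWitness {a? = inserted? u w}

    insert-mark : Fin (2 + order) → Mark
    insert-mark top     = root
    insert-mark new     = reticulation
    insert-mark (old u) = promote (mark u)

    private
      -- A path that enters `new` stops there or at the childless `a`, and `top` can only be a first
      -- vertex. All other paths live in `N`.
      acyclic⁻ : ∀ {x y} → TransClosure Inserted x y →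
        x ≡ top ⊎ (y ≡ new ⊎ y ≡ old a) ⊎ ∃₂ λ u w → x ≡ old u × y ≡ old w × TransClosure _⟶_ u w
      acyclic⁻ [ (top-o refl) ]    = inj₁ refl
      acyclic⁻ [ (o-new refl) ]    = inj₂ (inj₁ (inj₁ refl))
      acyclic⁻ [ (v-new refl) ]    = inj₂ (inj₁ (inj₁ refl))
      acyclic⁻ [ (new-a refl) ]    = inj₂ (inj₁ (inj₂ refl))
      acyclic⁻ [ kept e _ ] = inj₂ (inj₂ (_ , _ , refl , refl , [ e ]))
      acyclic⁻ ((top-o refl) ∷ p)  = inj₁ refl
      acyclic⁻ (e ∷ p) with acyclic⁻ p
      acyclic⁻ (() ∷ p)       | inj₁ refl
      acyclic⁻ (top-o _ ∷ p)  | inj₂ (inj₂ _) = inj₁ refl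
      acyclic⁻ (e ∷ p)        | inj₂ (inj₁ z) = inj₂ (inj₁ z)
      acyclic⁻ (kept e _ ∷ p) | inj₂ (inj₂ (u , w , refl , refl , q)) = inj₂ (inj₂ (_ , _ , refl , refl , e ∷ q))
      acyclic⁻ ((new-a refl) ∷ p)    | inj₂ (inj₂ (u , w , refl , refl , [ e ]))   = contradiction e (leaf-childless a-leaf)
      acyclic⁻ ((new-a refl) ∷ p)    | inj₂ (inj₂ (u , w , refl , refl , e ∷ _))   = contradiction e (leaf-childless a-leaf)

      a-childless : ∀ {x} → ¬ Inserted (old a) x
      a-childless (o-new refl)      = case trans (sym a-leaf) o-mark of λ ()
      a-childless (v-new refl)      = leaf-childless a-leaf v⟶a
      a-childless (kept e _) = leaf-childless a-leaf e

      inserted-acyclic : ∀ x → ¬ TransClosure Inserted x x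
      inserted-acyclic x p with acyclic⁻ p
      inserted-acyclic x p | inj₁ refl = case last p of λ ()
        where
        last : ∀ {x y} → TransClosure Inserted x y → ∃ λ z → Inserted z y
        last [ e ]   = _ , e
        last (_ ∷ p) = last p
      inserted-acyclic x [ () ]              | inj₂ (inj₁ (inj₁ refl))
      inserted-acyclic x ((new-a refl) ∷ [ e ])     | inj₂ (inj₁ (inj₁ refl)) = a-childless e
      inserted-acyclic x ((new-a refl) ∷ (e ∷ _))   | inj₂ (inj₁ (inj₁ refl)) = a-childless e
      inserted-acyclic x [ e ]               | inj₂ (inj₁ (inj₂ refl)) = a-childless e
      inserted-acyclic x (e ∷ _)             | inj₂ (inj₁ (inj₂ refl)) = a-childless e
      inserted-acyclic x p | inj₂ (inj₂ (u , _ , refl , refl , q)) = acyclic u q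

      insert-acyclic : ∀ x → ¬ TransClosure (λ u w → T (insert u w)) x x
      insert-acyclic x p = inserted-acyclic x (inserted⁺ p)
        where
        inserted⁺ : ∀ {x y} → TransClosure (λ u w → T (insert u w)) x y → TransClosure Inserted x y
        inserted⁺ [ t ]   = [ insert⁻ t ]
        inserted⁺ (t ∷ p) = insert⁻ t ∷ inserted⁺ p

      parents-≡ : ∀ x {xs} → Unique xs → (∀ {u} → Inserted u x → u ∈ xs) → (∀ {u} → u ∈ xs → Inserted u x) →
        ∣ tabulate (λ u → insert u x) ∣ ≡ length xs
      parents-≡ x uniq sub sup = ∣tabulate∣≡length (λ u → insert u x) uniq (λ u t → sub (insert⁻ t)) (insert⁺ ∘ sup)

      children-≡ : ∀ x {xs} → Unique xs → (∀ {u} → Inserted x u → u ∈ xs) → (∀ {u} → u ∈ xs → Inserted x u) →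
        ∣ tabulate (insert x) ∣ ≡ length xs
      children-≡ x uniq sub sup = ∣tabulate∣≡length (insert x) uniq (λ u t → sub (insert⁻ t)) (insert⁺ ∘ sup)

      indegree-old : ∀ w → ∣ tabulate (λ u → insert u (old w)) ∣ ≡ proj₁ (degree (promote (mark w)))
      indegree-old w = go (w ≟ᶠ o) (w ≟ᶠ a)
        where
        go : Dec (w ≡ o) → Dec (w ≡ a) → ∣ tabulate (λ u → insert u (old w)) ∣ ≡ proj₁ (degree (promote (mark w)))
        go (yes refl) _ = trans
          (parents-≡ (old w) {top ∷ []} ([] ∷ [])
            (λ { (top-o refl) → here refl
               ; (new-a refl) → case trans (sym a-leaf) o-mark of λ ()
               ; (kept e _) → contradiction e (root-parentless o-mark) })
            (λ { (here refl) → (top-o refl) }))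
          (cong (proj₁ ∘ degree ∘ promote) (sym o-mark))
        go (no w≢o) (yes refl) = trans
          (parents-≡ (old w) {new ∷ []} ([] ∷ [])
            (λ { (top-o refl) → contradiction refl w≢o
               ; (new-a refl) → here refl
               ; (kept _ w≢a) → contradiction refl w≢a })
            (λ { (here refl) → (new-a refl) }))
          (cong (proj₁ ∘ degree ∘ promote) (sym a-leaf))
        go (no w≢o) (no w≢a) = trans
          (parents-≡ (old w) {map (λ u → old u) (trues (λ u → edge u w))}
            (Uniqueₚ.map⁺ old-injective (trues-unique _))
            (λ { (top-o refl) → contradiction refl w≢o
               ; (new-a refl) → contradiction refl w≢a
               ; (kept e _) → ∈-map⁺ _ (∈-trues⁺ (λ u → edge u w) e) })
            (λ p → case ∈-map⁻ _ p of λ { (u , q , refl) → kept (∈-trues⁻ (λ u → edge u w) q) w≢a }))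
          (trans (length-map _ (trues (λ u → edge u w)))
            (trans (length-trues (λ u → edge u w)) (trans (indegree≡ refl) (unpromoted (mark w) (w≢o ∘ root⇒o)))))
          where
          unpromoted : ∀ k → k ≢ root → proj₁ (degree k) ≡ proj₁ (degree (promote k))
          unpromoted root         k≢ = contradiction refl k≢
          unpromoted tree         k≢ = refl
          unpromoted reticulation k≢ = refl
          unpromoted leaf         k≢ = refl

      outdegree-old : ∀ u → ∣ tabulate (insert (old u)) ∣ ≡ proj₂ (degree (promote (mark u)))
      outdegree-old u = go (u ≟ᶠ o) (u ≟ᶠ v)
        where
        go : Dec (u ≡ o) → Dec (u ≡ v) → ∣ tabulate (insert (old u)) ∣ ≡ proj₂ (degree (promote (mark u)))
        go (yes refl) _ with child (inj₁ o-mark)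
        ... | t , e , unique = trans
          (children-≡ (old u) {new ∷ old t ∷ []} (((λ ()) ∷ []) ∷ [] ∷ [])
            (λ { (o-new refl) → here refl
               ; (v-new refl) → here refl
               ; (kept e _) → there (here (cong (λ w → old w) (unique _ e))) })
            (λ { (here refl) → (o-new refl) ; (there (here refl)) → kept e (only-parent e (v≢o ∘ sym)) }))
          (cong (proj₂ ∘ degree ∘ promote) (sym o-mark))
        go (no u≢o) (yes refl) = trans
          (children-≡ (old u) {new ∷ old c ∷ []} (((λ ()) ∷ []) ∷ [] ∷ [])
            (λ { (o-new refl) → contradiction refl u≢o
               ; (v-new refl) → here refl
               ; (kept e w≢a) → case three-children v-tree a≢c v⟶a v⟶c e of λ
                   { (inj₁ refl) → contradiction refl w≢a
                   ; (inj₂ refl) → there (here refl) } })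
            (λ { (here refl) → (v-new refl) ; (there (here refl)) → kept v⟶c (a≢c ∘ sym) }))
          (cong (proj₂ ∘ degree ∘ promote) (sym v-tree))
        go (no u≢o) (no u≢v) = trans
          (children-≡ (old u) {map (λ w → old w) (trues (edge u))}
            (Uniqueₚ.map⁺ old-injective (trues-unique _))
            (λ { (o-new refl) → contradiction refl u≢o
               ; (v-new refl) → contradiction refl u≢v
               ; (kept e _) → ∈-map⁺ _ (∈-trues⁺ (edge u) e) })
            (λ p → case ∈-map⁻ _ p of λ { (w , q , refl) →
              let e = ∈-trues⁻ (edge u) q in kept e (only-parent e u≢v) }))
          (trans (length-map _ (trues (edge u)))
            (trans (length-trues (edge u)) (trans (outdegree≡ refl) (unpromoted (mark u) (u≢o ∘ root⇒o)))))
          where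
          unpromoted : ∀ k → k ≢ root → proj₂ (degree k) ≡ proj₂ (degree (promote k))
          unpromoted root         k≢ = contradiction refl k≢
          unpromoted tree         k≢ = refl
          unpromoted reticulation k≢ = refl
          unpromoted leaf         k≢ = refl

      insert-degrees : ∀ x → (∣ tabulate (λ u → insert u x) ∣ , ∣ tabulate (insert x) ∣) ≡ degree (insert-mark x)
      insert-degrees top = cong₂ _,_
        (parents-≡ top {[]} [] (λ ()) (λ ()))
        (children-≡ top {old o ∷ []} ([] ∷ []) (λ { (top-o refl) → here refl }) (λ { (here refl) → (top-o refl) }))
      insert-degrees new = cong₂ _,_
        (parents-≡ new {old o ∷ old v ∷ []} (((λ { refl → v≢o refl }) ∷ []) ∷ [] ∷ [])
          (λ { (o-new refl) → here refl ; (v-new refl) → there (here refl) })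
          (λ { (here refl) → (o-new refl) ; (there (here refl)) → (v-new refl) }))
        (children-≡ new {old a ∷ []} ([] ∷ []) (λ { (new-a refl) → here refl }) (λ { (here refl) → (new-a refl) }))
      insert-degrees (old w) = cong₂ _,_ (indegree-old w) (outdegree-old w)

      promote-leaf : ∀ {k} → promote k ≡ leaf → k ≡ leaf
      promote-leaf {leaf} refl = refl

      promote-ret : ∀ {k} → promote k ≡ reticulation → k ≡ reticulation
      promote-ret {reticulation} refl = refl

      promote-root : ∀ {k} → promote k ≢ root
      promote-root {root}         ()
      promote-root {tree}         ()
      promote-root {reticulation} ()
      promote-root {leaf}         ()

      promote-nonRet : ∀ {k} → NonRet k → NonRet (promote k)
      promote-nonRet (inj₁ refl) = inj₁ refl
      promote-nonRet (inj₂ refl) = inj₂ refl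

      insert-tree-child : ∀ x → insert-mark x ≢ leaf → ∃ λ w → T (insert x w) × NonRet (insert-mark w)
      insert-tree-child top     _ = old o , insert⁺ (top-o refl) , inj₁ (cong promote o-mark)
      insert-tree-child new     _ = old a , insert⁺ (new-a refl) , inj₂ (cong promote a-leaf)
      insert-tree-child (old u) k with tree-child u (k ∘ cong promote)
      ... | w , e , nr with u ≟ᶠ v
      ...   | yes refl = old c , insert⁺ (kept v⟶c (a≢c ∘ sym)) , promote-nonRet c-nonRet
      ...   | no u≢v   = old w , insert⁺ (kept e (only-parent e u≢v)) , promote-nonRet nr

      insert-one-component : ∀ x w → insert-mark x ≡ reticulation → Inserted x w → insert-mark w ≡ leaf
      insert-one-component x w k (o-new refl) = case trans (sym (cong promote o-mark)) k of λ ()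
      insert-one-component x w k (v-new refl) = case trans (sym (cong promote v-tree)) k of λ ()
      insert-one-component x w k (new-a refl) = cong promote a-leaf
      insert-one-component x w k (kept e _) = cong promote (one-component _ _ (promote-ret k) e)

    abstract
      insert-isSimplexTreeChild : IsSimplexTreeChild insert top insert-mark (λ i → old (label i))
      insert-isSimplexTreeChild = simplexTreeChild insert-acyclic
        (λ { top     → mk⇔ (λ _ → refl) (λ _ → refl)
           ; new     → mk⇔ (λ ()) (λ ())
           ; (old w) → mk⇔ (λ k → contradiction k promote-root) (λ ()) })
        insert-degrees
        (λ i j eq → label-injective i j (old-injective eq))
        (λ { top     → mk⇔ (λ ()) (λ ())
           ; new     → mk⇔ (λ ()) (λ ())
           ; (old w) → mk⇔
               (λ k → let i , eq = Equivalence.to (label-image w) (promote-leaf k) in i , cong (λ u → old u) eq)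
               (λ (i , eq) → cong promote (Equivalence.from (label-image w) (i , old-injective eq))) })
        insert-tree-child
        (λ x w k t → insert-one-component x w k (insert⁻ t))

    insertNetwork : Network n
    insertNetwork = record { isSimplexTreeChild = insert-isSimplexTreeChild }

module _ {n} {M N : Network n} {a b} (ia : Insertable M a) (ib : Insertable N b)
         (e : insertNetwork M ia ≃ insertNetwork N ib) where
  private
    module M = Net M
    module N = Net N
    module IN = Net (insertNetwork N ib)
    module a = Insertable ia
    module b = Insertable ib
  open Iso e using (to; edge⁺)

  private
    edge⁺′ : ∀ {x y} → Inserted M ia x y → Inserted N ib (to x) (to y)
    edge⁺′ i = insert⁻ N ib (edge⁺ (insert⁺ M ia i))

  abstract
    to-top : to top ≡ top
    to-top = IN.root⇒o (mark-preserved e top)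

    to-o : to (old M.o) ≡ old N.o
    to-o with to top | to-top | edge⁺′ (top-o refl)
    ... | _ | refl | i with to (old M.o) | i
    ...   | _ | (top-o refl) = refl

    to-new : to new ≡ new
    to-new with to (old M.o) | to-o | edge⁺′ (o-new refl) | ret-preserved e {new} refl
    ... | _ | refl | i | k with to new | i
    ...   | _ | (o-new refl) = refl
    ...   | _ | (v-new refl) = refl
    -- A kept edge out of the old root leads to its only child, which by `tree-child` is not a
    -- reticulation, whereas the image of `new` is one.
    ...   | _ | kept e′ _ with N.tree-child N.o (λ k′ → case trans (sym N.o-mark) k′ of λ ())
    ...     | w , e″ , nr with N.child-unique (inj₁ N.o-mark) e′ e″
    ...       | refl = contradiction nr (ret⇒¬NonRet (unpromote k))
      where
      unpromote : ∀ {k} → promote k ≡ reticulation → k ≡ reticulation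
      unpromote {reticulation} refl = refl

    to-a : to (old a) ≡ old b
    to-a with to new | to-new | edge⁺′ (new-a refl)
    ... | _ | refl | i with to (old a) | i
    ...   | _ | (new-a refl) = refl

module _ {n} {M N : Network n} {a b} (ia : Insertable M a) (ib : Insertable N b)
         (e : insertNetwork M ia ≃ insertNetwork N ib) where
  private
    module M = Net M
    module N = Net N
    module a = Insertable ia
    module b = Insertable ib
  open Iso e using (to; from; edge⁺; edge⁻; to-injective; label-preserved; strictlyInverseˡ; strictlyInverseʳ)

  private
    edge⁺′ : ∀ {x y} → Inserted M ia x y → Inserted N ib (to x) (to y)
    edge⁺′ i = insert⁻ N ib (edge⁺ (insert⁺ M ia i))

    edge⁻′ : ∀ {x y} → Inserted N ib (to x) (to y) → Inserted M ia x y
    edge⁻′ i = insert⁻ M ia (edge⁻ (insert⁺ N ib i))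

    is-old : ∀ {m} (x : Fin (2 + m)) → x ≢ top → x ≢ new → ∃ λ u → x ≡ old u
    is-old top     p _ = contradiction refl p
    is-old new     _ p = contradiction refl p
    is-old (old u) _ _ = u , refl

    there′ : ∀ u → ∃ λ w → to (old u) ≡ old w
    there′ u = is-old (to (old u))
      (λ eq → case to-injective (trans eq (sym (to-top ia ib e))) of λ ())
      (λ eq → case to-injective (trans eq (sym (to-new ia ib e))) of λ ())

    back : ∀ w → ∃ λ u → from (old w) ≡ old u
    back w = is-old (from (old w))
      (λ eq → case trans (sym (strictlyInverseˡ (old w))) (trans (cong to eq) (to-top ia ib e)) of λ ())
      (λ eq → case trans (sym (strictlyInverseˡ (old w))) (trans (cong to eq) (to-new ia ib e)) of λ ())

    f : Fin M.order → Fin N.order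
    f u = proj₁ (there′ u)

    f-old : ∀ u → to (old u) ≡ old (f u)
    f-old u = proj₂ (there′ u)

    f-a : f a ≡ b
    f-a = old-injective (trans (sym (f-old a)) (to-a ia ib e))

    f-injective : ∀ {u w} → f u ≡ f w → u ≡ w
    f-injective eq = old-injective (to-injective (trans (f-old _) (trans (cong (λ x → old x) eq) (sym (f-old _)))))

    f-v : f a.v ≡ b.v
    f-v with subst₂ (Inserted N ib) (f-old a.v) (to-new ia ib e) (edge⁺′ (v-new refl))
    ... | v-new eq = eq
    ... | o-new eq = contradiction (f-injective (trans eq (sym f-o))) a.v≢o
      where
      f-o : f M.o ≡ N.o
      f-o = old-injective (trans (sym (f-old M.o)) (to-o ia ib e))

    f-edge : ∀ u w → N.edge (f u) (f w) ≡ M.edge u w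
    f-edge u w = T-⇔⇒≡ bwd′ fwd′
      where
      fwd′ : u M.⟶ w → f u N.⟶ f w
      fwd′ h with w ≟ᶠ a
      ... | yes refl with M.parent-unique (inj₂ a.a-leaf) h a.v⟶a
      ...   | refl = subst₂ N._⟶_ (sym f-v) (sym f-a) b.v⟶a
      fwd′ h | no w≢a with subst₂ (Inserted N ib) (f-old u) (f-old w) (edge⁺′ (kept h w≢a))
      ...   | kept h′ _ = h′
      bwd′ : f u N.⟶ f w → u M.⟶ w
      bwd′ h with f w ≟ᶠ b
      ... | yes eq with N.parent-unique (inj₂ b.a-leaf) (subst (f u N.⟶_) eq h) b.v⟶a
      ...   | eq′ = subst₂ M._⟶_ (f-injective (trans f-v (sym eq′))) (f-injective (trans f-a (sym eq))) a.v⟶a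
      bwd′ h | no ≢b with edge⁻′ (subst₂ (Inserted N ib) (sym (f-old u)) (sym (f-old w)) (kept h ≢b))
      ...   | kept h′ _ = h′

  -- The insertion is decoded from the root downwards: `top` is the root, the old root is its child,
  -- `new` is the reticulation below that, `a` is the child of `new` and `v` its other parent. Then
  -- the edge from `v` to `a` can be restored and the isomorphism restricted to the old vertices.
  insert-reflects : ∃ λ (g : M ≃ N) → _≃_.to g a ≡ b × _≃_.to g a.v ≡ b.v ×
    (∀ u → to (old u) ≡ old (_≃_.to g u))
  insert-reflects = record
    { bijection = mk↔ₛ′ f (λ w → proj₁ (back w))
        (λ w → old-injective (trans (sym (f-old _)) (trans (cong to (sym (proj₂ (back w)))) (strictlyInverseˡ (old w)))))
        (λ u → old-injective (trans (sym (proj₂ (back (f u)))) (trans (cong from (sym (f-old u))) (strictlyInverseʳ (old u)))))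
    ; edge-preserved  = f-edge
    ; label-preserved = λ i → old-injective (trans (sym (f-old (M.label i))) (label-preserved i))
    } , f-a , f-v , f-old

-- Short cycles

module _ {m : ℕ} (edge : Fin m → Fin m → Bool) where

  Adjacent : Rel (Fin m) 0ℓ
  Adjacent u w = T (edge u w) ⊎ T (edge w u)

  -- A counterpart of `Within` over a Boolean edge relation; it is decidable and applies equally to
  -- a graph from which a vertex has been removed by `avoiding`.
  data Near (x : Fin m) : ℕ → Fin m → Set where
    here : ∀ {r} → Near x r x
    step : ∀ {r u w} → Near x r u → Adjacent u w → Near x (suc r) w

  neighbours : Fin m → List (Fin m)
  neighbours v = trues (edge v) ++ trues (λ u → edge u v)

  ball : ℕ → Fin m → List (Fin m)
  ball zero    x = x ∷ []
  ball (suc r) x = x ∷ concatMap neighbours (ball r x)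

module _ {m : ℕ} {edge : Fin m → Fin m → Bool} where

  adjacent-sym : ∀ {u w} → Adjacent edge u w → Adjacent edge w u
  adjacent-sym = Sum.swap

  near-suc : ∀ {x r y} → Near edge x r y → Near edge x (suc r) y
  near-suc here         = here
  near-suc (step p adj) = step (near-suc p) adj

  near-mono : ∀ {x r s y} → r ≤ s → Near edge x r y → Near edge x s y
  near-mono _         here         = here
  near-mono (s≤s r≤s) (step p adj) = step (near-mono r≤s p) adj

  near-trans : ∀ {x r y s z} → Near edge x r y → Near edge y s z → Near edge x (r + s) z
  near-trans {r = r} {s = s} p here         = near-mono (ℕₚ.m≤m+n r s) p
  near-trans {x} {r} {z = z} p (step q adj) = subst (λ k → Near edge x k z) (sym (ℕₚ.+-suc r _)) (step (near-trans p q) adj)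

  near-step : ∀ {x y} → Adjacent edge x y → Near edge x 1 y
  near-step = step here

  near-sym : ∀ {x r y} → Near edge x r y → Near edge y r x
  near-sym here         = here
  near-sym (step p adj) = near-trans (near-step (adjacent-sym adj)) (near-sym p)

  ∈-ball⁺ : ∀ {x r y} → Near edge x r y → y ∈ ball edge r x
  ∈-ball⁺ {r = zero}  here = here refl
  ∈-ball⁺ {r = suc _} here = here refl
  ∈-ball⁺ (step {u = u} p adj) = there (∈-concatMap⁺ (neighbours edge) (lose (∈-ball⁺ p)
    ([ (λ e → ∈-++⁺ˡ (∈-trues⁺ (edge u) e)) , (λ e → ∈-++⁺ʳ (trues (edge u)) (∈-trues⁺ (λ u′ → edge u′ u) e)) ]′ adj)))

  ∈-ball⁻ : ∀ {x} r {y} → y ∈ ball edge r x → Near edge x r y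
  ∈-ball⁻ zero    (here refl) = here
  ∈-ball⁻ (suc r) (here refl) = here
  ∈-ball⁻ {x} (suc r) (there p) with find (∈-concatMap⁻ (neighbours edge) {xs = ball edge r x} p)
  ... | u , u∈ , q = step (∈-ball⁻ r u∈)
    (Sum.map (∈-trues⁻ (edge u)) (∈-trues⁻ (λ u′ → edge u′ u)) (∈-++⁻ (trues (edge u)) q))

  near? : ∀ x r y → Dec (Near edge x r y)
  near? x r y = map′ (∈-ball⁻ r) ∈-ball⁺ (DecMembership._∈?_ _≟ᶠ_ y (ball edge r x))

length-concatMap-≤ : ∀ {A B : Set} (f : A → List B) xs k → (∀ {x} → x ∈ xs → length (f x) ≤ k) →
  length (concatMap f xs) ≤ length xs * k
length-concatMap-≤ f []       k h = z≤n
length-concatMap-≤ f (x ∷ xs) k h = begin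
  length (f x ++ concatMap f xs)         ≡⟨ length-++ (f x) ⟩
  length (f x) + length (concatMap f xs) ≤⟨ ℕₚ.+-mono-≤ (h (here refl)) (length-concatMap-≤ f xs k (h ∘ there)) ⟩
  k + length xs * k                      ∎
  where open ℕₚ.≤-Reasoning

module Balls {n} (N : Network n) where
  open Net N

  abstract
    length-neighbours-≤ : ∀ v → length (neighbours edge v) ≤ 3
    length-neighbours-≤ v = begin
      length (trues (edge v) ++ trues (λ u → edge u v))          ≡⟨ length-++ (trues (edge v)) ⟩
      length (trues (edge v)) + length (trues (λ u → edge u v))  ≡⟨ cong₂ _+_ (length-trues (edge v)) (length-trues (λ u → edge u v)) ⟩
      outdegree v + indegree v                                   ≡⟨ cong₂ _+_ (outdegree≡ refl) (indegree≡ refl) ⟩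
      proj₂ (degree (mark v)) + proj₁ (degree (mark v))          ≤⟨ bound (mark v) ⟩
      3                                                          ∎
      where
      open ℕₚ.≤-Reasoning
      bound : ∀ k → proj₂ (degree k) + proj₁ (degree k) ≤ 3
      bound root         = s≤s z≤n
      bound tree         = s≤s (s≤s (s≤s z≤n))
      bound reticulation = s≤s (s≤s (s≤s z≤n))
      bound leaf         = s≤s z≤n

    -- Degrees are at most 3, and `1 + 3 * 4 ^ r` is at most `4 ^ (1 + r)`.
    length-ball-≤ : ∀ r x → length (ball edge r x) ≤ 4 ^ r
    length-ball-≤ zero    x = s≤s z≤n
    length-ball-≤ (suc r) x = begin
      suc (length (concatMap (neighbours edge) (ball edge r x)))
        ≤⟨ s≤s (length-concatMap-≤ (neighbours edge) (ball edge r x) 3 (λ {v} _ → length-neighbours-≤ v)) ⟩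
      suc (length (ball edge r x) * 3) ≤⟨ s≤s (ℕₚ.*-monoˡ-≤ 3 (length-ball-≤ r x)) ⟩
      suc (4 ^ r * 3)                  ≤⟨ ℕₚ.+-monoˡ-≤ (4 ^ r * 3) (ℕₚ.m^n>0 4 r) ⟩
      4 ^ r + 4 ^ r * 3                ≡⟨ arith (4 ^ r) ⟩
      4 * 4 ^ r                        ∎
      where
      open ℕₚ.≤-Reasoning
      arith : ∀ x → x + x * 3 ≡ 4 * x
      arith = solve-∀

-- The vertex `ϱ` is deleted by isolating it, so that the vertex type stays the same.
avoiding : ∀ {m} → (Fin m → Fin m → Bool) → Fin m → Fin m → Fin m → Bool
avoiding edge ϱ u w = edge u w ∧ not ⌊ u ≟ᶠ ϱ ⌋ ∧ not ⌊ w ≟ᶠ ϱ ⌋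

avoiding⁻ : ∀ {m} (edge : Fin m → Fin m → Bool) (ϱ : Fin m) {u w} →
  T (avoiding edge ϱ u w) → T (edge u w) × u ≢ ϱ × w ≢ ϱ
avoiding⁻ edge ϱ {u} {w} t with edge u w | u ≟ᶠ ϱ | w ≟ᶠ ϱ
... | true | no u≢ϱ | no w≢ϱ = tt , u≢ϱ , w≢ϱ

avoiding⁺ : ∀ {m} (edge : Fin m → Fin m → Bool) (ϱ : Fin m) {u w} →
  T (edge u w) → u ≢ ϱ → w ≢ ϱ → T (avoiding edge ϱ u w)
avoiding⁺ edge ϱ {u} {w} t u≢ϱ w≢ϱ with edge u w | u ≟ᶠ ϱ | w ≟ᶠ ϱ
... | true | yes p | _     = contradiction p u≢ϱ
... | true | no _  | yes p = contradiction p w≢ϱ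
... | true | no _  | no _  = tt

module ShortCycles {n} (N : Network n) (L : ℕ) where
  open Net N

  -- ϱ lies on an undirected cycle of length at most L + 2.
  ShortCycle : Pred (Fin order) 0ℓ
  ShortCycle ϱ = mark ϱ ≡ reticulation ×
    ∃₂ λ x y → x ⟶ ϱ × y ⟶ ϱ × x ≢ y × Near (avoiding edge ϱ) x L y

  shortCycle? : Decidable ShortCycle
  shortCycle? ϱ = ret? (mark ϱ) ×-dec any? λ x → any? λ y →
    T? (edge x ϱ) ×-dec T? (edge y ϱ) ×-dec ¬? (x ≟ᶠ y) ×-dec near? x L y

  onShortCycle : List (Fin order)
  onShortCycle = satisfying shortCycle?

  rets : List (Fin order)
  rets = satisfying (ret? ∘ mark)

  farRets : Fin order → List (Fin order)
  farRets ϱ = filter (λ β → ¬? (near? {edge = edge} ϱ (2 + L) β)) rets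

  open Kinds N using (HasRetParent; hasRetParent?; treeLeaves; treeLeaf?)
  open Balls N

  private
    -- A leaf that is not a tree leaf hangs below a reticulation, and different leaves hang below
    -- different ones. This is how few tree leaves provide many candidates for `β`.
    n≤ : n ≤ length treeLeaves + length rets
    n≤ = begin
      n                                                  ≡⟨ length-tabulate {n = n} id ⟨
      length (allFin n)                                  ≡⟨ length-filter-¬ P? (allFin n) ⟨
      length (filter P? (allFin n)) + length (filter (¬? ∘ P?) (allFin n))
        ≤⟨ ℕₚ.+-mono-≤ below others ⟩
      length rets + length treeLeaves                    ≡⟨ ℕₚ.+-comm (length rets) _ ⟩
      length treeLeaves + length rets                    ∎
      where
      open ℕₚ.≤-Reasoning
      P? : Decidable (λ i → HasRetParent (label i))
      P? i = hasRetParent? (label i)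
      uniq : Unique (allFin n)
      uniq = Uniqueₚ.allFin⁺ n
      below : length (filter P? (allFin n)) ≤ length rets
      below = length-≤ {R = λ i r → r ⟶ label i × mark r ≡ reticulation} (Uniqueₚ.filter⁺ P? uniq)
        (λ p → let r , e , k = proj₂ (∈-filter⁻ P? {xs = allFin n} p) in r , ∈-satisfying⁺ (ret? ∘ mark) k , e , k)
        (λ _ _ (e , k) (e′ , _) → label-injective _ _ (child-unique (inj₂ k) e e′))
      others : length (filter (¬? ∘ P?) (allFin n)) ≤ length treeLeaves
      others = length-≤ {R = λ i v → label i ≡ v} (Uniqueₚ.filter⁺ (¬? ∘ P?) uniq)
        (λ {i} p → label i , ∈-satisfying⁺ treeLeaf? (label-mark i , proj₂ (∈-filter⁻ (¬? ∘ P?) {xs = allFin n} p)) , refl)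
        (λ _ _ p q → label-injective _ _ (trans p (sym q)))

  abstract
    length-farRets-≥ : ∀ ϱ → n ∸ length treeLeaves ∸ 4 ^ (2 + L) ≤ length (farRets ϱ)
    length-farRets-≥ ϱ = ℕₚ.m≤n+o⇒m∸n≤o (n ∸ length treeLeaves) (4 ^ (2 + L)) (ℕₚ.m≤n+o⇒m∸n≤o n (length treeLeaves) (begin
      n                                        ≤⟨ n≤ ⟩
      length treeLeaves + length rets          ≡⟨ cong (length treeLeaves +_) (length-filter-¬ P? rets) ⟨
      length treeLeaves + (length (filter P? rets) + length (farRets ϱ))
        ≤⟨ ℕₚ.+-monoʳ-≤ (length treeLeaves) (ℕₚ.+-monoˡ-≤ (length (farRets ϱ)) nearby) ⟩
      length treeLeaves + (4 ^ (2 + L) + length (farRets ϱ)) ∎))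
      where
      open ℕₚ.≤-Reasoning
      P? : Decidable (Near edge ϱ (2 + L))
      P? β = near? ϱ (2 + L) β
      nearby : length (filter P? rets) ≤ 4 ^ (2 + L)
      nearby = ℕₚ.≤-trans
        (⊆⇒length-≤ {ys = ball edge (2 + L) ϱ} (Uniqueₚ.filter⁺ P? (satisfying-unique (ret? ∘ mark)))
          (λ p → ∈-ball⁺ (proj₂ (∈-filter⁻ P? {xs = rets} p))))
        (length-ball-≤ (2 + L) ϱ)

  -- Exchange a parent y of ϱ with a parent z of a far away reticulation β:
  -- the walk from x to y that closed the cycle is untouched, so afterwards
  -- y can still be found near x.
  record Exchange (ϱ β : Fin order) : Set where
    field
      x y z : Fin order
      ϱ-ret : mark ϱ ≡ reticulation
      β-ret : mark β ≡ reticulation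
      x⟶ϱ   : x ⟶ ϱ
      x≢y   : x ≢ y
      y⟶ϱ   : y ⟶ ϱ
      z⟶β   : z ⟶ β
      walk  : Near (avoiding edge ϱ) x L y
      far   : ¬ Near edge ϱ (2 + L) β

    exchange-swappable : Swappable edge y ϱ z β
    -- Either of the unwanted edges would place `β` at distance 2 from `ϱ`, hence the `2` in the
    -- radius `2 + L`.
    exchange-swappable = swappable y⟶ϱ z⟶β
      (λ e → far (near-mono (s≤s (s≤s z≤n)) (step (near-step (inj₂ y⟶ϱ)) (inj₁ e))))
      (λ e → far (near-mono (s≤s (s≤s z≤n)) (step (near-step (inj₂ e)) (inj₁ z⟶β))))

    exchanged : Network n
    exchanged = swapAtRets N exchange-swappable ϱ-ret β-ret

    private
      module E = Net exchanged

    x⟶ϱ′ : x E.⟶ ϱ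
    x⟶ϱ′ = Swap.swap⁺ edge y ϱ z β (inj₁ (x⟶ϱ ,
      λ { (inj₁ (eq , _)) → x≢y eq ; (inj₂ (_ , eq)) → Swappable.α≢β exchange-swappable eq }))

    y⟶β′ : y E.⟶ β
    y⟶β′ = Swap.swap⁺ edge y ϱ z β (inj₂ (inj₁ (refl , refl)))

    z⟶ϱ′ : z E.⟶ ϱ
    z⟶ϱ′ = Swap.swap⁺ edge y ϱ z β (inj₂ (inj₂ (refl , refl)))

    x≢z : x ≢ z
    x≢z eq = Swappable.z↛α exchange-swappable (subst (_⟶ ϱ) eq x⟶ϱ)

    walk′ : Near E.edge x L y
    walk′ = go ℕₚ.≤-refl walk
      where
      forget : ∀ {r u} → Near (avoiding edge ϱ) x r u → Near edge x r u
      forget here         = here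
      forget (step p adj) = step (forget p) (Sum.map (proj₁ ∘ avoiding⁻ edge ϱ) (proj₁ ∘ avoiding⁻ edge ϱ) adj)
      -- The vertices of the walk are within `1 + L` of `ϱ`, so none of them is `β`. They also avoid
      -- `ϱ`, and every exchanged edge ends in `ϱ` or `β`.
      untouched : ∀ {r u} → r ≤ L → Near (avoiding edge ϱ) x r u → u ≢ β
      untouched r≤L p refl = far (near-mono (s≤s (ℕₚ.m≤n⇒m≤1+n r≤L)) (near-trans (near-step (inj₂ x⟶ϱ)) (forget p)))
      keep : ∀ {u w} → w ≢ β → T (avoiding edge ϱ u w) → u E.⟶ w
      keep w≢β t = let e , _ , w≢ϱ = avoiding⁻ edge ϱ t in
        Swap.swap⁺ edge y ϱ z β (inj₁ (e , [ w≢ϱ ∘ proj₂ , w≢β ∘ proj₂ ]′))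
      go : ∀ {r u} → r ≤ L → Near (avoiding edge ϱ) x r u → Near E.edge x r u
      go r≤L here = here
      go (s≤s r≤L) q@(step p adj) = step (go (ℕₚ.m≤n⇒m≤1+n r≤L) p)
        (Sum.map (keep (untouched (s≤s r≤L) q)) (keep (untouched (ℕₚ.m≤n⇒m≤1+n r≤L) p)) adj)

  exchange : ∀ {ϱ β} → ShortCycle ϱ → mark β ≡ reticulation → ¬ Near edge ϱ (2 + L) β → Exchange ϱ β
  exchange (ϱ-ret , x , y , ex , ey , x≢y , walk) β-ret far = record
    { x = x ; y = y ; z = proj₁ (parents-of-ret β-ret) ; ϱ-ret = ϱ-ret ; β-ret = β-ret
    ; x⟶ϱ = ex ; x≢y = x≢y ; y⟶ϱ = ey ; z⟶β = proj₁ (proj₂ (proj₂ (proj₂ (parents-of-ret β-ret))))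
    ; walk = walk ; far = far }

-- After the exchange `ϱ` is still the reticulation below `x`, while `β` is the one below `y`, and
-- `z` is the parent of `ϱ` other than `x`. So `x` and `y` reveal all ends of the exchanged edges.
exchange-reflects : ∀ {n L} {M N : Network n} {ϱ β ϱ′ β′}
  (p : ShortCycles.Exchange M L ϱ β) (q : ShortCycles.Exchange N L ϱ′ β′) →
  let module p = ShortCycles.Exchange p ; module q = ShortCycles.Exchange q in
  (e : p.exchanged ≃ q.exchanged) → _≃_.to e p.x ≡ q.x → _≃_.to e p.y ≡ q.y →
  ∃ λ (f : M ≃ N) → _≃_.to f ϱ ≡ ϱ′ × _≃_.to f β ≡ β′
exchange-reflects {M = M} {N} {ϱ} {β} {ϱ′} {β′} p q e ex ey = record
  { bijection       = bijection
  ; edge-preserved  = swap-reflects bijection p.exchange-swappable q.exchange-swappable edge-preserved ey eϱ ez eβ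
  ; label-preserved = label-preserved
  } , eϱ , eβ
  where
  module p = ShortCycles.Exchange p
  module q = ShortCycles.Exchange q
  module Q = Net q.exchanged
  open Iso e
  eϱ : to ϱ ≡ ϱ′
  eϱ = Q.ret-child-unique (ret-preserved e p.ϱ-ret) q.ϱ-ret (subst (Q._⟶ to ϱ) ex (edge⁺ p.x⟶ϱ′)) q.x⟶ϱ′
  eβ : to β ≡ β′
  eβ = Q.ret-child-unique (ret-preserved e p.β-ret) q.β-ret (subst (Q._⟶ to β) ey (edge⁺ p.y⟶β′)) q.y⟶β′
  ez : to p.z ≡ q.z
  ez with Q.three-parents q.ϱ-ret q.x≢z q.x⟶ϱ′ q.z⟶ϱ′ (subst (to p.z Q.⟶_) eϱ (edge⁺ p.z⟶ϱ′))
  ... | inj₁ eq = contradiction (to-injective (trans ex (sym eq))) p.x≢z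
  ... | inj₂ eq = eq

module CountShortCycles (n L : ℕ) where
  open Classes n
  private
    module At (c : Fin size) = ShortCycles (representative c) L
    module Net′ (c : Fin size) = Network (representative c)

    Source Target : Set
    Source = Σ (Σ (Fin size) (λ c → Fin (Net′.order c))) (λ (c , _) → Fin (Net′.order c))
    Target = Σ (Σ (Fin size) (λ c → Fin (Net′.order c))) (λ (c , _) → Fin (Net′.order c))

    targets : List Target
    targets = Σ-list (Σ-list (allFin size) (λ c → allFin (Net′.order c))) (λ (c , x) → ball (Net′.edge c) L x)

    length-targets : length targets ≤ size * (4 * n) * 4 ^ L
    length-targets = ℕₚ.≤-trans
      (length-Σ-list-≤ (Σ-list (allFin size) (λ c → allFin (Net′.order c))) (4 ^ L)
        (λ {(c , x)} _ → Balls.length-ball-≤ (representative c) L x))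
      (ℕₚ.*-monoˡ-≤ (4 ^ L) (ℕₚ.≤-trans
        (length-Σ-list-≤ (allFin size) (4 * n) (λ {c} _ →
          ℕₚ.≤-trans (ℕₚ.≤-reflexive (length-tabulate {n = Net′.order c} id)) (Kinds.order≤ (representative c))))
        (ℕₚ.≤-reflexive (cong (_* (4 * n)) (length-tabulate {n = size} id)))))

    Exchanges : Source → Target → Set
    Exchanges ((c , ϱ) , β) ((c′ , x) , y) = ∃ λ (p : At.Exchange c ϱ β) → let module p = ShortCycles.Exchange p in
      ∃ λ (e : p.exchanged ≃ representative c′) → _≃_.to e p.x ≡ x × _≃_.to e p.y ≡ y

    -- A common target yields an isomorphism between the two original networks. Both are
    -- representatives, hence equal, and the isomorphism becomes an automorphism, which fixes `ϱ`
    -- and `β` by `rigid`.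
    exchanges-injective : ∀ {s s′ t} → Exchanges s t → Exchanges s′ t → s ≡ s′
    exchanges-injective {(c , ϱ) , β} {(d , ϱ′) , β′} (p , e , ex , ey) (q , f , fx , fy)
      with exchange-reflects p q (≃-trans e (≃-sym f))
             (trans (cong (_≃_.from f) (trans ex (sym fx))) (_≃_.strictlyInverseʳ f _))
             (trans (cong (_≃_.from f) (trans ey (sym fy))) (_≃_.strictlyInverseʳ f _))
    ... | g , gϱ , gβ with representative-injective g
    ...   | refl with trans (sym (rigid g ϱ)) gϱ | trans (sym (rigid g β)) gβ
    ...     | refl | refl = refl

  module _ (cs : List (Fin size)) (cs-unique : Unique cs) where

    shortCycles : List (Σ (Fin size) (λ c → Fin (Net′.order c)))
    shortCycles = Σ-list cs (λ c → At.onShortCycle c)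

    private
      sources : List Source
      sources = Σ-list shortCycles (λ (c , ϱ) → At.farRets c ϱ)

      sources-unique : Unique sources
      sources-unique = Σ-list-unique (Σ-list-unique cs-unique (λ c → satisfying-unique (At.shortCycle? c)))
        (λ (c , ϱ) → Uniqueₚ.filter⁺ (λ β → ¬? (near? ϱ (2 + L) β)) (satisfying-unique (ret? ∘ Net′.mark c)))

      sources≤targets : length sources ≤ length targets
      sources≤targets = length-≤ {R = Exchanges} sources-unique total (λ _ _ → exchanges-injective)
        where
        total : ∀ {s} → s ∈ sources → ∃ λ t → t ∈ targets × Exchanges s t
        total {(c , ϱ) , β} s∈ =
          ((class M , to p.x) , to p.y) ,
          ∈-Σ-list⁺ (∈-Σ-list⁺ (∈-allFin _) (∈-allFin _)) (∈-ball⁺ (transport p.walk′)) ,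
          p , class-≃ M , refl , refl
          where
          members = ∈-Σ-list⁻ shortCycles s∈
          β∈ = ∈-filter⁻ (λ β → ¬? (near? ϱ (2 + L) β)) {xs = At.rets c} (proj₂ members)
          p : At.Exchange c ϱ β
          p = At.exchange c (∈-satisfying⁻ (At.shortCycle? c) (proj₂ (∈-Σ-list⁻ cs (proj₁ members))))
                (∈-satisfying⁻ (ret? ∘ Net′.mark c) (proj₁ β∈)) (proj₂ β∈)
          module p = ShortCycles.Exchange p
          M = p.exchanged
          open Iso (class-≃ M) using (to; edge⁺)
          transport : ∀ {r x y} → Near (Network.edge M) x r y → Near (Net′.edge (class M)) (to x) r (to y)
          transport here         = here
          transport (step q adj) = step (transport q) (Sum.map edge⁺ edge⁺ adj)

    length-shortCycles : ∀ k → (∀ {c} → c ∈ cs → k ≤ n ∸ length (Kinds.treeLeaves (representative c)) ∸ 4 ^ (2 + L)) →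
      length shortCycles * k ≤ size * (4 * n) * 4 ^ L
    length-shortCycles k h = ℕₚ.≤-trans
      (length-Σ-list-≥ shortCycles k (λ {(c , ϱ)} p →
        ℕₚ.≤-trans (h (proj₁ (∈-Σ-list⁻ cs p))) (At.length-farRets-≥ c ϱ)))
      (ℕₚ.≤-trans sources≤targets length-targets)

-- Tree leaves

module Rotations {n} (N : Network n) where
  open Net N
  open Kinds N

  -- Hang the subtree of a child d of v in the place of the leaf a, and a
  -- in the place of d.
  record Rotation (v a : Fin order) : Set where
    field
      d c p    : Fin order
      v-tree   : mark v ≡ tree
      v⟶d      : v ⟶ d
      v⟶c      : v ⟶ c
      d≢c      : d ≢ c
      d-nonRet : NonRet (mark d)
      c-nonRet : NonRet (mark c)
      a-leaf   : mark a ≡ leaf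
      p⟶a      : p ⟶ a
      p-¬ret   : mark p ≢ reticulation
      p≢v      : p ≢ v
      d↛p      : ¬ Star _⟶_ d p

    v↛a : ¬ v ⟶ a
    v↛a e = p≢v (parent-unique (inj₂ a-leaf) p⟶a e)

    abstract
      rotation-swappable : Swappable edge v d p a
      rotation-swappable = swappable v⟶d p⟶a v↛a (λ e → p≢v (parent-unique d-nonRet e v⟶d))

      rotated-isSimplexTreeChild : IsSimplexTreeChild (Swap.swap edge v d p a) o mark label
      rotated-isSimplexTreeChild = swapAtLeaf-isSimplexTreeChild N rotation-swappable
        (λ k → case trans (sym v-tree) k of λ ()) p-¬ret d-nonRet a-leaf d↛p

    rotated : Network n
    rotated = record { isSimplexTreeChild = rotated-isSimplexTreeChild }

    abstract
      p⟶d′ : Network._⟶_ rotated p d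
      p⟶d′ = Swap.swap⁺ edge v d p a (inj₂ (inj₂ (refl , refl)))

      v⟶a′ : Network._⟶_ rotated v a
      v⟶a′ = Swap.swap⁺ edge v d p a (inj₂ (inj₁ (refl , refl)))

      v⟶c′ : Network._⟶_ rotated v c
      v⟶c′ = Swap.swap⁺ edge v d p a (inj₁ (v⟶c ,
          λ { (inj₁ (_ , eq)) → d≢c (sym eq) ; (inj₂ (eq , _)) → p≢v (sym eq) }))

      a≢c : a ≢ c
      a≢c eq = v↛a (subst (v ⟶_) (sym eq) v⟶c)

    insertable : Insertable rotated a
    insertable = record
      { a-leaf = a-leaf ; v = v ; c = c ; v-tree = v-tree
      ; v⟶a = v⟶a′ ; v⟶c = v⟶c′ ; c-nonRet = c-nonRet ; a≢c = a≢c }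

    grown : Network n
    grown = insertNetwork rotated insertable

  private
    star? : ∀ p u → Acc (flip (TransClosure _⟶_)) u → Dec (Star _⟶_ u p)
    star? p u (acc rs) with u ≟ᶠ p
    ... | yes refl = yes ε
    ... | no u≢p   = map′ (λ (w , e , q) → e ◅ q)
      (λ { ε → contradiction refl u≢p ; (e ◅ q) → _ , e , q })
      (any? step?)
      where
      step? : ∀ w → Dec (u ⟶ w × Star _⟶_ w p)
      step? w with T? (edge u w)
      ... | no ¬e = no (¬e ∘ proj₁)
      ... | yes e = map′ (e ,_) proj₂ (star? p w (rs [ e ]))

    downwards : ∀ {u p} → Star (flip _⟶_) p u → Star _⟶_ u p
    downwards = Star.reverse id

    -- Above a vertex that is neither a reticulation nor a leaf all parents are unique, since a
    -- reticulation would only have a leaf below it. The ancestors therefore form a chain.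
    comparable : ∀ {u u′ p} → mark p ≢ reticulation → mark p ≢ leaf →
      Star (flip _⟶_) p u → Star (flip _⟶_) p u′ → Star _⟶_ u u′ ⊎ Star _⟶_ u′ u
    comparable ¬r ¬l ε       q = inj₂ (downwards q)
    comparable ¬r ¬l (e ◅ p) ε = inj₁ (downwards (e ◅ p))
    comparable ¬r ¬l (e ◅ p) (f ◅ q) with target-mark e
    ... | inj₂ r  = contradiction r ¬r
    ... | inj₁ nr with parent-unique nr e f
    ...   | refl = comparable (λ k → ¬l (one-component _ _ k e)) (λ k → leaf-childless k e) p q

    -- A path from `x` to `y` would enter `y` through its only parent `v` and thus close a directed
    -- cycle through `x`.
    not-below-sibling : ∀ {v x y} → v ⟶ x → v ⟶ y → NonRet (mark y) → x ≢ y → ¬ Star _⟶_ x y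
    not-below-sibling ex ey nr x≢y p with Star.reverse {U = flip _⟶_} id p
    ... | ε = x≢y refl
    ... | f ◅ q with parent-unique nr f ey
    ...   | refl = acyclic _ (prepend ex (downwards q))
      where
      prepend : ∀ {u w z} → u ⟶ w → Star _⟶_ w z → TransClosure _⟶_ u z
      prepend e ε       = [ e ]
      prepend e (f ◅ p) = e ∷ prepend f p

    not-both : ∀ {v x y p} → v ⟶ x → v ⟶ y → NonRet (mark x) → NonRet (mark y) → x ≢ y →
      mark p ≢ reticulation → mark p ≢ leaf → Star _⟶_ x p → ¬ Star _⟶_ y p
    not-both ex ey nx ny x≢y ¬r ¬l p q with comparable ¬r ¬l (Star.reverse id p) (Star.reverse id q)
    ... | inj₁ s = not-below-sibling ex ey ny x≢y s
    ... | inj₂ s = not-below-sibling ey ex nx (x≢y ∘ sym) s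

  -- By `not-both` at most one child of `v` is `p` or an ancestor of `p`. The other one is taken as
  -- `d`, for otherwise the new edge from `p` to `d` would close a directed cycle.
  rotation : ∀ {v a} → Branch v → TreeLeaf a → ¬ v ⟶ a → Rotation v a
  rotation {v} {a} (v-tree , ¬rc) (a-leaf , ¬rp) v↛a
    with parent (inj₂ a-leaf) | children-of-tree v-tree
  ... | p , p⟶a , _ | x , y , x≢y , ex , ey , _ = go (star? p x (descendants-wellFounded acyclic x))
    where
    nonRet : ∀ {w} → v ⟶ w → NonRet (mark w)
    nonRet e = [ id , (λ r → contradiction (_ , e , r) ¬rc) ]′ (target-mark e)
    p-¬ret : mark p ≢ reticulation
    p-¬ret k = ¬rp (p , p⟶a , k)
    p≢v : p ≢ v
    p≢v refl = v↛a p⟶a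
    go : Dec (Star _⟶_ x p) → Rotation v a
    go (no ¬s) = record
      { v-tree = v-tree ; v⟶d = ex ; v⟶c = ey ; d≢c = x≢y ; d-nonRet = nonRet ex ; c-nonRet = nonRet ey
      ; a-leaf = a-leaf ; p⟶a = p⟶a ; p-¬ret = p-¬ret ; p≢v = p≢v ; d↛p = ¬s }
    go (yes s) = record
      { v-tree = v-tree ; v⟶d = ey ; v⟶c = ex ; d≢c = x≢y ∘ sym ; d-nonRet = nonRet ey ; c-nonRet = nonRet ex
      ; a-leaf = a-leaf ; p⟶a = p⟶a ; p-¬ret = p-¬ret ; p≢v = p≢v
      ; d↛p = not-both ex ey (nonRet ex) (nonRet ey) x≢y p-¬ret (λ k → leaf-childless k p⟶a) s }

  distantBranches : Fin order → List (Fin order)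
  distantBranches a = filter (λ v → ¬? (T? (edge v a))) branches

  abstract
    -- There is one branch fewer than tree leaves, and at most one branch is the parent of `a`.
    length-distantBranches-≥ : ∀ {a} → TreeLeaf a → length treeLeaves ∸ 2 ≤ length (distantBranches a)
    length-distantBranches-≥ {a} (a-leaf , _) = subst (λ k → k ∸ 2 ≤ length (distantBranches a)) (sym length-treeLeaves)
      (ℕₚ.m≤n+o⇒m∸n≤o (length branches) 1 (begin
        length branches                                             ≡⟨ length-filter-¬ P? branches ⟨
        length (filter P? branches) + length (distantBranches a)    ≤⟨ ℕₚ.+-monoˡ-≤ _ one ⟩
        1 + length (distantBranches a)                              ∎))
      where
      open ℕₚ.≤-Reasoning
      P? : Decidable (λ v → v ⟶ a)
      P? v = T? (edge v a)
      one : length (filter P? branches) ≤ 1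
      one = length-≤ {R = λ _ (_ : Fin order) → ⊤} {ys = a ∷ []} (Uniqueₚ.filter⁺ P? (satisfying-unique branch?))
        (λ _ → a , here refl , tt)
        (λ p q _ _ → parent-unique (inj₂ a-leaf) (proj₂ (∈-filter⁻ P? {xs = branches} p)) (proj₂ (∈-filter⁻ P? {xs = branches} q)))

-- Undoing the insertion reveals `v` and `a`. The mark on `d` supplies the rest, because `p` is now
-- the only parent of `d`.
rotation-reflects : ∀ {n} {M N : Network n} {v a v′ a′}
  (p : Rotations.Rotation M v a) (q : Rotations.Rotation N v′ a′) →
  let module p = Rotations.Rotation p ; module q = Rotations.Rotation q in
  (e : p.grown ≃ q.grown) → _≃_.to e (old p.d) ≡ old q.d →
  ∃ λ (f : M ≃ N) → _≃_.to f v ≡ v′ × _≃_.to f a ≡ a′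
rotation-reflects {M = M} {N} p q e ed with insert-reflects (Rotations.Rotation.insertable p) (Rotations.Rotation.insertable q) e
... | g , ga , gv , g-old = record
  { bijection       = bijection
  ; edge-preserved  = swap-reflects bijection p.rotation-swappable q.rotation-swappable edge-preserved gv gd gp ga
  ; label-preserved = label-preserved
  } , gv , ga
  where
  module p = Rotations.Rotation p
  module q = Rotations.Rotation q
  open Iso g
  gd : to p.d ≡ q.d
  gd = old-injective (trans (sym (g-old p.d)) ed)
  gp : to p.p ≡ q.p
  gp = Net.parent-unique q.rotated q.d-nonRet (subst (Network._⟶_ q.rotated (to p.p)) gd (edge⁺ p.p⟶d′)) q.p⟶d′

module CountTreeLeaves (n : ℕ) where
  open Classes n
  private
    module At (c : Fin size) = Rotations (representative c)
    module Kinds′ (c : Fin size) = Kinds (representative c)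
    module Net′ (c : Fin size) = Network (representative c)

    Source Target : Set
    Source = Σ (Σ (Fin size) (λ c → Fin (Net′.order c))) (λ (c , _) → Fin (Net′.order c))
    Target = Σ (Fin size) (λ c → Fin (Net′.order c))

    targets : List Target
    targets = Σ-list (allFin size) (λ c → allFin (Net′.order c))

    length-targets : length targets ≤ size * (4 * n)
    length-targets = ℕₚ.≤-trans
      (length-Σ-list-≤ (allFin size) (4 * n) (λ {c} _ →
        ℕₚ.≤-trans (ℕₚ.≤-reflexive (length-tabulate {n = Net′.order c} id)) (Kinds.order≤ (representative c))))
      (ℕₚ.≤-reflexive (cong (_* (4 * n)) (length-tabulate {n = size} id)))

    Rotates : Source → Target → Set
    Rotates ((c , a) , v) (c′ , x) = ∃ λ (p : At.Rotation c v a) → let module p = Rotations.Rotation p in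
      ∃ λ (e : p.grown ≃ representative c′) → _≃_.to e (old p.d) ≡ x

    rotates-injective : ∀ {s s′ t} → Rotates s t → Rotates s′ t → s ≡ s′
    rotates-injective {(c , a) , v} {(d , a′) , v′} (p , e , ex) (q , f , fx)
      with rotation-reflects p q (≃-trans e (≃-sym f))
             (trans (cong (_≃_.from f) (trans ex (sym fx))) (_≃_.strictlyInverseʳ f _))
    ... | g , gv , ga with representative-injective g
    ...   | refl with trans (sym (rigid g v)) gv | trans (sym (rigid g a)) ga
    ...     | refl | refl = refl

  module _ (cs : List (Fin size)) (cs-unique : Unique cs) where

    private
      leafPairs : List (Σ (Fin size) (λ c → Fin (Net′.order c)))
      leafPairs = Σ-list cs Kinds′.treeLeaves

      sources : List Source
      sources = Σ-list leafPairs (λ (c , a) → At.distantBranches c a)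

      sources-unique : Unique sources
      sources-unique = Σ-list-unique (Σ-list-unique cs-unique (λ c → satisfying-unique (Kinds′.treeLeaf? c)))
        (λ (c , a) → Uniqueₚ.filter⁺ (λ v → ¬? (T? (Net′.edge c v a))) (satisfying-unique (Kinds′.branch? c)))

      sources≤targets : length sources ≤ length targets
      sources≤targets = length-≤ {R = Rotates} sources-unique total (λ _ _ → rotates-injective)
        where
        total : ∀ {s} → s ∈ sources → ∃ λ t → t ∈ targets × Rotates s t
        total {(c , a) , v} s∈ =
          (class M , _≃_.to (class-≃ M) (old p.d)) , ∈-Σ-list⁺ (∈-allFin _) (∈-allFin _) , p , class-≃ M , refl
          where
          members = ∈-Σ-list⁻ leafPairs s∈
          v∈ = ∈-filter⁻ (λ v → ¬? (T? (Net′.edge c v a))) {xs = Kinds′.branches c} (proj₂ members)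
          p : At.Rotation c v a
          p = At.rotation c (∈-satisfying⁻ (Kinds′.branch? c) (proj₁ v∈))
                (∈-satisfying⁻ (Kinds′.treeLeaf? c) (proj₂ (∈-Σ-list⁻ cs (proj₁ members)))) (proj₂ v∈)
          module p = Rotations.Rotation p
          M = p.grown

    length-manyTreeLeaves : ∀ J → (∀ {c} → c ∈ cs → J ≤ length (Kinds′.treeLeaves c)) →
      length cs * J * (J ∸ 2) ≤ size * (4 * n)
    length-manyTreeLeaves J h = begin
      length cs * J * (J ∸ 2)      ≤⟨ ℕₚ.*-monoˡ-≤ (J ∸ 2) (length-Σ-list-≥ cs J h) ⟩
      length leafPairs * (J ∸ 2)   ≤⟨ length-Σ-list-≥ leafPairs (J ∸ 2) (λ {(c , a)} p →
        let c∈ , a∈ = ∈-Σ-list⁻ cs p in ℕₚ.≤-trans (ℕₚ.∸-monoˡ-≤ 2 (h c∈))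
          (At.length-distantBranches-≥ c (∈-satisfying⁻ (Kinds′.treeLeaf? c) a∈))) ⟩
      length sources               ≤⟨ sources≤targets ⟩
      length targets               ≤⟨ length-targets ⟩
      size * (4 * n)               ∎
      where open ℕₚ.≤-Reasoning

-- The covering map

height-spine : Spine → ℕ
height-spine p-spine          = 2
height-spine q-spine          = 2
height-spine (decorating s i) = 2 + (ℤ.∣ i ∣ + height-spine s)

-- The distance from `ℓ₀` in closed form: `within⇒height` bounds it from below and `height-within`
-- attains it. A shortest walk enters each spine at its index 0.
height : R̂-Vertex → ℕ
height (on s i) = ℤ.∣ i ∣ + height-spine s
height ρ₀       = 1
height ℓ₀       = 0
height (ρ s i)  = 1 + (ℤ.∣ i ∣ + height-spine s)
height (ℓ s i)  = 2 + (ℤ.∣ i ∣ + height-spine s)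

∣suc∣≤ : ∀ i → ℤ.∣ ℤ.suc i ∣ ≤ suc ℤ.∣ i ∣
∣suc∣≤ i = ℤₚ.∣i+j∣≤∣i∣+∣j∣ (ℤ.+ 1) i

∣pred∣≤ : ∀ i → ℤ.∣ ℤ.pred i ∣ ≤ suc ℤ.∣ i ∣
∣pred∣≤ i = ℤₚ.∣i+j∣≤∣i∣+∣j∣ -[1+ 0 ] i

∣∣≤suc∣suc∣ : ∀ i → ℤ.∣ i ∣ ≤ suc ℤ.∣ ℤ.suc i ∣
∣∣≤suc∣suc∣ i = subst (λ j → ℤ.∣ j ∣ ≤ suc ℤ.∣ ℤ.suc i ∣) (ℤₚ.pred-suc i) (∣pred∣≤ (ℤ.suc i))

height-edge : ∀ {X Y} → R̂-Edge X Y → height Y ≤ suc (height X) × height X ≤ suc (height Y)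
height-edge (along {s} {i} refl) = ℕₚ.+-monoˡ-≤ (height-spine s) (∣suc∣≤ i) , ℕₚ.+-monoˡ-≤ (height-spine s) (∣∣≤suc∣suc∣ i)
height-edge p₀→ρ₀                = s≤s z≤n , s≤s (s≤s z≤n)
height-edge q₀→ρ₀                = s≤s z≤n , s≤s (s≤s z≤n)
height-edge ρ₀→ℓ₀                = z≤n , s≤s z≤n
height-edge x→ρ[x]               = ℕₚ.≤-refl , ℕₚ.m≤n+m _ 2
height-edge w[x]→ρ[x]            = ℕₚ.m≤n+m _ 2 , ℕₚ.≤-refl
height-edge ρ[x]→ℓ[x]            = ℕₚ.≤-refl , ℕₚ.m≤n+m _ 2

within⇒height : ∀ {r X} → Within R̂ ℓ₀ r X → height X ≤ r
within⇒height (here refl)        = z≤n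
within⇒height (step p (fwd e))   = ℕₚ.≤-trans (proj₁ (height-edge e)) (s≤s (within⇒height p))
within⇒height (step p (bwd e))   = ℕₚ.≤-trans (proj₂ (height-edge e)) (s≤s (within⇒height p))

within-mono : ∀ {G v r s u} → r ≤ s → Within G v r u → Within G v s u
within-mono _         (here eq)    = here eq
within-mono (s≤s r≤s) (step p adj) = step (within-mono r≤s p) adj

height-within-on   : ∀ s i → Within R̂ ℓ₀ (height (on s i)) (on s i)
height-within-base : ∀ s → Within R̂ ℓ₀ (height-spine s) (on s 0ℤ)
height-within-on s (ℤ.+ zero)       = height-within-base s
height-within-on s (ℤ.+ suc k)      = step (height-within-on s (ℤ.+ k)) (fwd (along refl))
height-within-on s -[1+ zero ]      = step (height-within-base s) (bwd (along refl))
height-within-on s -[1+ suc k ]     = step (height-within-on s -[1+ k ]) (bwd (along refl))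
height-within-base p-spine          = step (step (here refl) (bwd ρ₀→ℓ₀)) (bwd p₀→ρ₀)
height-within-base q-spine          = step (step (here refl) (bwd ρ₀→ℓ₀)) (bwd q₀→ρ₀)
height-within-base (decorating s i) = step (step (height-within-on s i) (fwd x→ρ[x])) (bwd w[x]→ρ[x])

height-within : ∀ X → Within R̂ ℓ₀ (height X) X
height-within (on s i) = height-within-on s i
height-within ρ₀       = step (here refl) (bwd ρ₀→ℓ₀)
height-within ℓ₀       = here refl
height-within (ρ s i)  = step (height-within-on s i) (fwd x→ρ[x])
height-within (ℓ s i)  = step (step (height-within-on s i) (fwd x→ρ[x])) (fwd ρ[x]→ℓ[x])

module _ {n} (N : Network n) where
  open Net N

  within⇒near : ∀ {v r u} → Within markedGraph v r u → Near edge v r u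
  within⇒near (here refl)      = here
  within⇒near (step p (fwd e)) = step (within⇒near p) (inj₁ e)
  within⇒near (step p (bwd e)) = step (within⇒near p) (inj₂ e)

  near⇒within : ∀ {v r u} → Near edge v r u → Within markedGraph v r u
  near⇒within here              = here refl
  near⇒within (step p (inj₁ e)) = step (near⇒within p) (fwd e)
  near⇒within (step p (inj₂ e)) = step (near⇒within p) (bwd e)

-- The covering map from R̂ onto the neighbourhood of a leaf.  It is total,
-- with junk values outside the region that contains no special vertex.
module Covering {n} (N : Network n) (i₀ : Fin n) where
  open Net N
  open Kinds N

  abstract
    up down ret : Fin order → Fin order
    up   v = choose (λ u → T? (edge u v)) v
    down v = choose (λ w → T? (edge v w) ×-dec ¬? (ret? (mark w))) v
    ret  v = choose (λ w → T? (edge v w) ×-dec ret? (mark w)) v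

    other : Fin order → Fin order → Fin order
    other x r = choose (λ u → T? (edge u r) ×-dec ¬? (x ≟ᶠ u)) r

    up⟶ : ∀ {u v} → u ⟶ v → up v ⟶ v
    up⟶ {v = v} e = choose-satisfies (λ u → T? (edge u v)) (_ , e)

    down-child : ∀ {v w} → v ⟶ w → mark w ≢ reticulation → v ⟶ down v × mark (down v) ≢ reticulation
    down-child {v} e k = choose-satisfies (λ w → T? (edge v w) ×-dec ¬? (ret? (mark w))) (_ , e , k)

    ret-child : ∀ {v w} → v ⟶ w → mark w ≡ reticulation → v ⟶ ret v × mark (ret v) ≡ reticulation
    ret-child {v} e k = choose-satisfies (λ w → T? (edge v w) ×-dec ret? (mark w)) (_ , e , k)

    other⟶ : ∀ {x r} → mark r ≡ reticulation → x ⟶ r → other x r ⟶ r × x ≢ other x r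
    other⟶ {x} {r} k e = let y , x≢y , ey = other-parent k e in
      choose-satisfies (λ u → T? (edge u r) ×-dec ¬? (x ≟ᶠ u)) (y , ey , x≢y)

  leaf₀ ret₀ : Fin order
  leaf₀ = label i₀
  ret₀  = up leaf₀

  shift : Fin order → ℤ → Fin order
  shift x (ℤ.+ zero)   = x
  shift x (ℤ.+ suc k)  = down (shift x (ℤ.+ k))
  shift x -[1+ zero ]  = up x
  shift x -[1+ suc k ] = up (shift x -[1+ k ])

  base : Spine → Fin order
  base p-spine          = up ret₀
  base q-spine          = other (up ret₀) ret₀
  base (decorating s i) = other (shift (base s) i) (ret (shift (base s) i))

  φ : R̂-Vertex → Fin order
  φ (on s i) = shift (base s) i
  φ ρ₀       = ret₀
  φ ℓ₀       = leaf₀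
  φ (ρ s i)  = ret (shift (base s) i)
  φ (ℓ s i)  = down (ret (shift (base s) i))

  module Region (K : ℕ) (ordinary : ∀ {v} → Near edge leaf₀ K v → ¬ Special v) where

    -- The invariant carried along spines. Within distance `K` a tree vertex has a reticulation
    -- child because it is no branch, its other child is a tree vertex because a leaf there would be
    -- a tree leaf, and its parent is not the root. So spines continue in both directions.
    record TreeAt (h : ℕ) (x : Fin order) : Set where
      constructor treeAt
      field
        is-tree : mark x ≡ tree
        near    : Near edge leaf₀ h x
    open TreeAt

    module _ {h x} (t : TreeAt h x) where

      private
        ordinary-tree : h ≤ K → HasRetChild x
        ordinary-tree h≤K with hasRetChild? x
        ... | yes r = r
        ... | no ¬r = contradiction (inj₂ (inj₁ (is-tree t , ¬r))) (ordinary (near-mono h≤K (near t)))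

      ret-correct : h ≤ K → x ⟶ ret x × mark (ret x) ≡ reticulation
      ret-correct h≤K = let _ , e , k = ordinary-tree h≤K in ret-child e k

      twin-correct : h ≤ K → other x (ret x) ⟶ ret x × x ≢ other x (ret x) × TreeAt (2 + h) (other x (ret x))
      twin-correct h≤K =
        let e , k = ret-correct h≤K ; e′ , x≢ = other⟶ k e in
        e′ , x≢ , treeAt (parent-of-ret k e′) (step (step (near t) (inj₁ e)) (inj₂ e′))

      down-correct : suc h ≤ K → x ⟶ down x × TreeAt (suc h) (down x)
      down-correct h<K with tree-child x (λ k → case trans (sym (is-tree t)) k of λ ())
      ... | w , e , nr with down-child e (λ k → ret⇒¬NonRet k nr)
      ...   | e′ , ¬r = e′ , treeAt tree-mark close
        where
        close : Near edge leaf₀ (suc h) (down x)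
        close = step (near t) (inj₁ e′)
        tree-mark : mark (down x) ≡ tree
        tree-mark with target-mark e′
        ... | inj₂ r        = contradiction r ¬r
        ... | inj₁ (inj₁ k) = k
        ... | inj₁ (inj₂ k) = contradiction (inj₂ (inj₂ (k , λ (u , e″ , r) →
          case trans (sym (is-tree t)) (trans (cong mark (parent-unique (inj₂ k) e′ e″)) r) of λ ())))
          (ordinary (near-mono h<K close))

      up-correct : suc h ≤ K → up x ⟶ x × TreeAt (suc h) (up x)
      up-correct h<K with parent (inj₁ (is-tree t))
      ... | u , e , _ with up⟶ e
      ...   | e′ = e′ , treeAt (tree-mark (mark (up x)) refl) close
        where
        close : Near edge leaf₀ (suc h) (up x)
        close = step (near t) (inj₂ e′)
        tree-mark : ∀ k → mark (up x) ≡ k → mark (up x) ≡ tree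
        tree-mark root         k = contradiction (inj₁ k) (ordinary (near-mono h<K close))
        tree-mark tree         k = k
        tree-mark reticulation k = case trans (sym (is-tree t)) (one-component _ _ k e′) of λ ()
        tree-mark leaf         k = contradiction e′ (leaf-childless k)

    ret₀-correct : ret₀ ⟶ leaf₀ × mark ret₀ ≡ reticulation
    ret₀-correct with hasRetParent? leaf₀
    ... | no ¬r           = contradiction (inj₂ (inj₂ (label-mark i₀ , ¬r))) (ordinary here)
    ... | yes (u , e , k) =
      let e′ = up⟶ e in e′ , trans (cong mark (parent-unique (inj₂ (label-mark i₀)) e′ e)) k

    p₀-correct : up ret₀ ⟶ ret₀ × TreeAt 2 (up ret₀)
    p₀-correct =
      let e , k = ret₀-correct ; _ , _ , _ , e₁ , _ = parents-of-ret k ; e′ = up⟶ e₁ in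
      e′ , treeAt (parent-of-ret k e′) (step (step here (inj₂ e)) (inj₂ e′))

    q₀-correct : base q-spine ⟶ ret₀ × up ret₀ ≢ base q-spine × TreeAt 2 (base q-spine)
    q₀-correct =
      let e , k = ret₀-correct ; e′ , x≢ = other⟶ k (proj₁ p₀-correct) in
      e′ , x≢ , treeAt (parent-of-ret k e′) (step (step here (inj₂ e)) (inj₂ e′))

    base-correct  : ∀ s → height-spine s ≤ K → TreeAt (height-spine s) (base s)
    shift-correct : ∀ s i → height (on s i) ≤ K → TreeAt (height (on s i)) (φ (on s i))
    base-correct p-spine          h≤K = proj₂ p₀-correct
    base-correct q-spine          h≤K = proj₂ (proj₂ q₀-correct)
    base-correct (decorating s i) h≤K = proj₂ (proj₂ (twin-correct (shift-correct s i h) h))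
      where h = ℕₚ.≤-trans (ℕₚ.m≤n+m _ 2) h≤K
    shift-correct s (ℤ.+ zero)   h≤K = base-correct s h≤K
    shift-correct s (ℤ.+ suc k)  h≤K = proj₂ (down-correct (shift-correct s (ℤ.+ k) (ℕₚ.<⇒≤ h≤K)) h≤K)
    shift-correct s -[1+ zero ]  h≤K = proj₂ (up-correct (base-correct s (ℕₚ.<⇒≤ h≤K)) h≤K)
    shift-correct s -[1+ suc k ] h≤K = proj₂ (up-correct (shift-correct s -[1+ k ] (ℕₚ.<⇒≤ h≤K)) h≤K)

    along-correct : ∀ s i → height (on s i) ≤ K → height (on s (ℤ.suc i)) ≤ K → φ (on s i) ⟶ φ (on s (ℤ.suc i))
    along-correct s (ℤ.+ k)      h h′ = proj₁ (down-correct (shift-correct s (ℤ.+ k) h) h′)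
    along-correct s -[1+ zero ]  h h′ = proj₁ (up-correct (base-correct s h′) h)
    along-correct s -[1+ suc k ] h h′ = proj₁ (up-correct (shift-correct s -[1+ k ] h′) h)

    leaf-correct : ∀ s i .{{_ : ℤ.NonZero i}} → height (on s i) ≤ K → φ (ρ s i) ⟶ φ (ℓ s i) × mark (φ (ℓ s i)) ≡ leaf
    leaf-correct s i h with ret-correct (shift-correct s i h) h
    ... | _ , k with child (inj₂ k)
    ...   | c , e , _ with down-child e (λ k′ → case trans (sym k′) (one-component _ _ k e) of λ ())
    ...     | e′ , _ = e′ , one-component _ _ k e′

    φ-mark : ∀ X → height X ≤ K → mark (φ X) ≡ R̂-mark X
    φ-mark (on s i) h = is-tree (shift-correct s i h)
    φ-mark ρ₀       h = proj₂ ret₀-correct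
    φ-mark ℓ₀       h = label-mark i₀
    φ-mark (ρ s i)  h = proj₂ (ret-correct (shift-correct s i (ℕₚ.<⇒≤ h)) (ℕₚ.<⇒≤ h))
    φ-mark (ℓ s i)  h = proj₂ (leaf-correct s i (ℕₚ.<⇒≤ (ℕₚ.<⇒≤ h)))

    φ-edge : ∀ {X Y} → R̂-Edge X Y → height X ≤ K → height Y ≤ K → φ X ⟶ φ Y
    φ-edge (along {s} {i} refl)    h h′ = along-correct s i h h′
    φ-edge p₀→ρ₀                   h h′ = proj₁ p₀-correct
    φ-edge q₀→ρ₀                   h h′ = proj₁ q₀-correct
    φ-edge ρ₀→ℓ₀                   h h′ = proj₁ ret₀-correct
    φ-edge (x→ρ[x] {s} {i})        h h′ = proj₁ (ret-correct (shift-correct s i h) h)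
    φ-edge (w[x]→ρ[x] {s} {i})     h h′ = proj₁ (twin-correct (shift-correct s i (ℕₚ.<⇒≤ h′)) (ℕₚ.<⇒≤ h′))
    φ-edge (ρ[x]→ℓ[x] {s} {i})     h h′ = proj₁ (leaf-correct s i (ℕₚ.<⇒≤ h))

    φ-near : ∀ X → height X ≤ K → Near edge leaf₀ (height X) (φ X)
    φ-near X h = go (height-within X) h
      where
      go : ∀ {r X} → Within R̂ ℓ₀ r X → r ≤ K → Near edge leaf₀ r (φ X)
      go (here refl) _ = here
      go w@(step p (fwd e)) r≤K = step (go p (ℕₚ.<⇒≤ r≤K))
        (inj₁ (φ-edge e (ℕₚ.≤-trans (within⇒height p) (ℕₚ.<⇒≤ r≤K)) (ℕₚ.≤-trans (within⇒height w) r≤K)))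
      go w@(step p (bwd e)) r≤K = step (go p (ℕₚ.<⇒≤ r≤K))
        (inj₂ (φ-edge e (ℕₚ.≤-trans (within⇒height w) r≤K) (ℕₚ.≤-trans (within⇒height p) (ℕₚ.<⇒≤ r≤K))))

    -- At index 0 this is the reticulation through which the spine is attached, elsewhere the
    -- decoration of the vertex.
    ret-below : ∀ s i → ∃ λ Y → R̂-Edge (on s i) Y × R̂-mark Y ≡ reticulation
    ret-below s                  (ℤ.+ suc k)  = ρ s (ℤ.+ suc k) , x→ρ[x] , refl
    ret-below s                  -[1+ k ]     = ρ s -[1+ k ] , x→ρ[x] , refl
    ret-below p-spine            (ℤ.+ zero)   = ρ₀ , p₀→ρ₀ , refl
    ret-below q-spine            (ℤ.+ zero)   = ρ₀ , q₀→ρ₀ , refl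
    ret-below (decorating s i)   (ℤ.+ zero)   = ρ s i , w[x]→ρ[x] , refl

    -- The mark of `φ X` limits the number of its children of each kind, and the images of the
    -- children of `X` already exhaust them. Together with `lift-parent` this makes `φ` a covering
    -- below height `K`.
    lift-child : ∀ X {w} → height X < K → φ X ⟶ w → ∃ λ Y → R̂-Edge X Y × φ Y ≡ w
    lift-child (on s i) {w} h e with target-mark e
    ... | inj₂ r with ret-below s i
    ...   | Y , e′ , k = Y , e′ , ret-child-unique (trans (φ-mark Y hY) k) r (φ-edge e′ (ℕₚ.<⇒≤ h) hY) e
      where hY = ℕₚ.≤-trans (proj₁ (height-edge e′)) h
    lift-child (on s i) {w} h e | inj₁ nr with ret-correct (shift-correct s i (ℕₚ.<⇒≤ h)) (ℕₚ.<⇒≤ h)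
    ...   | er , k = on s (ℤ.suc i) , along refl ,
      nonret-child-unique k er (inj₁ (φ-mark (on s (ℤ.suc i)) hY)) nr (along-correct s i (ℕₚ.<⇒≤ h) hY) e
      where hY = ℕₚ.≤-trans (proj₁ (height-edge (along {s} {i} refl))) h
    lift-child ρ₀ h e = ℓ₀ , ρ₀→ℓ₀ , child-unique (inj₂ (φ-mark ρ₀ (ℕₚ.<⇒≤ h))) (proj₁ ret₀-correct) e
    lift-child ℓ₀ h e = contradiction e (leaf-childless (label-mark i₀))
    lift-child (ρ s i) h e = ℓ s i , ρ[x]→ℓ[x] ,
      child-unique (inj₂ (φ-mark (ρ s i) (ℕₚ.<⇒≤ h))) (φ-edge (ρ[x]→ℓ[x] {s} {i}) (ℕₚ.<⇒≤ h) h) e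
    lift-child (ℓ s i) h e = contradiction e (leaf-childless (φ-mark (ℓ s i) (ℕₚ.<⇒≤ h)))

    parents-of-ret₀ : ∀ {w} → w ⟶ ret₀ → w ≡ base p-spine ⊎ w ≡ base q-spine
    parents-of-ret₀ = three-parents (proj₂ ret₀-correct) (proj₁ (proj₂ q₀-correct)) (proj₁ p₀-correct) (proj₁ q₀-correct)

    parents-of-ρ : ∀ s i .{{_ : ℤ.NonZero i}} {w} → height (on s i) ≤ K → w ⟶ φ (ρ s i) →
      w ≡ φ (on s i) ⊎ w ≡ base (decorating s i)
    parents-of-ρ s i h e = let t = shift-correct s i h ; e₁ , k = ret-correct t h ; e₂ , x≢ , _ = twin-correct t h in
      three-parents k x≢ e₁ e₂ e

    lift-parent : ∀ X {w} → height X < K → w ⟶ φ X → ∃ λ Y → R̂-Edge Y X × φ Y ≡ w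
    lift-parent (on s i) h e = on s (ℤ.pred i) , e′ ,
      parent-unique (inj₁ (φ-mark (on s i) (ℕₚ.<⇒≤ h))) (φ-edge e′ (ℕₚ.≤-trans (proj₂ (height-edge e′)) h) (ℕₚ.<⇒≤ h)) e
      where
      e′ : R̂-Edge (on s (ℤ.pred i)) (on s i)
      e′ = along (sym (ℤₚ.suc-pred i))
    lift-parent ρ₀ h e with parents-of-ret₀ e
    ... | inj₁ eq = on p-spine 0ℤ , p₀→ρ₀ , sym eq
    ... | inj₂ eq = on q-spine 0ℤ , q₀→ρ₀ , sym eq
    lift-parent ℓ₀ h e = ρ₀ , ρ₀→ℓ₀ , parent-unique (inj₂ (label-mark i₀)) (proj₁ ret₀-correct) e
    lift-parent (ρ s i) h e with parents-of-ρ s i (ℕₚ.<⇒≤ (ℕₚ.<⇒≤ h)) e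
    ... | inj₁ eq = on s i , x→ρ[x] , sym eq
    ... | inj₂ eq = on (decorating s i) 0ℤ , w[x]→ρ[x] , sym eq
    lift-parent (ℓ s i) h e = ρ s i , ρ[x]→ℓ[x] ,
      parent-unique (inj₂ (φ-mark (ℓ s i) (ℕₚ.<⇒≤ h))) (φ-edge (ρ[x]→ℓ[x] {s} {i}) (ℕₚ.<⇒≤ (ℕₚ.<⇒≤ h)) (ℕₚ.<⇒≤ h)) e

    lift-walk : ∀ {r u} → r ≤ K → Near edge leaf₀ r u → ∃ λ X → height X ≤ r × φ X ≡ u
    lift-walk r≤K here = ℓ₀ , z≤n , refl
    lift-walk r≤K (step p adj) with lift-walk (ℕₚ.<⇒≤ r≤K) p | adj
    ... | X , hX , refl | inj₁ e with lift-child X (ℕₚ.≤-<-trans hX r≤K) e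
    ...   | Y , e′ , eq = Y , ℕₚ.≤-trans (proj₁ (height-edge e′)) (s≤s hX) , eq
    lift-walk r≤K (step p adj) | X , hX , refl | inj₂ e with lift-parent X (ℕₚ.≤-<-trans hX r≤K) e
    ...   | Y , e′ , eq = Y , ℕₚ.≤-trans (proj₂ (height-edge e′)) (s≤s hX) , eq

-- Injectivity of the covering map

depth : Spine → ℕ
depth p-spine          = 0
depth q-spine          = 0
depth (decorating s _) = suc (depth s)

infix 4 _⊑_
-- The ancestor order on the forest of spines: the descent from `ret₀` to `t` runs along precisely
-- the spines `s` with `s ⊑ t`.
data _⊑_ (s : Spine) : Spine → Set where
  self  : s ⊑ s
  below : ∀ {t i} .{{_ : ℤ.NonZero i}} → s ⊑ t → s ⊑ decorating t i

⊑-parent : ∀ {s t i} .{{_ : ℤ.NonZero i}} → decorating s i ⊑ t → s ⊑ t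
⊑-parent self      = below self
⊑-parent (below p) = below (⊑-parent p)

⊑⇒depth≤ : ∀ {s t} → s ⊑ t → depth s ≤ depth t
⊑⇒depth≤ self      = ℕₚ.≤-refl
⊑⇒depth≤ (below p) = ℕₚ.m≤n⇒m≤1+n (⊑⇒depth≤ p)

⊑⇒height≤ : ∀ {s t} → s ⊑ t → height-spine s ≤ height-spine t
⊑⇒height≤ self                = ℕₚ.≤-refl
⊑⇒height≤ (below {t} {i} p)   = ℕₚ.≤-trans (⊑⇒height≤ p) (ℕₚ.m≤n+m (height-spine t) (2 + ℤ.∣ i ∣))

⊑-deep⇒≡ : ∀ {s t} → s ⊑ t → depth t ≤ depth s → t ≡ s
⊑-deep⇒≡ self      _ = refl
⊑-deep⇒≡ (below p) h = contradiction (ℕₚ.≤-trans h (⊑⇒depth≤ p)) (ℕₚ.<-irrefl refl)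

on-nonzero : ∀ {s t} i .{{_ : ℤ.NonZero i}} → on s i ≢ on t 0ℤ
on-nonzero i refl = ≢-nonZero⁻¹ ℤ.∣ i ∣ refl

height-on-zero : ∀ s i → height-spine s ≤ height (on s i)
height-on-zero s i = ℕₚ.m≤n+m (height-spine s) ℤ.∣ i ∣

module CoveringInjective {n} (N : Network n) (i₀ : Fin n) (K M L : ℕ)
  (ordinary : ∀ {v} → Near (Network.edge N) (Covering.leaf₀ N i₀) K v → ¬ Kinds.Special N v)
  (acyclic-locally : ∀ {v} → Near (Network.edge N) (Covering.leaf₀ N i₀) K v → ¬ ShortCycles.ShortCycle N L v)
  (M<K : M < K) (3M≤L : M + M + M ≤ L) where

  open Net N
  open Covering N i₀
  open Region K ordinary

  private
    M≤K : M ≤ K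
    M≤K = ℕₚ.<⇒≤ M<K

    base≤M : ∀ {s i} → height (on s i) ≤ M → height-spine s ≤ M
    base≤M {s} {i} = ℕₚ.≤-trans (height-on-zero s i)

  up-path : ∀ s a b → a < b → b + height-spine s ≤ K → TransClosure _⟶_ (φ (on s (ℤ.+ a))) (φ (on s (ℤ.+ b)))
  up-path s a (suc b) (s≤s a≤b) h with ℕₚ.m≤n⇒m<n∨m≡n a≤b
  ... | inj₁ a<b  = up-path s a b a<b (ℕₚ.<⇒≤ h) ∷ʳ along-correct s (ℤ.+ b) (ℕₚ.<⇒≤ h) h
  ... | inj₂ refl = [ along-correct s (ℤ.+ b) (ℕₚ.<⇒≤ h) h ]

  negative-path : ∀ s a b → b < a → suc a + height-spine s ≤ K → TransClosure _⟶_ (φ (on s -[1+ a ])) (φ (on s -[1+ b ]))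
  negative-path s (suc a) b (s≤s b≤a) h with ℕₚ.m≤n⇒m<n∨m≡n b≤a
  ... | inj₁ b<a  = along-correct s -[1+ suc a ] h (ℕₚ.<⇒≤ h) ∷ negative-path s a b b<a (ℕₚ.<⇒≤ h)
  ... | inj₂ refl = [ along-correct s -[1+ suc a ] h (ℕₚ.<⇒≤ h) ]

  zero-path : ∀ s a → suc a + height-spine s ≤ K → TransClosure _⟶_ (φ (on s -[1+ a ])) (φ (on s 0ℤ))
  zero-path s zero    h = [ along-correct s -[1+ 0 ] h (ℕₚ.<⇒≤ h) ]
  zero-path s (suc a) h = along-correct s -[1+ suc a ] h (ℕₚ.<⇒≤ h) ∷ zero-path s a (ℕₚ.<⇒≤ h)

  spine-path : ∀ s {i j} → i ℤ.< j → height (on s i) ≤ K → height (on s j) ≤ K →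
    TransClosure _⟶_ (φ (on s i)) (φ (on s j))
  spine-path s (ℤ.-<- b<a)              h h′ = negative-path s _ _ b<a h
  spine-path s (ℤ.-<+ {a} {zero})       h h′ = zero-path s a h
  spine-path s (ℤ.-<+ {a} {suc b})      h h′ = zero-path s a h Plus.++ up-path s 0 (suc b) (s≤s z≤n) h′
  spine-path s (ℤ.+<+ a<b)              h h′ = up-path s _ _ a<b h′

  -- Different vertices of one spine are joined by a directed path, so a common image would close a
  -- directed cycle.
  spine-injective : ∀ s i j → height (on s i) ≤ K → height (on s j) ≤ K → φ (on s i) ≡ φ (on s j) → on s i ≡ on s j
  spine-injective s i j h h′ eq with ℤₚ.<-cmp i j
  ... | tri< i<j _ _  = contradiction (subst (TransClosure _⟶_ _) (sym eq) (spine-path s i<j h h′)) (acyclic _)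
  ... | tri≈ _ refl _ = refl
  ... | tri> _ _ j<i  = contradiction (subst (TransClosure _⟶_ _) eq (spine-path s j<i h′ h)) (acyclic _)

  module _ {r : Fin order} (r-ret : mark r ≡ reticulation) where

    -- Spine vertices map to tree vertices, so a descent to `s` can meet `r` only at `ret₀` or at a
    -- reticulation through which it changes spines.
    data Hit (s : Spine) : Set where
      at-root : ret₀ ≡ r → Hit s
      at      : ∀ t i .{{_ : ℤ.NonZero i}} → decorating t i ⊑ s → φ (ρ t i) ≡ r → Hit s

    private
      tree≢r : ∀ X → R̂-mark X ≡ tree → height X ≤ K → φ X ≢ r
      tree≢r X k h eq = case trans (sym k) (trans (sym (φ-mark X h)) (trans (cong mark eq) r-ret)) of λ ()

      step-down : ∀ {x h X Y} → Near (avoiding edge r) x h (φ X) → R̂-Edge X Y → height X ≤ K → height Y ≤ K →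
        φ X ≢ r → φ Y ≢ r → Near (avoiding edge r) x (suc h) (φ Y)
      step-down p e hX hY X≢ Y≢ = step p (inj₁ (avoiding⁺ edge r (φ-edge e hX hY) X≢ Y≢))

      step-up : ∀ {x h X Y} → Near (avoiding edge r) x h (φ Y) → R̂-Edge X Y → height X ≤ K → height Y ≤ K →
        φ X ≢ r → φ Y ≢ r → Near (avoiding edge r) x (suc h) (φ X)
      step-up p e hX hY X≢ Y≢ = step p (inj₂ (avoiding⁺ edge r (φ-edge e hX hY) X≢ Y≢))

    spine-walk : ∀ s i → height (on s i) ≤ K → Near (avoiding edge r) (base s) ℤ.∣ i ∣ (φ (on s i))
    spine-walk s (ℤ.+ zero)   h = here
    spine-walk s (ℤ.+ suc k)  h = step-down (spine-walk s (ℤ.+ k) (ℕₚ.<⇒≤ h)) (along {s} {ℤ.+ k} refl) (ℕₚ.<⇒≤ h) h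
      (tree≢r (on s (ℤ.+ k)) refl (ℕₚ.<⇒≤ h)) (tree≢r (on s (ℤ.+ suc k)) refl h)
    spine-walk s -[1+ zero ]  h = step-up {X = on s -[1+ 0 ]} here (along {s} { -[1+ 0 ]} refl) h (ℕₚ.<⇒≤ h)
      (tree≢r (on s -[1+ 0 ]) refl h) (tree≢r (on s 0ℤ) refl (ℕₚ.<⇒≤ h))
    spine-walk s -[1+ suc k ] h = step-up (spine-walk s -[1+ k ] (ℕₚ.<⇒≤ h)) (along {s} { -[1+ suc k ]} refl) h (ℕₚ.<⇒≤ h)
      (tree≢r (on s -[1+ suc k ]) refl h) (tree≢r (on s -[1+ k ]) refl (ℕₚ.<⇒≤ h))

    descend : ∀ s → height-spine s ≤ K → Near (avoiding edge r) ret₀ (height-spine s) (base s) ⊎ Hit s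
    descend p-spine h with ret₀ ≟ᶠ r
    ... | yes eq = inj₂ (at-root eq)
    -- `height-spine` is measured from `ℓ₀`, but the walk starts at `ret₀`; `near-suc` absorbs the
    -- difference of one.
    ... | no ≢r  = inj₁ (near-suc (step-up {X = on p-spine 0ℤ} {Y = ρ₀} here p₀→ρ₀ h (ℕₚ.<⇒≤ h) (tree≢r (on p-spine 0ℤ) refl h) ≢r))
    descend q-spine h with ret₀ ≟ᶠ r
    ... | yes eq = inj₂ (at-root eq)
    ... | no ≢r  = inj₁ (near-suc (step-up {X = on q-spine 0ℤ} {Y = ρ₀} here q₀→ρ₀ h (ℕₚ.<⇒≤ h) (tree≢r (on q-spine 0ℤ) refl h) ≢r))
    descend (decorating s i) h with descend s (ℕₚ.≤-trans (ℕₚ.m≤n+m (height-spine s) (2 + ℤ.∣ i ∣)) h) | φ (ρ s i) ≟ᶠ r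
    ... | _                     | yes eq = inj₂ (at s i self eq)
    ... | inj₂ (at-root eq)     | no _   = inj₂ (at-root eq)
    ... | inj₂ (at t j t⊑s eq)  | no _   = inj₂ (at t j (below t⊑s) eq)
    ... | inj₁ p                | no ≢r  = inj₁
      (step-up {X = on (decorating s i) 0ℤ} {Y = ρ s i}
        (step-down {X = on s i} {Y = ρ s i}
          (subst (λ k → Near (avoiding edge r) ret₀ k (φ (on s i))) (ℕₚ.+-comm (height-spine s) ℤ.∣ i ∣)
            (near-trans p (spine-walk s i hi)))
          x→ρ[x] hi (ℕₚ.<⇒≤ h) (tree≢r (on s i) refl hi) ≢r)
        w[x]→ρ[x] h (ℕₚ.<⇒≤ h) (tree≢r (on (decorating s i) 0ℤ) refl h) ≢r)
      where
      hi : height (on s i) ≤ K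
      hi = ℕₚ.<⇒≤ (ℕₚ.<⇒≤ h)

  Injective : Spine → Spine → Set
  Injective s t = ∀ i j → height (on s i) ≤ M → height (on t j) ≤ M → φ (on s i) ≡ φ (on t j) → on s i ≡ on t j

  Injective-sym : ∀ {s t} → Injective s t → Injective t s
  Injective-sym inj i j h h′ eq = sym (inj j i h′ h (sym eq))

  -- The closing walk from the base of the spine decorating s i back to
  -- the vertex on s i either avoids their common reticulation, which is
  -- then on a short cycle, or it meets that reticulation elsewhere and
  -- produces a collision between less deep spines.
  collide : ∀ s i .{{_ : ℤ.NonZero i}} t → depth t ≤ suc (depth s) →
    (∀ u → u ⊑ t → Injective s u) → (∀ u → depth u ≤ depth s → Injective s u) →
    Injective (decorating s i) t
  collide s i t shallow below-t below-s j k hj hk eq = go (descend r-ret t (ℕₚ.≤-trans ht M≤K)) (descend r-ret s (ℕₚ.≤-trans hs M≤K))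
    where
    r : Fin order
    r = φ (ρ s i)
    hr : height-spine (decorating s i) ≤ M
    hr = base≤M {decorating s i} {j} hj
    hi : height (on s i) ≤ M
    hi = ℕₚ.<⇒≤ (ℕₚ.<⇒≤ hr)
    hs : height-spine s ≤ M
    hs = base≤M {s} {i} hi
    ht : height-spine t ≤ M
    ht = base≤M {t} {k} hk
    x⟶r : φ (on s i) ⟶ r
    x⟶r = φ-edge (x→ρ[x] {s} {i}) (ℕₚ.≤-trans hi M≤K) (ℕₚ.≤-trans (ℕₚ.<⇒≤ hr) M≤K)
    w⟶r : base (decorating s i) ⟶ r
    w⟶r = φ-edge (w[x]→ρ[x] {s} {i}) (ℕₚ.≤-trans hr M≤K) (ℕₚ.≤-trans (ℕₚ.<⇒≤ hr) M≤K)
    r-ret : mark r ≡ reticulation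
    r-ret = φ-mark (ρ s i) (ℕₚ.≤-trans (ℕₚ.<⇒≤ hr) M≤K)
    hit⇒ : ∀ {u l} .{{_ : ℤ.NonZero l}} → height-spine (decorating u l) ≤ M → φ (ρ u l) ≡ r →
      φ (on s i) ≡ φ (on u l) ⊎ φ (on s i) ≡ base (decorating u l)
    hit⇒ {u} {l} h eq = parents-of-ρ u l (ℕₚ.≤-trans (ℕₚ.<⇒≤ (ℕₚ.<⇒≤ h)) M≤K) (subst (φ (on s i) ⟶_) (sym eq) x⟶r)
    root-hit : ret₀ ≢ r
    root-hit eq with parents-of-ret₀ (subst (φ (on s i) ⟶_) (sym eq) x⟶r)
    ... | inj₁ eq′ = on-nonzero i (below-s p-spine z≤n i 0ℤ hi (ℕₚ.≤-trans (s≤s (s≤s z≤n)) hr) eq′)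
    ... | inj₂ eq′ = on-nonzero i (below-s q-spine z≤n i 0ℤ hi (ℕₚ.≤-trans (s≤s (s≤s z≤n)) hr) eq′)
    go : Near (avoiding edge r) ret₀ (height-spine t) (base t) ⊎ Hit r-ret t →
         Near (avoiding edge r) ret₀ (height-spine s) (base s) ⊎ Hit r-ret s →
         on (decorating s i) j ≡ on t k
    go (inj₂ (at-root eq′)) _ = contradiction eq′ root-hit
    go (inj₂ (at u l u⊑t eq′)) _ = lemma (hit⇒ {u} {l} hul eq′)
      where
      hul : height-spine (decorating u l) ≤ M
      hul = ℕₚ.≤-trans (⊑⇒height≤ u⊑t) ht
      lemma : φ (on s i) ≡ φ (on u l) ⊎ φ (on s i) ≡ base (decorating u l) → on (decorating s i) j ≡ on t k
      lemma (inj₂ eq″) = contradiction (below-t (decorating u l) u⊑t i 0ℤ hi hul eq″) (on-nonzero i)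
      lemma (inj₁ eq″) with below-t u (⊑-parent u⊑t) i l hi (ℕₚ.<⇒≤ (ℕₚ.<⇒≤ hul)) eq″
      -- Now `decorating s i ⊑ t`, and `t` is not deeper than `decorating s i`, so the two spines
      -- coincide and the collision happens on a single spine.
      ... | refl with ⊑-deep⇒≡ u⊑t shallow
      ...   | refl = spine-injective (decorating s i) j k (ℕₚ.≤-trans hj M≤K) (ℕₚ.≤-trans hk M≤K) eq
    go (inj₁ _) (inj₂ (at-root eq′)) = contradiction eq′ root-hit
    go (inj₁ _) (inj₂ (at u l u⊑s eq′)) = ⊥-elim (lemma (hit⇒ {u} {l} hul eq′))
      where
      hul : height-spine (decorating u l) ≤ M
      hul = ℕₚ.≤-trans (⊑⇒height≤ u⊑s) hs
      lemma : φ (on s i) ≡ φ (on u l) ⊎ φ (on s i) ≡ base (decorating u l) → ⊥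
      lemma (inj₂ eq″) = on-nonzero i (below-s (decorating u l) (⊑⇒depth≤ u⊑s) i 0ℤ hi hul eq″)
      lemma (inj₁ eq″) with below-s u (⊑⇒depth≤ (⊑-parent u⊑s)) i l hi (ℕₚ.<⇒≤ (ℕₚ.<⇒≤ hul)) eq″
      -- Here `decorating s i` would be an ancestor of `s`.
      ... | refl = ℕₚ.<-irrefl refl (⊑⇒depth≤ u⊑s)
    -- The walk follows the decorating spine to the collision, returns along `t` and its ancestors
    -- to `ret₀`, and descends to `s` and to the decorated vertex, all without meeting `r`.
    go (inj₁ p) (inj₁ q) = contradiction
      (r-ret , _ , _ , w⟶r , x⟶r , w≢x , near-mono bound
        (near-trans (near-trans to-collision (near-sym (near-trans p from-t))) (near-trans q from-s)))
      (acyclic-locally (near-mono (ℕₚ.≤-trans hr M≤K) (near-suc (φ-near (ρ s i) (ℕₚ.≤-trans (ℕₚ.<⇒≤ hr) M≤K)))))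
      where
      to-collision : Near (avoiding edge r) (base (decorating s i)) ℤ.∣ j ∣ (φ (on t k))
      to-collision = subst (Near (avoiding edge r) (base (decorating s i)) ℤ.∣ j ∣) eq
        (spine-walk r-ret (decorating s i) j (ℕₚ.≤-trans hj M≤K))
      from-t : Near (avoiding edge r) (base t) ℤ.∣ k ∣ (φ (on t k))
      from-t = spine-walk r-ret t k (ℕₚ.≤-trans hk M≤K)
      from-s : Near (avoiding edge r) (base s) ℤ.∣ i ∣ (φ (on s i))
      from-s = spine-walk r-ret s i (ℕₚ.≤-trans hi M≤K)
      w≢x : base (decorating s i) ≢ φ (on s i)
      w≢x eq′ = let h = ℕₚ.≤-trans hi M≤K in proj₁ (proj₂ (twin-correct (shift-correct s i h) h)) (sym eq′)
      bound : ℤ.∣ j ∣ + (height-spine t + ℤ.∣ k ∣) + (height-spine s + ℤ.∣ i ∣) ≤ L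
      bound = ℕₚ.≤-trans (ℕₚ.+-mono-≤ (ℕₚ.+-mono-≤
        (ℕₚ.≤-trans (ℕₚ.m≤m+n ℤ.∣ j ∣ _) hj)
        (ℕₚ.≤-trans (ℕₚ.≤-reflexive (ℕₚ.+-comm (height-spine t) _)) hk))
        (ℕₚ.≤-trans (ℕₚ.≤-reflexive (ℕₚ.+-comm (height-spine s) _)) hi)) 3M≤L

  -- A meeting point would join the two parents of `ret₀` by a short walk along the two spines,
  -- whose vertices are tree vertices and so avoid `ret₀`.
  p-q-disjoint : ∀ i j → height (on p-spine i) ≤ M → height (on q-spine j) ≤ M → φ (on p-spine i) ≢ φ (on q-spine j)
  p-q-disjoint i j hi hj eq = acyclic-locally (near-mono (ℕₚ.≤-trans (s≤s z≤n) M<K) (φ-near ρ₀ (ℕₚ.≤-trans (s≤s z≤n) M<K)))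
    (r-ret , _ , _ , proj₁ p₀-correct , proj₁ q₀-correct , proj₁ (proj₂ q₀-correct) , near-mono bound
      (near-trans (subst (Near (avoiding edge ret₀) (base p-spine) ℤ.∣ i ∣) eq (spine-walk r-ret p-spine i (ℕₚ.≤-trans hi M≤K)))
        (near-sym (spine-walk r-ret q-spine j (ℕₚ.≤-trans hj M≤K)))))
    where
    r-ret : mark ret₀ ≡ reticulation
    r-ret = proj₂ ret₀-correct
    bound : ℤ.∣ i ∣ + ℤ.∣ j ∣ ≤ L
    bound = ℕₚ.≤-trans (ℕₚ.+-mono-≤ (ℕₚ.≤-trans (ℕₚ.m≤m+n _ 2) hi) (ℕₚ.≤-trans (ℕₚ.m≤m+n _ 2) hj))
      (ℕₚ.≤-trans (ℕₚ.m≤m+n (M + M) M) 3M≤L)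

  -- Induction on the depth. `collide` replaces `decorating s i` by `s` but may keep the other spine
  -- at full depth; hence the intermediate `mixed`, where the bound has grown for one spine only. If
  -- `t` is too deep for `shallow`, the two spines exchange roles.
  injective-upto : ∀ D s t → depth s ≤ D → depth t ≤ D → Injective s t
  mixed : ∀ D s t → depth s ≤ suc D → depth t ≤ D → Injective s t
  mixed D p-spine t hs ht = injective-upto D p-spine t z≤n ht
  mixed D q-spine t hs ht = injective-upto D q-spine t z≤n ht
  mixed D (decorating s i) t (s≤s hs) ht with depth t ℕₚ.≤? suc (depth s)
  ... | yes shallow = collide s i t shallow
    (λ u u⊑t → injective-upto D s u hs (ℕₚ.≤-trans (⊑⇒depth≤ u⊑t) ht))
    (λ u hu → injective-upto D s u hs (ℕₚ.≤-trans hu hs))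
  ... | no deep = injective-upto D (decorating s i) t (ℕₚ.≤-trans (ℕₚ.<⇒≤ (ℕₚ.≰⇒> deep)) ht) ht
  injective-upto zero p-spine p-spine _ _ i j hi hj eq = spine-injective p-spine i j (ℕₚ.≤-trans hi M≤K) (ℕₚ.≤-trans hj M≤K) eq
  injective-upto zero p-spine q-spine _ _ i j hi hj eq = contradiction eq (p-q-disjoint i j hi hj)
  injective-upto zero q-spine p-spine _ _ i j hi hj eq = contradiction (sym eq) (p-q-disjoint j i hj hi)
  injective-upto zero q-spine q-spine _ _ i j hi hj eq = spine-injective q-spine i j (ℕₚ.≤-trans hi M≤K) (ℕₚ.≤-trans hj M≤K) eq
  injective-upto (suc D) p-spine t _ ht = Injective-sym {t} {p-spine} (mixed D t p-spine ht z≤n)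
  injective-upto (suc D) q-spine t _ ht = Injective-sym {t} {q-spine} (mixed D t q-spine ht z≤n)
  injective-upto (suc D) (decorating s i) t (s≤s hs) ht with depth t ℕₚ.≤? suc (depth s)
  ... | yes shallow = collide s i t shallow
    (λ u u⊑t → Injective-sym {u} {s} (mixed D u s (ℕₚ.≤-trans (⊑⇒depth≤ u⊑t) ht) hs))
    (λ u hu → Injective-sym {u} {s} (mixed D u s (ℕₚ.m≤n⇒m≤1+n (ℕₚ.≤-trans hu hs)) hs))
  ... | no deep = Injective-sym {t} {decorating s i}
    (mixed D t (decorating s i) ht (ℕₚ.≤-pred (ℕₚ.≤-trans (ℕₚ.≰⇒> deep) ht)))

  on-injective : ∀ s t → Injective s t
  on-injective s t = injective-upto (depth s + depth t) s t (ℕₚ.m≤m+n _ _) (ℕₚ.m≤n+m _ _)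

  private
    ρ₀≢ρ : ∀ s i .{{_ : ℤ.NonZero i}} → height (ρ s i) < M → ret₀ ≢ φ (ρ s i)
    ρ₀≢ρ s i h eq with parents-of-ret₀ (subst (φ (on s i) ⟶_) (sym eq)
                         (φ-edge (x→ρ[x] {s} {i}) (ℕₚ.≤-trans (ℕₚ.<⇒≤ (ℕₚ.<⇒≤ h)) M≤K) (ℕₚ.≤-trans (ℕₚ.<⇒≤ h) M≤K)))
    ... | inj₁ eq′ = on-nonzero i (on-injective s p-spine i 0ℤ (ℕₚ.<⇒≤ (ℕₚ.<⇒≤ h)) (ℕₚ.≤-trans (s≤s (s≤s z≤n)) h) eq′)
    ... | inj₂ eq′ = on-nonzero i (on-injective s q-spine i 0ℤ (ℕₚ.<⇒≤ (ℕₚ.<⇒≤ h)) (ℕₚ.≤-trans (s≤s (s≤s z≤n)) h) eq′)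

    -- The decorated vertex `on s i` must coincide in `N` with one of the two parents of the common
    -- reticulation. The parent on the decorating spine has height one more than `ρ t j`, which is
    -- why the heights are strictly below `M`.
    ρ-injective : ∀ s i t j .{{_ : ℤ.NonZero i}} .{{_ : ℤ.NonZero j}} → height (ρ s i) < M → height (ρ t j) < M →
      φ (ρ s i) ≡ φ (ρ t j) → _≡_ {A = R̂-Vertex} (ρ s i) (ρ t j)
    ρ-injective s i t j h h′ eq with parents-of-ρ t j (ℕₚ.≤-trans (ℕₚ.<⇒≤ (ℕₚ.<⇒≤ h′)) M≤K) (subst (φ (on s i) ⟶_) eq
                         (φ-edge (x→ρ[x] {s} {i}) (ℕₚ.≤-trans (ℕₚ.<⇒≤ (ℕₚ.<⇒≤ h)) M≤K) (ℕₚ.≤-trans (ℕₚ.<⇒≤ h) M≤K)))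
    ... | inj₂ eq′ = contradiction (on-injective s (decorating t j) i 0ℤ (ℕₚ.<⇒≤ (ℕₚ.<⇒≤ h)) h′ eq′) (on-nonzero i)
    ... | inj₁ eq′ with on-injective s t i j (ℕₚ.<⇒≤ (ℕₚ.<⇒≤ h)) (ℕₚ.<⇒≤ (ℕₚ.<⇒≤ h′)) eq′
    ...   | refl = refl

    above-leaf : ∀ {X Y X′ Y′} → R̂-Edge X X′ → R̂-Edge Y Y′ → height X′ ≤ M → height Y′ ≤ M → height X ≤ M → height Y ≤ M →
      R̂-mark X′ ≡ leaf → φ X′ ≡ φ Y′ → φ X ≡ φ Y
    above-leaf {X′ = X′} e f hX′ hY′ hX hY k eq = parent-unique (inj₂ (trans (φ-mark X′ (ℕₚ.≤-trans hX′ M≤K)) k))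
      (φ-edge e (ℕₚ.≤-trans hX M≤K) (ℕₚ.≤-trans hX′ M≤K))
      (subst (_ ⟶_) (sym eq) (φ-edge f (ℕₚ.≤-trans hY M≤K) (ℕₚ.≤-trans hY′ M≤K)))

  φ-injective : ∀ X Y → height X < M → height Y < M → φ X ≡ φ Y → X ≡ Y
  φ-injective X Y h h′ eq = go X Y h h′ eq
    (trans (sym (φ-mark X (ℕₚ.≤-trans (ℕₚ.<⇒≤ h) M≤K))) (trans (cong mark eq) (φ-mark Y (ℕₚ.≤-trans (ℕₚ.<⇒≤ h′) M≤K))))
    where
    go : ∀ X Y → height X < M → height Y < M → φ X ≡ φ Y → R̂-mark X ≡ R̂-mark Y → X ≡ Y
    go (on s i) (on t j) h h′ eq refl = on-injective s t i j (ℕₚ.<⇒≤ h) (ℕₚ.<⇒≤ h′) eq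
    go ρ₀       ρ₀       h h′ eq refl = refl
    go ρ₀       (ρ t j)  h h′ eq refl = contradiction eq (ρ₀≢ρ t j h′)
    go (ρ s i)  ρ₀       h h′ eq refl = contradiction (sym eq) (ρ₀≢ρ s i h)
    go (ρ s i)  (ρ t j)  h h′ eq refl = ρ-injective s i t j h h′ eq
    go ℓ₀       ℓ₀       h h′ eq refl = refl
    go ℓ₀       (ℓ t j)  h h′ eq refl = contradiction
      (above-leaf ρ₀→ℓ₀ (ρ[x]→ℓ[x] {t} {j}) (ℕₚ.<⇒≤ h) (ℕₚ.<⇒≤ h′) (ℕₚ.≤-trans (s≤s z≤n) h) (ℕₚ.<⇒≤ (ℕₚ.<⇒≤ h′)) refl eq)
      (ρ₀≢ρ t j (ℕₚ.<⇒≤ h′))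
    go (ℓ s i)  ℓ₀       h h′ eq refl = contradiction
      (sym (above-leaf (ρ[x]→ℓ[x] {s} {i}) ρ₀→ℓ₀ (ℕₚ.<⇒≤ h) (ℕₚ.<⇒≤ h′) (ℕₚ.<⇒≤ (ℕₚ.<⇒≤ h)) (ℕₚ.≤-trans (s≤s z≤n) h′) refl eq))
      (ρ₀≢ρ s i (ℕₚ.<⇒≤ h))
    go (ℓ s i)  (ℓ t j)  h h′ eq refl with ρ-injective s i t j (ℕₚ.<⇒≤ h) (ℕₚ.<⇒≤ h′)
      (above-leaf (ρ[x]→ℓ[x] {s} {i}) (ρ[x]→ℓ[x] {t} {j}) (ℕₚ.<⇒≤ h) (ℕₚ.<⇒≤ h′) (ℕₚ.<⇒≤ (ℕₚ.<⇒≤ h)) (ℕₚ.<⇒≤ (ℕₚ.<⇒≤ h′)) refl eq)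
    ... | refl = refl

-- From the covering map to an isomorphism of balls

module LocalIsomorphism {n} (N : Network n) (i₀ : Fin n) (r : ℕ)
  (ordinary : ∀ {v} → Near (Network.edge N) (Network.label N i₀) (3 + r) v → ¬ Kinds.Special N v)
  (acyclic-locally : ∀ {v} → Near (Network.edge N) (Network.label N i₀) (3 + r) v →
    ¬ ShortCycles.ShortCycle N ((2 + r) + (2 + r) + (2 + r)) v) where

  open Net N
  open Covering N i₀
  open Region (3 + r) ordinary
  open CoveringInjective N i₀ (3 + r) (2 + r) _ ordinary acyclic-locally ℕₚ.≤-refl ℕₚ.≤-refl using (φ-injective)

  private
    module G = RootedGraph (U r (markedGraph rootedAt label i₀))
    module H = RootedGraph (U r N̂ˡᶠ)

    lift : (v : G.Vertex) → ∃ λ X → height X ≤ r × φ X ≡ proj₁ v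
    lift (v , p) with lift-walk {r} (ℕₚ.m≤n+m r 3) (within⇒near N p)
    ... | X , h , eq = X , h , eq

    lift-origin : proj₁ (lift G.origin) ≡ ℓ₀
    lift-origin = refl

    to : G.Vertex → H.Vertex
    to v = let X , h , _ = lift v in X , within-mono h (height-within X)

    from : H.Vertex → G.Vertex
    from (X , p) = φ X , near⇒within N (near-mono h (φ-near X (ℕₚ.≤-trans h (ℕₚ.m≤n+m r 3))))
      where h = within⇒height p

    -- One height may be `1 + r`: `lift-edge` lifts an edge to a child `Z` before `Z` is known to
    -- lie in the ball.
    injective : ∀ {X Y} → height X ≤ r → height Y ≤ suc r → φ X ≡ φ Y → X ≡ Y
    injective h h′ = φ-injective _ _ (s≤s (ℕₚ.m≤n⇒m≤1+n h)) (s≤s h′)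

    lift-edge : ∀ v w → proj₁ v ⟶ proj₁ w → R̂-Edge (proj₁ (lift v)) (proj₁ (lift w))
    lift-edge v w e with lift v | lift w
    ... | X , h , refl | Y , h′ , eq with lift-child X (s≤s (ℕₚ.m≤n⇒m≤1+n (ℕₚ.m≤n⇒m≤1+n h))) e
    ...   | Z , e′ , eq′ = subst (R̂-Edge X)
      (sym (injective h′ (ℕₚ.≤-trans (proj₁ (height-edge e′)) (s≤s h)) (trans eq (sym eq′)))) e′

    project-edge : ∀ v w → R̂-Edge (proj₁ (lift v)) (proj₁ (lift w)) → proj₁ v ⟶ proj₁ w
    project-edge v w e with lift v | lift w
    ... | X , h , refl | Y , h′ , refl = φ-edge e (ℕₚ.≤-trans h (ℕₚ.m≤n+m r 3)) (ℕₚ.≤-trans h′ (ℕₚ.m≤n+m r 3))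

    lift-mark : ∀ v → R̂-mark (proj₁ (lift v)) ≡ mark (proj₁ v)
    lift-mark v with lift v
    ... | X , h , refl = sym (φ-mark X (ℕₚ.≤-trans h (ℕₚ.m≤n+m r 3)))

    lift-cong : ∀ v w → proj₁ v ≡ proj₁ w → proj₁ (lift v) ≡ proj₁ (lift w)
    lift-cong v w eq with lift v | lift w
    ... | X , h , p | Y , h′ , q = injective h (ℕₚ.m≤n⇒m≤1+n h′) (trans p (trans eq (sym q)))

    lift-φ : ∀ v X → height X ≤ r → proj₁ v ≡ φ X → proj₁ (lift v) ≡ X
    lift-φ v X h eq with lift v
    ... | Y , h′ , q = injective h′ (ℕₚ.m≤n⇒m≤1+n h) (trans q eq)

    φ-lift : ∀ v → φ (proj₁ (lift v)) ≡ proj₁ v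
    φ-lift v = proj₂ (proj₂ (lift v))

  isomorphism : U r (markedGraph rootedAt label i₀) ≅ U r N̂ˡᶠ
  isomorphism = record
    { bijection = record
      { to        = to
      ; from      = from
      ; to-cong   = λ {v} {w} → lift-cong v w
      ; from-cong = λ { refl → refl }
      ; inverse   = (λ {X} {v} eq → lift-φ v (proj₁ X) (within⇒height (proj₂ X)) eq)
                  , (λ {v} {X} eq → trans (cong φ eq) (φ-lift v))
      }
    ; origin-preserved = lift-origin
    ; mark-preserved   = lift-mark
    ; edge-preserved   = λ v w → mk⇔ (lift-edge v w) (project-edge v w)
    }

-- Counting bad outcomes

module BadOutcomes (n r : ℕ) where
  open Classes n

  K L : ℕ
  K = 3 + r
  L = (2 + r) + (2 + r) + (2 + r)

  private
    module Net′ (c : Fin size) = Network (representative c)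
    module Kinds′ (c : Fin size) = Kinds (representative c)
    module Short (c : Fin size) = ShortCycles (representative c) L

  Good : Pred (Fin size × Fin n) 0ℓ
  Good (c , i) = All (λ v → ¬ Kinds′.Special c v × ¬ Short.ShortCycle c v) (ball (Net′.edge c) K (Net′.label c i))

  good⇒≅ : ∀ {c i} → Good (c , i) →
    U r (Net′.markedGraph c rootedAt Net′.label c i) ≅ U r N̂ˡᶠ
  good⇒≅ {c} {i} good = LocalIsomorphism.isomorphism (representative c) i r
    (λ p → proj₁ (All.lookup good (∈-ball⁺ p))) (λ p → proj₂ (All.lookup good (∈-ball⁺ p)))

  good-vertex? : ∀ c → Decidable (λ v → ¬ Kinds′.Special c v × ¬ Short.ShortCycle c v)
  good-vertex? c v = ¬? (Kinds′.special? c v) ×-dec ¬? (Short.shortCycle? c v)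

  good? : Decidable Good
  good? (c , i) = All.all? (good-vertex? c) (ball (Net′.edge c) K (Net′.label c i))

  -- The ball is turned around, so that spoilt leaves can be counted around each obstruction.
  ¬good⇒ : ∀ {c i} → ¬ Good (c , i) → ∃ λ v →
    Near (Net′.edge c) v K (Net′.label c i) × (Kinds′.Special c v ⊎ Short.ShortCycle c v)
  ¬good⇒ {c} {i} bad with find (Allₚ.¬All⇒Any¬ (good-vertex? c) _ bad)
  ... | v , v∈ , ¬gv = v , near-sym (∈-ball⁻ K v∈) , cases (Kinds′.special? c v) (Short.shortCycle? c v)
    where
    cases : Dec (Kinds′.Special c v) → Dec (Short.ShortCycle c v) → Kinds′.Special c v ⊎ Short.ShortCycle c v
    cases (yes s) _       = inj₁ s
    cases (no _)  (yes s) = inj₂ s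
    cases (no ¬s) (no ¬t) = contradiction (¬s , ¬t) ¬gv

  allOutcomes goodOutcomes badOutcomes : List (Fin size × Fin n)
  allOutcomes  = Σ-list (allFin size) (λ _ → allFin n)
  goodOutcomes = filter good? allOutcomes
  badOutcomes  = filter (¬? ∘ good?) allOutcomes

  allOutcomes-unique : Unique allOutcomes
  allOutcomes-unique = Σ-list-unique (Uniqueₚ.allFin⁺ size) (λ _ → Uniqueₚ.allFin⁺ n)

  length-allOutcomes : size * n ≤ length allOutcomes
  length-allOutcomes = subst (λ k → k * n ≤ length allOutcomes) (length-tabulate {n = size} id)
    (length-Σ-list-≥ (allFin size) n (λ _ → ℕₚ.≤-reflexive (sym (length-tabulate {n = n} id))))

  module _ (J : ℕ) where

    private
      many? : Decidable (λ c → J ≤ length (Kinds′.treeLeaves c))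
      many? c = J ℕₚ.≤? length (Kinds′.treeLeaves c)

    many few : List (Fin size)
    many = filter many? (allFin size)
    few  = filter (¬? ∘ many?) (allFin size)

    many-unique : Unique many
    many-unique = Uniqueₚ.filter⁺ many? (Uniqueₚ.allFin⁺ size)

    few-unique : Unique few
    few-unique = Uniqueₚ.filter⁺ (¬? ∘ many?) (Uniqueₚ.allFin⁺ size)

    ∈-many⁺ : ∀ {c} → J ≤ length (Kinds′.treeLeaves c) → c ∈ many
    ∈-many⁺ {c} = ∈-filter⁺ many? (∈-allFin c)

    ∈-few⁺ : ∀ {c} → ¬ J ≤ length (Kinds′.treeLeaves c) → c ∈ few
    ∈-few⁺ {c} = ∈-filter⁺ (¬? ∘ many?) (∈-allFin c)

    ∈-many⁻ : ∀ {c} → c ∈ many → J ≤ length (Kinds′.treeLeaves c)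
    ∈-many⁻ p = proj₂ (∈-filter⁻ many? {xs = allFin size} p)

    ∈-few⁻ : ∀ {c} → c ∈ few → length (Kinds′.treeLeaves c) ≤ J
    ∈-few⁻ p = ℕₚ.<⇒≤ (ℕₚ.≰⇒> (proj₂ (∈-filter⁻ (¬? ∘ many?) {xs = allFin size} p)))

    length-few-≤ : length few ≤ size
    length-few-≤ = ℕₚ.≤-trans (⊆⇒length-≤ {ys = allFin size} few-unique (λ _ → ∈-allFin _))
      (ℕₚ.≤-reflexive (length-tabulate {n = size} id))

    cycles : List (Σ (Fin size) (λ c → Fin (Net′.order c)))
    cycles = CountShortCycles.shortCycles n L few few-unique

    private
      LeafVertex : Set
      LeafVertex = Σ (Fin size) (λ c → Fin (Net′.order c))

      around : LeafVertex → List LeafVertex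
      around (c , v) = map (λ u → c , u) (ball (Net′.edge c) K v)

      in-many near-special near-cycle : List LeafVertex
      in-many      = Σ-list many (λ c → map (Net′.label c) (allFin n))
      near-special = Σ-list few (λ c → concatMap (ball (Net′.edge c) K) (Kinds′.specials c))
      near-cycle   = concatMap around cycles

      leafVertex : Fin size × Fin n → LeafVertex
      leafVertex (c , i) = c , Net′.label c i

      near-special⁺ : ∀ {c i v} → c ∈ few → v ∈ Kinds′.specials c → Near (Net′.edge c) v K (Net′.label c i) →
        leafVertex (c , i) ∈ near-special
      near-special⁺ {c} c∈ v∈ close =
        ∈-Σ-list⁺ c∈ (∈-concatMap⁺ (ball (Net′.edge c) K) {xs = Kinds′.specials c} (lose v∈ (∈-ball⁺ close)))

      near-cycle⁺ : ∀ {c i v} → (c , v) ∈ cycles → Near (Net′.edge c) v K (Net′.label c i) →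
        leafVertex (c , i) ∈ near-cycle
      near-cycle⁺ {c} cv∈ close = ∈-concatMap⁺ around {xs = cycles} (lose cv∈ (∈-map⁺ (λ u → c , u) (∈-ball⁺ close)))

      covered : ∀ {ω} → ω ∈ badOutcomes → leafVertex ω ∈ in-many ++ near-special ++ near-cycle
      covered {c , i} ω∈ = go (many? c) (¬good⇒ (proj₂ (∈-filter⁻ (¬? ∘ good?) {xs = allOutcomes} ω∈)))
        where
        go : Dec (J ≤ length (Kinds′.treeLeaves c)) →
          (∃ λ v → Near (Net′.edge c) v K (Net′.label c i) × (Kinds′.Special c v ⊎ Short.ShortCycle c v)) →
          leafVertex (c , i) ∈ in-many ++ near-special ++ near-cycle
        go (yes p) _                     = ∈-++⁺ˡ (∈-Σ-list⁺ (∈-many⁺ p) (∈-map⁺ (Net′.label c) (∈-allFin i)))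
        go (no ¬p) (v , close , inj₁ s) = ∈-++⁺ʳ in-many (∈-++⁺ˡ
          (near-special⁺ (∈-few⁺ ¬p) (∈-satisfying⁺ (Kinds′.special? c) s) close))
        go (no ¬p) (v , close , inj₂ s) = ∈-++⁺ʳ in-many (∈-++⁺ʳ near-special
          (near-cycle⁺ (∈-Σ-list⁺ (∈-few⁺ ¬p) (∈-satisfying⁺ (Short.shortCycle? c) s)) close))

      length-near-special : ∀ {c} → c ∈ few → length (concatMap (ball (Net′.edge c) K) (Kinds′.specials c)) ≤ 2 * J * 4 ^ K
      length-near-special {c} p = ℕₚ.≤-trans
        (length-concatMap-≤ (ball (Net′.edge c) K) (Kinds′.specials c) (4 ^ K)
          (λ {v} _ → Balls.length-ball-≤ (representative c) K v))
        (ℕₚ.*-monoˡ-≤ (4 ^ K) (ℕₚ.≤-trans (Kinds′.length-specials-≤ c) (ℕₚ.*-monoʳ-≤ 2 (∈-few⁻ p))))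

    -- In a network with many tree leaves all `n` leaves count as bad. In the others each of the at
    -- most `2 * J` special vertices, and each reticulation on a short cycle, spoils at most `4 ^ K`
    -- leaves.
    length-badOutcomes : length badOutcomes ≤ length many * n + (size * (2 * J * 4 ^ K) + length cycles * 4 ^ K)
    length-badOutcomes = begin
      length badOutcomes
        ≤⟨ length-≤ {R = λ ω x → leafVertex ω ≡ x} (Uniqueₚ.filter⁺ (¬? ∘ good?) allOutcomes-unique)
             (λ p → _ , covered p , refl) (λ _ _ p q → leafVertex-injective (trans p (sym q))) ⟩
      length (in-many ++ near-special ++ near-cycle)
        ≡⟨ trans (length-++ in-many) (cong (length in-many +_) (length-++ near-special)) ⟩
      length in-many + (length near-special + length near-cycle)
        ≤⟨ ℕₚ.+-mono-≤
             (length-Σ-list-≤ many n (λ {c} _ → ℕₚ.≤-reflexive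
               (trans (length-map (Net′.label c) (allFin n)) (length-tabulate {n = n} id))))
             (ℕₚ.+-mono-≤
               (ℕₚ.≤-trans (length-Σ-list-≤ few (2 * J * 4 ^ K) length-near-special)
                 (ℕₚ.*-monoˡ-≤ (2 * J * 4 ^ K) length-few-≤))
               (length-concatMap-≤ around cycles (4 ^ K) (λ {(c , v)} _ →
                 ℕₚ.≤-trans (ℕₚ.≤-reflexive (length-map _ (ball (Net′.edge c) K v)))
                   (Balls.length-ball-≤ (representative c) K v)))) ⟩
      length many * n + (size * (2 * J * 4 ^ K) + length cycles * 4 ^ K) ∎
      where
      open ℕₚ.≤-Reasoning
      leafVertex-injective : ∀ {ω ω′} → leafVertex ω ≡ leafVertex ω′ → ω ≡ ω′
      leafVertex-injective {c , i} {d , j} eq with cong proj₁ eq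
      ... | refl = cong (c ,_) (Net′.label-injective c i j (second eq))
        where
        second : ∀ {u w} → _≡_ {A = LeafVertex} (c , u) (c , w) → u ≡ w
        second refl = refl

    length-many : length many * J * (J ∸ 2) ≤ size * (4 * n)
    length-many = CountTreeLeaves.length-manyTreeLeaves n many many-unique J ∈-many⁻

    length-cycles : length cycles * (n ∸ J ∸ 4 ^ (2 + L)) ≤ size * (4 * n) * 4 ^ L
    length-cycles = CountShortCycles.length-shortCycles n L few few-unique (n ∸ J ∸ 4 ^ (2 + L))
      (λ p → ℕₚ.∸-monoˡ-≤ (4 ^ (2 + L)) (ℕₚ.∸-monoʳ-≤ n (∈-few⁻ p)))

-- X networks have at least J tree leaves, and Y short cycles lie in the
-- others; Δ, A and B bound the sizes of balls.  The choice J ≈ n / (6 q Δ)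
-- gives each of the three kinds of bad outcome probability at most 1 / (3 q).
module Estimates (q Δ A B : ℕ) .{{_ : NonZero B}} where

  -- The term `6 * q * Δ` of `period` serves `special-estimate`; the `2` makes the divisor nonzero
  -- and gives `J + J ≤ n`. The threshold forces `3 + D + A + F ≤ J`, where `3 + D` is for
  -- `many-estimate` and `A + F` for `cycle-estimate`.
  D F period threshold : ℕ
  period    = 2 + 6 * q * Δ
  D         = 12 * q * period
  F         = 12 * q * Δ * B
  threshold = (3 + D + A + F) * period

  module _ (n : ℕ) (large : threshold ≤ n) where

    J : ℕ
    J = n / period

    private
      n≡ : n ≡ n % period + J * period
      n≡ = m≡m%n+[m/n]*n n period

      J-large : 3 + D + A + F ≤ J
      J-large = subst (_≤ J) (m*n/n≡m (3 + D + A + F) period) (/-monoˡ-≤ period large)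

      J*period≤n : J * period ≤ n
      J*period≤n = subst (J * period ≤_) (sym n≡) (ℕₚ.m≤n+m (J * period) (n % period))

      n≤[1+J]*period : n ≤ suc J * period
      n≤[1+J]*period = subst (_≤ suc J * period) (sym n≡) (ℕₚ.+-monoˡ-≤ (J * period) (ℕₚ.<⇒≤ (m%n<n n period)))

      instance
        n-nonZero : NonZero n
        n-nonZero = >-nonZero (ℕₚ.≤-trans (s≤s z≤n) large)

    many-estimate : ∀ S X → X * J * (J ∸ 2) ≤ S * (4 * n) → 3 * q * (X * n) ≤ S * n
    many-estimate S X h = begin
      3 * q * (X * n)  ≡⟨ ℕₚ.*-assoc (3 * q) X n ⟨
      3 * q * X * n    ≤⟨ ℕₚ.*-monoˡ-≤ n (ℕₚ.*-cancelʳ-≤ (3 * q * X) S (4 * n) {{ℕₚ.m*n≢0 4 n}} scaled) ⟩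
      S * n            ∎
      where
      open ℕₚ.≤-Reasoning
      -- Rounding costs one summand `D` in `(1 + J) * D`, and `J ∸ 2` costs two more units;
      -- `3 + D ≤ J` pays for both.
      large-enough : 12 * q * n ≤ J * (J ∸ 2)
      large-enough = begin
        12 * q * n                  ≤⟨ ℕₚ.*-monoʳ-≤ (12 * q) n≤[1+J]*period ⟩
        12 * q * (suc J * period)   ≡⟨ regroup (12 * q) J period ⟩
        D + J * D                   ≤⟨ ℕₚ.+-monoˡ-≤ (J * D) D≤J ⟩
        J + J * D                   ≡⟨ ℕₚ.*-suc J D ⟨
        J * suc D                   ≤⟨ ℕₚ.*-monoʳ-≤ J (ℕₚ.m+n≤o⇒m≤o∸n (suc D) (subst (_≤ J) (ℕₚ.+-comm 2 (suc D)) 3+D≤J)) ⟩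
        J * (J ∸ 2)                 ∎
        where
        regroup : ∀ a j p → a * (suc j * p) ≡ a * p + j * (a * p)
        regroup = solve-∀
        3+D≤J : 3 + D ≤ J
        3+D≤J = ℕₚ.≤-trans (ℕₚ.≤-trans (ℕₚ.m≤m+n (3 + D) A) (ℕₚ.m≤m+n (3 + D + A) F)) J-large
        D≤J : D ≤ J
        D≤J = ℕₚ.≤-trans (ℕₚ.m≤n+m D 3) 3+D≤J
      scaled : 3 * q * X * (4 * n) ≤ S * (4 * n)
      scaled = begin
        3 * q * X * (4 * n)   ≡⟨ regroup q X n ⟩
        X * (12 * q * n)      ≤⟨ ℕₚ.*-monoʳ-≤ X large-enough ⟩
        X * (J * (J ∸ 2))     ≡⟨ ℕₚ.*-assoc X J (J ∸ 2) ⟨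
        X * J * (J ∸ 2)       ≤⟨ h ⟩
        S * (4 * n)           ∎
        where
        regroup : ∀ q X n → 3 * q * X * (4 * n) ≡ X * (12 * q * n)
        regroup = solve-∀

    special-estimate : ∀ S → 3 * q * (S * (2 * J * Δ)) ≤ S * n
    special-estimate S = begin
      3 * q * (S * (2 * J * Δ))   ≡⟨ regroup q S J Δ ⟩
      S * (J * (6 * q * Δ))       ≤⟨ ℕₚ.*-monoʳ-≤ S (ℕₚ.*-monoʳ-≤ J (ℕₚ.m≤n+m (6 * q * Δ) 2)) ⟩
      S * (J * period)            ≤⟨ ℕₚ.*-monoʳ-≤ S J*period≤n ⟩
      S * n                       ∎
      where
      open ℕₚ.≤-Reasoning
      regroup : ∀ q S J Δ → 3 * q * (S * (2 * J * Δ)) ≡ S * (J * (6 * q * Δ))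
      regroup = solve-∀

    cycle-estimate : ∀ S Y → Y * (n ∸ J ∸ A) ≤ S * (4 * n) * B → 3 * q * (Y * Δ) ≤ S * n
    cycle-estimate S Y h = ℕₚ.*-cancelʳ-≤ (3 * q * (Y * Δ)) (S * n) (4 * B) {{ℕₚ.m*n≢0 4 B}} (begin
      3 * q * (Y * Δ) * (4 * B)   ≡⟨ regroup q Y Δ B ⟩
      Y * F                       ≤⟨ ℕₚ.*-monoʳ-≤ Y F≤ ⟩
      Y * (n ∸ J ∸ A)             ≤⟨ h ⟩
      S * (4 * n) * B             ≡⟨ regroup′ S n B ⟩
      S * n * (4 * B)             ∎)
      where
      open ℕₚ.≤-Reasoning
      regroup : ∀ q Y Δ B → 3 * q * (Y * Δ) * (4 * B) ≡ Y * (12 * q * Δ * B)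
      regroup = solve-∀
      regroup′ : ∀ S n B → S * (4 * n) * B ≡ S * n * (4 * B)
      regroup′ = solve-∀
      J+J≤n : J + J ≤ n
      J+J≤n = begin
        J + J                     ≡⟨ double J ⟩
        J * 2                     ≤⟨ ℕₚ.*-monoʳ-≤ J (ℕₚ.m≤m+n 2 (6 * q * Δ)) ⟩
        J * period                ≤⟨ J*period≤n ⟩
        n                         ∎
        where
        double : ∀ j → j + j ≡ j * 2
        double = solve-∀
      -- At least `J` remains of `n ∸ J`, and `J` is at least `A + F`.
      F≤ : F ≤ n ∸ J ∸ A
      F≤ = ℕₚ.m+n≤o⇒m≤o∸n F (ℕₚ.≤-trans (begin
        F + A              ≡⟨ ℕₚ.+-comm F A ⟩
        A + F              ≤⟨ ℕₚ.m≤n+m (A + F) (3 + D) ⟩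
        3 + D + (A + F)    ≡⟨ ℕₚ.+-assoc (3 + D) A F ⟨
        3 + D + A + F      ≤⟨ J-large ⟩
        J                  ∎) (ℕₚ.m+n≤o⇒m≤o∸n J J+J≤n))

-- Convergence

theorem1p9 : uniformNetworkAtLeaf ⟶ᵈ N̂ˡᶠ
theorem1p9 r k = threshold , λ n large → let open BadOutcomes n r hiding (K; L) in record
  { outcomes = goodOutcomes
  ; unique   = Uniqueₚ.filter⁺ good? allOutcomes-unique
  ; all      = All.map good⇒≅ (Allₚ.all-filter good? allOutcomes)
  ; enough   = enough n large
  }
  where
  q K L : ℕ
  q = suc k
  K = 3 + r
  L = (2 + r) + (2 + r) + (2 + r)

  open Estimates q (4 ^ K) (4 ^ (2 + L)) (4 ^ L) {{ℕₚ.m^n≢0 4 L}}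

  module _ (n : ℕ) (large : threshold ≤ n) where
    open BadOutcomes n r hiding (K; L)
    open Classes n using (size)
    open ℕₚ.≤-Reasoning

    -- After multiplication by 3, each of the three kinds of bad outcome uses up one copy of
    -- `size * n`.
    few-bad : q * length badOutcomes ≤ size * n
    few-bad = ℕₚ.*-cancelˡ-≤ 3 (begin
      3 * (q * length badOutcomes)
        ≡⟨ ℕₚ.*-assoc 3 q (length badOutcomes) ⟨
      3 * q * length badOutcomes
        ≤⟨ ℕₚ.*-monoʳ-≤ (3 * q) (length-badOutcomes j) ⟩
      3 * q * (length (many j) * n + (size * (2 * j * 4 ^ K) + length (cycles j) * 4 ^ K))
        ≡⟨ distribute (3 * q) (length (many j) * n) (size * (2 * j * 4 ^ K)) (length (cycles j) * 4 ^ K) ⟩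
      3 * q * (length (many j) * n) + (3 * q * (size * (2 * j * 4 ^ K)) + 3 * q * (length (cycles j) * 4 ^ K))
        ≤⟨ ℕₚ.+-mono-≤ (many-estimate n large size (length (many j)) (length-many j)) (ℕₚ.+-mono-≤ (special-estimate n large size)
             (cycle-estimate n large size (length (cycles j)) (length-cycles j))) ⟩
      size * n + (size * n + size * n)
        ≡⟨ triple (size * n) ⟩
      3 * (size * n) ∎)
      where
      j : ℕ
      j = J n large
      distribute : ∀ a x y z → a * (x + (y + z)) ≡ a * x + (a * y + a * z)
      distribute = solve-∀
      triple : ∀ x → x + (x + x) ≡ 3 * x
      triple = solve-∀

    -- A proportion of at most `1 / q` of bad outcomes leaves `k / (1 + k)`. Adding the bad outcomes
    -- on both sides avoids truncated subtraction.
    enough : size * n * k ≤ length goodOutcomes * suc k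
    enough = ℕₚ.+-cancelʳ-≤ (q * length badOutcomes) _ _ (begin
      size * n * k + q * length badOutcomes
        ≤⟨ ℕₚ.+-monoʳ-≤ (size * n * k) few-bad ⟩
      size * n * k + size * n
        ≡⟨ collect (size * n) k ⟩
      size * n * q
        ≤⟨ ℕₚ.*-monoˡ-≤ q length-allOutcomes ⟩
      length allOutcomes * q
        ≡⟨ cong (_* q) (length-filter-¬ good? allOutcomes) ⟨
      (length goodOutcomes + length badOutcomes) * q
        ≡⟨ split (length goodOutcomes) (length badOutcomes) q ⟩
      length goodOutcomes * q + q * length badOutcomes ∎)
      where
      collect : ∀ x k → x * k + x ≡ x * suc k
      collect = solve-∀
      split : ∀ g b q → (g + b) * q ≡ g * q + q * b
      split = solve-∀
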